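{- Let $t\not\equiv 0\pmod 4$ be a fixed positive integer and let $n$ and $k<n$ be positive integers such that $t\mid 2nk$ and such that one of the following holds: (1) $nk$ is odd, $n\geq k\geq 3$, and $\gcd(n,k-1)=1$; (2) $nk$ is odd, $n\geq k$, and $3<k<200$; (3) $nk$ is odd, $n\geq k\geq 3$, and $n\geq (k-2)(k-1)$. Set $v=2nk+t$. Then there is a family of pairwise non-isomorphic biembeddings $\Pi$ of $K_{\frac{v}{t}\times t}$ such that (a) $\mathrm{Aut}(\Pi)=\mathbb{Z}_{v}$, (b) the faces determined by $\Pi$ have lengths multiples of $k$ strictly greater than $k$, whose cardinality is at least $$\left(1-\frac{2n}{nk-(k-1)}\right)\left(1-O\left(\tfrac{1}{nk}\right)\right)\frac{(nk)!}{2\phi(2nk+t)}=\left(1-O\left(\tfrac1k\right)\right)(1-o(1))\frac{\left(\frac{v-t}{2}\right)!}{2\phi(v)},$$ where the term $\left(1-O\left(\frac1k\right)\right)=1-\frac{2n}{nk-(k-1)}$ is strictly positive for any $k\geq 3$. Moreover, if $v$ is a prime (that can occur only if $t=1$), all the biembeddings of $K_v$ in this family are $kv$-gonal.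
   Context: $\phi(\cdot)$ is Euler's totient function. Asymptotic convention: $t$ is fixed, the constant implied in $O(\frac{1}{nk})$ depends only on $t$, and $o(1)$ is for $nk\to\infty$. $K_{\frac{v}{t}\times t}$ is the complete multipartite graph with $v/t$ parts of size $t$ (so it is $K_v$ when $t=1$); its vertex set is identified with $\mathbb{Z}_v$, two vertices being adjacent iff their difference is not in the subgroup $J=\frac{v}{t}\mathbb{Z}_v$ of order $t$. A (combinatorial, orientable) embedding of a connected graph $\Gamma$ is a pair $\Pi=(\Gamma,\rho)$ where $\rho$ is a permutation of the oriented edges with $\rho(x,y)=(x,\rho_x(y))$, each $\rho_x$ being a cyclic permutation of all neighbours of $x$; this is equivalent to a cellular embedding into an orientable surface. Face boundaries are traced by the orbits of $(x,y)\mapsto\rho(y,x)$; the length of a face is the length of the orbit. A biembedding is an embedding whose faces can be coloured with two colours so that each edge lies on one face of each colour. An embedding is $\ell$-gonal if all its faces have length $\ell$. Two embeddings $(\Gamma,\rho)$ and $(\Gamma',\rho')$ are isomorphic if there is a graph isomorphism $\sigma:\Gamma\to\Gamma'$ (acting on oriented edges by $\sigma(x,y)=(\sigma(x),\sigma(y))$) such that either $\sigma\circ\rho=\rho'\circ\sigma$ or $\sigma\circ\rho=(\rho')^{ -1}\circ\sigma$. $\mathrm{Aut}(\Pi)$ is the group of isomorphisms from $\Pi$ to itself; $\mathrm{Aut}(\Pi)=\mathbb{Z}_v$ means that it consists exactly of the translations $\tau_g(x)=x+g$, $g\in\mathbb{Z}_v$. -}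

module Defs where

open import Data.Bool.Base using (Bool)
open import Data.Fin.Base using (Fin; toℕ)
open import Data.Fin.Properties using (toℕ-fromℕ<; toℕ≤n)
import Data.Integer.Base as ℤ
open import Data.List.Base using (length; filter; map; upTo; applyUpTo)
open import Data.List.Properties using (filter-accept)
open import Data.Nat.Base using (ℕ; suc; _+_; _*_; _∸_; _≤_; _<_; NonZero; >-nonZero)
open import Data.Nat.Divisibility using (_∣_; _∣?_; m/n∣m; ∣n∣m%n⇒∣m; %-presˡ-∣; ∣m+n∣m⇒∣n; ∣m∣n⇒∣m+n; ∣-refl)
open import Data.Nat.DivMod using (_/_; _%_; _mod_; m%n<n)
open import Data.Nat.GCD using (gcd; gcd-zeroˡ)
open import Data.Nat.GeneralisedArithmetic using (iterate)
open import Data.Nat.Properties using (_≟_; +-comm; +-assoc; m+[n∸m]≡n; m∸n+n≡m; m*n≢0; m<n⇒0<n∸m; m≤n*m)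
open import Data.Product.Base using (Σ-syntax; ∃; ∃-syntax; _×_)
open import Data.Rational.Base as ℚ using (ℚ; 0ℚ)
open import Data.Sum.Base using (_⊎_)
open import Function.Bundles using (_↔_; _⇔_; module Inverse; module Equivalence)
open import Relation.Binary.Construct.Closure.ReflexiveTransitive using (Star)
open import Relation.Binary.Core using (Rel)
open import Relation.Binary.Definitions using (Symmetric; Decidable)
open import Relation.Binary.PropositionalEquality using (_≡_; _≢_; sym; cong; subst; module ≡-Reasoning)
open import Relation.Nullary using (¬_; ¬?)

record Graph (v : ℕ) : Set₁ where
  field
    Adj    : Rel (Fin v) _
    adj?   : Decidable Adj
    irrefl : ∀ {x} → ¬ Adj x x
    symm   : Symmetric Adj

open Graph public

Connected : ∀ {v} → Graph v → Set
Connected Γ = ∀ x y → Star (Adj Γ) x y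

-- An oriented edge.  Adjacency is decidable, so the irrelevant proof can be
-- recomputed, and two darts with the same endpoints are equal.
record Dart {v : ℕ} (Γ : Graph v) : Set where
  constructor dart
  field
    src tgt : Fin v
    .edge   : Adj Γ src tgt

open Dart public using (src; tgt)

reverse : ∀ {v} {Γ : Graph v} → Dart Γ → Dart Γ
reverse {Γ = Γ} (dart x y xy) = dart y x (symm Γ xy)

-- ρ permutes the oriented edges leaving each x, and does so in one single
-- cycle: this is ρ(x,y) = (x,ρₓ(y)) with ρₓ cyclic on the neighbours of x.
record Embedding {v : ℕ} (Γ : Graph v) : Set where
  field
    connected  : Connected Γ
    ρ          : Dart Γ ↔ Dart Γ
    ρ-src      : ∀ d → src (Inverse.to ρ d) ≡ src d
    ρ-cyclic   : ∀ d e → src d ≡ src e → ∃[ m ] iterate (Inverse.to ρ) d m ≡ e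

  rot rot⁻¹ : Dart Γ → Dart Γ
  rot   = Inverse.to ρ
  rot⁻¹ = Inverse.from ρ

  faceStep : Dart Γ → Dart Γ
  faceStep d = rot (reverse d)

open Embedding public

module _ {v : ℕ} {Γ : Graph v} (Π : Embedding Γ) where

  -- The face containing d, i.e. the orbit of d under faceStep, has ℓ elements.
  HasFaceLength : Dart Γ → ℕ → Set
  HasFaceLength d ℓ =
      0 < ℓ
    × iterate (faceStep Π) d ℓ ≡ d
    × (∀ j → 0 < j → j < ℓ → iterate (faceStep Π) d j ≢ d)

  Gonal : ℕ → Set
  Gonal ℓ = ∀ d → HasFaceLength d ℓ

  -- A colouring of the faces is a colouring of the darts constant on orbits
  -- of faceStep.  The two faces on which an edge lies are those containing
  -- its two orientations.
  IsBiembedding : Set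
  IsBiembedding = Σ[ colour ∈ (Dart Γ → Bool) ]
      (∀ d → colour (faceStep Π d) ≡ colour d)
    × (∀ d → colour (reverse d) ≢ colour d)

record GraphIso {v w : ℕ} (Γ : Graph v) (Γ′ : Graph w) : Set where
  field
    vertices : Fin v ↔ Fin w
    adjacent : ∀ x y → Adj Γ x y ⇔ Adj Γ′ (Inverse.to vertices x) (Inverse.to vertices y)

  onVertex : Fin v → Fin w
  onVertex = Inverse.to vertices

  onDart : Dart Γ → Dart Γ′
  onDart (dart x y xy) = dart (onVertex x) (onVertex y) (Equivalence.to (adjacent x y) xy)

open GraphIso public using (onVertex; onDart)

module _ {v w : ℕ} {Γ : Graph v} {Γ′ : Graph w} where

  IsEmbeddingIso : Embedding Γ → Embedding Γ′ → GraphIso Γ Γ′ → Set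
  IsEmbeddingIso Π Π′ σ =
      (∀ d → onDart σ (rot Π d) ≡ rot Π′ (onDart σ d))
    ⊎ (∀ d → onDart σ (rot Π d) ≡ rot⁻¹ Π′ (onDart σ d))

  Isomorphic : Embedding Γ → Embedding Γ′ → Set
  Isomorphic Π Π′ = ∃ (IsEmbeddingIso Π Π′)

module _ {v : ℕ} .{{_ : NonZero v}} where

  infixl 6 _⊕_ _⊖_

  _⊕_ _⊖_ : Fin v → Fin v → Fin v
  x ⊕ y = (toℕ x + toℕ y) mod v
  x ⊖ y = (toℕ x + (v ∸ toℕ y)) mod v

  -- Aut(Π) is exactly the set of translations x ↦ x + g.
  AutIsTranslations : {Γ : Graph v} → Embedding Γ → Set
  AutIsTranslations {Γ} Π =
      (∀ g → Σ[ σ ∈ GraphIso Γ Γ ] IsEmbeddingIso Π Π σ × (∀ x → onVertex σ x ≡ x ⊕ g))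
    × (∀ σ → IsEmbeddingIso Π Π σ → ∃[ g ] (∀ x → onVertex σ x ≡ x ⊕ g))

module _ (v t : ℕ) .{{_ : NonZero v}} .{{_ : NonZero t}} where

  -- The subgroup (v/t)ℤᵥ.  As v/t divides v, whether a residue class is a
  -- multiple of v/t can be read off its representative.
  J : Fin v → Set
  J g = v / t ∣ toℕ g

  private
    toℕ-⊖ : ∀ (x y : Fin v) → toℕ (x ⊖ y) ≡ (toℕ x + (v ∸ toℕ y)) % v
    toℕ-⊖ x y = toℕ-fromℕ< (m%n<n (toℕ x + (v ∸ toℕ y)) v)

    sum≡ : ∀ a b → a ≤ v → b ≤ v → (a + (v ∸ b)) + (b + (v ∸ a)) ≡ v + v
    sum≡ a b a≤v b≤v = begin
      (a + (v ∸ b)) + (b + (v ∸ a))  ≡⟨ cong ((a + (v ∸ b)) +_) (+-comm b (v ∸ a)) ⟩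
      (a + (v ∸ b)) + ((v ∸ a) + b)  ≡⟨ cong (_+ ((v ∸ a) + b)) (+-comm a (v ∸ b)) ⟩
      ((v ∸ b) + a) + ((v ∸ a) + b)  ≡⟨ +-assoc (v ∸ b) a _ ⟩
      (v ∸ b) + (a + ((v ∸ a) + b))  ≡⟨ cong ((v ∸ b) +_) (sym (+-assoc a (v ∸ a) b)) ⟩
      (v ∸ b) + ((a + (v ∸ a)) + b)  ≡⟨ cong (λ z → (v ∸ b) + (z + b)) (m+[n∸m]≡n a≤v) ⟩
      (v ∸ b) + (v + b)              ≡⟨ cong ((v ∸ b) +_) (+-comm v b) ⟩
      (v ∸ b) + (b + v)              ≡⟨ sym (+-assoc (v ∸ b) b v) ⟩
      ((v ∸ b) + b) + v              ≡⟨ cong (_+ v) (m∸n+n≡m b≤v) ⟩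
      v + v                          ∎
      where open ≡-Reasoning

    J-neg : t ∣ v → ∀ x y → J (x ⊖ y) → J (y ⊖ x)
    J-neg t∣v x y j = subst (v / t ∣_) (sym (toℕ-⊖ y x))
      (%-presˡ-∣ (∣m+n∣m⇒∣n m∣sum m∣x-y) m∣v)
      where
      m∣v = m/n∣m t∣v
      m∣x-y : v / t ∣ toℕ x + (v ∸ toℕ y)
      m∣x-y = ∣n∣m%n⇒∣m m∣v (subst (v / t ∣_) (toℕ-⊖ x y) j)
      m∣sum = subst (v / t ∣_) (sym (sum≡ (toℕ x) (toℕ y) (toℕ≤n x) (toℕ≤n y)))
                (∣m∣n⇒∣m+n m∣v m∣v)

    J-zero : t ∣ v → ∀ x → J (x ⊖ x)
    J-zero t∣v x = subst (v / t ∣_) (sym (toℕ-⊖ x x))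
      (%-presˡ-∣ (subst (v / t ∣_) (sym (m+[n∸m]≡n (toℕ≤n x))) m∣v) m∣v)
      where m∣v = m/n∣m t∣v

  -- v/t parts of size t, the parts being the cosets of J.
  K : t ∣ v → Graph v
  K t∣v = record
    { Adj    = λ x y → ¬ J (x ⊖ y)
    ; adj?   = λ x y → ¬? (v / t ∣? toℕ (x ⊖ y))
    ; irrefl = λ {x} ¬j → ¬j (J-zero t∣v x)
    ; symm   = λ {x} {y} ¬j j → ¬j (J-neg t∣v y x j)
    }

data Regime (n k : ℕ) : Set where
  coprime : ¬ (2 ∣ n * k) → k ≤ n → 3 ≤ k → gcd n (k ∸ 1) ≡ 1 → Regime n k
  small-k : ¬ (2 ∣ n * k) → k ≤ n → 3 < k → k < 200 → Regime n k
  large-n : ¬ (2 ∣ n * k) → k ≤ n → 3 ≤ k → (k ∸ 2) * (k ∸ 1) ≤ n → Regime n k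

record Admissible (t n k : ℕ) : Set where
  field
    k<n    : k < n
    t∣2nk  : t ∣ 2 * n * k
    regime : Regime n k

t∣2nk+t : ∀ {t n k} → Admissible t n k → t ∣ 2 * n * k + t
t∣2nk+t adm = ∣m∣n⇒∣m+n (Admissible.t∣2nk adm) ∣-refl

φ : ℕ → ℕ
φ n = length (filter (λ i → gcd i n ≟ 1) (map suc (upTo n)))

φ-nonZero : ∀ n .{{_ : NonZero n}} → NonZero (φ n)
φ-nonZero n@(suc m) =
  subst (λ xs → NonZero (length xs))
        (sym (filter-accept (λ i → gcd i n ≟ 1) {1} {map suc (applyUpTo suc m)} (gcd-zeroˡ n)))
        _

infix 7 _/2φ_

_/2φ_ : ℕ → (v : ℕ) .{{_ : NonZero v}} → ℚ
a /2φ v = ℚ._/_ (ℤ.+ a) (2 * φ v) {{m*n≢0 2 (φ v) {{_}} {{φ-nonZero v}}}}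

-- Rational functions of two positive integers n and k.
Fun₂ : Set
Fun₂ = ∀ (n k : ℕ) .{{_ : NonZero n}} .{{_ : NonZero k}} → ℚ

1/nk : Fun₂
1/nk n k = ℚ._/_ (ℤ.+ 1) (n * k) {{m*n≢0 n k}}

1/k : Fun₂
1/k n k = (ℤ.+ 1) ℚ./ k

private
  nk∸[k∸1]-nonZero : ∀ n k .{{_ : NonZero n}} .{{_ : NonZero k}} →
                     NonZero (n * k ∸ (k ∸ 1))
  nk∸[k∸1]-nonZero n k@(suc _) = >-nonZero (m<n⇒0<n∸m (m≤n*m k n))

-- 2n / (nk - (k-1)); the truncated subtractions are exact for positive n, k.
δ : Fun₂
δ n k = ℚ._/_ (ℤ.+ (2 * n)) (n * k ∸ (k ∸ 1)) {{nk∸[k∸1]-nonZero n k}}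

-- f = O(g) and f = o(1) as nk → ∞, for (n,k) ranging over the pairs
-- satisfying D.
IsBigO : (D : ℕ → ℕ → Set) → Fun₂ → Fun₂ → Set
IsBigO D f g = Σ[ C ∈ ℚ ]
  (∀ n k .{{_ : NonZero n}} .{{_ : NonZero k}} → D n k →
     ℚ.∣ f n k ∣ ℚ.≤ C ℚ.* ℚ.∣ g n k ∣)

IsLittleO1 : (D : ℕ → ℕ → Set) → Fun₂ → Set
IsLittleO1 D f = ∀ (η : ℚ) → 0ℚ ℚ.< η → Σ[ M ∈ ℕ ]
  (∀ n k .{{_ : NonZero n}} .{{_ : NonZero k}} → D n k → M ≤ n * k →
     ℚ.∣ f n k ∣ ℚ.< η)

{-# OPTIONS --safe #-}

-- Write N = n k.  Fix N cells and two permutations of them, row and col, all of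
-- whose cycles have length k and whose composite is a single N-cycle.  Placing
-- in the cells one element of each pair {x , -x} of residues outside J and
-- rotating by x ↦ - row x, - x ↦ col x gives a translation-invariant
-- biembedding, and its face lengths are k times the orders of the sums along
-- the cycles.  No Heffter array is needed, and a single pair (row , col) serves
-- all three regimes.
--
-- There are 2^N N! such placements, so a polynomial factor may be given away.
-- Prescribe the five entries at a cell a₀ and its neighbours in such a way that
--   a₀ + col a₀ + row a₀ = 0 = a₀ + col⁻¹ a₀ + row⁻¹ a₀,
-- and discard the placements with a zero sum along some cycle or with another
-- cell satisfying these two equations.  Up to orientation the equations are
-- isomorphism invariants of darts, so an isomorphism σ maps x + 1 to σ x ± 1,
-- and the asymmetry of the five values leaves only translations, whence equal
-- placements.  A coincidence is broken by exchanging one of its cells with any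
-- cell outside it, so at least 1/8 of the 2^N N! / (2N)^5 placements survive,
-- which exceeds N! when N is large.

module Submission where

open import Defs
open import Algebra.Bundles using (AbelianGroup)
import Algebra.Properties.AbelianGroup as AbelianGroupProperties
open import Data.Bool.Base using (Bool; true; false; not; if_then_else_)
import Data.Bool.Properties as Bool
open import Data.Empty using (⊥)
open import Data.Fin.Base using (Fin; toℕ; opposite; combine; remQuot; splitAt; punchIn; finToFun; funToFin; cast)
import Data.Fin.Base as Fin
open import Data.Fin.Permutation as Perm using (Permutation; _⟨$⟩ʳ_; _⟨$⟩ˡ_)
import Data.Fin.Permutation.Components as PC
open import Data.Fin.Properties as Fin using (toℕ-injective; toℕ<n; toℕ≤n; toℕ-fromℕ<; toℕ-combine; remQuot-combine; combine-remQuot; opposite-prop; finToFun-funToFin; funToFin-finToFin; *↔×; +↔⊎; 2↔Bool; punchIn-injective)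
import Data.Integer.Base as ℤ
import Data.Integer.Properties as ℤ
open import Data.Integer.Base using (+_)
open import Data.List.Base using (List; []; _∷_; _++_; length; filter; map; concatMap; lookup; allFin; cartesianProduct; applyUpTo)
open import Data.List.Membership.Propositional using (_∈_; _∉_)
open import Data.List.Membership.Propositional.Properties using (∈-∃++; ∈-++⁺ˡ; ∈-++⁺ʳ; ∈-++⁻; ∈-filter⁺; ∈-filter⁻; ∈-cartesianProduct⁺; ∈-cartesianProduct⁻; ∈-allFin; ∈-map⁺; ∈-lookup; ∈-concatMap⁺; ∈-applyUpTo⁺)
import Data.List.Properties as List
open import Data.Nat.ListAction using (sum)
open import Data.Nat.ListAction.Properties using (sum-++)
open import Data.List.Relation.Unary.All as All using (All; []; _∷_)
import Data.List.Relation.Unary.All.Properties as All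
open import Data.List.Relation.Unary.Any as Any using (Any; here; there)
import Data.List.Relation.Unary.Any.Properties as Any
open import Data.List.Relation.Unary.Unique.Propositional using (Unique; []; _∷_)
import Data.List.Relation.Unary.Unique.Propositional.Properties as Unique
open import Data.Nat.Base using (ℕ; zero; suc; NonZero; _+_; _*_; _∸_; _^_; _≤_; _<_; _!; z≤n; s≤s; s≤s⁻¹; >-nonZero; >-nonZero⁻¹)
open import Data.Nat.DivMod using (_%_; _mod_; m%n<n; m<n⇒m%n≡m; %-distribˡ-+; [m+n]%n≡m%n; n%n≡0; m*n%n≡0; m*n/n≡m) renaming (_/_ to _÷_)
open import Data.Nat.Divisibility using (_∣_; divides; ∣⇒≤; ∣m+n∣m⇒∣n; n∣m*n; m∣m*n; m%n≡0⇒n∣m; n∣m⇒m%n≡0; ∣n∣m%n⇒∣m)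
open import Data.Nat.GeneralisedArithmetic using (iterate)
open import Data.Nat.Primality using (Prime; euclidsLemma; prime⇒irreducible)
import Data.Nat.Properties as ℕ
open import Data.Nat.Tactic.RingSolver using (solve-∀)
open import Data.Product.Base using (Σ-syntax; ∃; ∃-syntax; _×_; _,_; proj₁; proj₂; uncurry)
open import Data.Product.Properties using (≡-dec; ,-injective; ×-≡,≡→≡)
open import Data.Rational.Base using (ℚ; 0ℚ; 1ℚ; _-_; _/_) renaming (_*_ to _·_; _≤_ to _≤ℚ_; _<_ to _<ℚ_)
import Data.Rational.Base as ℚ
import Data.Rational.Properties as ℚ
import Data.Rational.Unnormalised.Base as ℚᵘ
import Data.Rational.Unnormalised.Properties as ℚᵘ
open import Data.Sum.Base using (_⊎_; inj₁; inj₂; [_,_]′)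
import Data.Sum.Properties as Sum
open import Data.Unit.Base using (⊤; tt)
import Data.Unit.Properties as Unit
open import Function.Base using (_∘_; id; case_of_)
open import Function.Bundles using (_↔_; mk↔ₛ′; mk⇔; module Inverse)
open import Function.Construct.Composition using (_↔-∘_)
open import Function.Construct.Symmetry using (↔-sym)
open import Relation.Binary.Construct.Closure.ReflexiveTransitive using (Star; ε; _◅_)
open import Relation.Binary.Definitions using (DecidableEquality)
open import Relation.Binary.PropositionalEquality using (_≡_; _≢_; refl; sym; trans; cong; cong₂; subst; subst₂; module ≡-Reasoning; isEquivalence)
open import Relation.Nullary using (¬_; Dec; yes; no; ¬?; contradiction; _×-dec_; _⊎-dec_)
open import Relation.Nullary.Decidable using (map′; does)
import Relation.Nullary.Decidable as Dec
open import Relation.Nullary.Recomputable using (¬-recompute)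
open import Relation.Unary using (Decidable)

-- Two equations mark the cell because one would not do: up to constants a single equation holds at
-- a given other cell with probability 1/N, and with N such cells a union bound fails. Both
-- equations together have probability of order 1/N², except near the prescribed cells, of which
-- there are boundedly many. The zero lines are fewer, 2n in number, each of probability about 1/N;
-- together they cost about 2/k, which is below 1 already at k = 3 and is the dominant loss. The
-- pair (row , col) comes from conjugation: col is row conjugated by an involution, so its cycles
-- have length k for free and only the composite needs care. The array grows by splicing two rows at
-- a time into a single one, in agreement with parity: products of cycles of odd length are even
-- permutations, and an N-cycle is even exactly when N is odd.

injection⇒length≤ : ∀ {A B : Set} {xs : List A} {ys : List B} → Unique xs → (φ : A → B) →
  (∀ {x} → x ∈ xs → φ x ∈ ys) →
  (∀ {x y} → x ∈ xs → y ∈ xs → φ x ≡ φ y → x ≡ y) → length xs ≤ length ys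
injection⇒length≤ [] φ φ∈ inj = z≤n
injection⇒length≤ {xs = x ∷ xs} {ys} (x∉xs ∷ uxs) φ φ∈ inj with as , bs , refl ← ∈-∃++ (φ∈ (here refl)) =
  subst (suc (length xs) ≤_)
    (sym (trans (List.length-++ as) (trans (ℕ.+-suc (length as) (length bs)) (cong suc (sym (List.length-++ as))))))
    (s≤s (injection⇒length≤ uxs φ rest (λ p q → inj (there p) (there q))))
  where
  rest : ∀ {y} → y ∈ xs → φ y ∈ as ++ bs
  rest {y} y∈xs with ∈-++⁻ as (φ∈ (there y∈xs))
  ... | inj₁ p = ∈-++⁺ˡ p
  ... | inj₂ (there p) = ∈-++⁺ʳ as p
  ... | inj₂ (here e) = contradiction (inj (here refl) (there y∈xs) (sym e)) (All.lookup x∉xs y∈xs)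

length-cartesianProduct : ∀ {A B : Set} (xs : List A) (ys : List B) →
  length (cartesianProduct xs ys) ≡ length xs * length ys
length-cartesianProduct [] ys = refl
length-cartesianProduct (x ∷ xs) ys = trans (List.length-++ (map (x ,_) ys))
  (cong₂ _+_ (List.length-map _ ys) (length-cartesianProduct xs ys))

sum-map-≤ : ∀ {I : Set} (is : List I) (g : I → ℕ) {b c : ℕ} →
  (∀ {i} → i ∈ is → g i * b ≤ c) → sum (map g is) * b ≤ length is * c
sum-map-≤ [] g h = z≤n
sum-map-≤ (i ∷ is) g {b} {c} h = ℕ.≤-trans (ℕ.≤-reflexive (ℕ.*-distribʳ-+ b (g i) _))
  (ℕ.+-mono-≤ (h (here refl)) (sum-map-≤ is g (λ p → h (there p))))

-- Counting by injections and the union bound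

module Counting {Ω : Set} (all : List Ω) (all-unique : Unique all) (all-complete : ∀ ω → ω ∈ all) where

  # : {P : Ω → Set} → Decidable P → ℕ
  # P? = length (filter P? all)

  -- Double counting with advice: an outcome `φ ω y` in `Q` and the advice `h ω y` from `zs`
  -- together recover the pair (ω , y). Many `y` with little advice make `P` rare compared with `Q`;
  -- a single `y` with much advice bounds `P` by a multiple of `Q`.
  #-injection : ∀ {P Q : Ω → Set} (P? : Decidable P) (Q? : Decidable Q) {B D : Set}
    {ys : List B} → Unique ys → (zs : List D) (φ : Ω → B → Ω) (h : Ω → B → D) →
    (∀ ω y → P ω → y ∈ ys → Q (φ ω y) × h ω y ∈ zs) →
    (∀ ω y ω′ y′ → P ω → y ∈ ys → P ω′ → y′ ∈ ys →
       φ ω y ≡ φ ω′ y′ → h ω y ≡ h ω′ y′ → ω ≡ ω′ × y ≡ y′) →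
    # P? * length ys ≤ # Q? * length zs
  #-injection P? Q? {ys = ys} ys! zs φ h ok inj =
    subst₂ _≤_ (length-cartesianProduct (filter P? all) ys) (length-cartesianProduct (filter Q? all) zs)
      (injection⇒length≤ (Unique.cartesianProduct⁺ (Unique.filter⁺ P? all-unique) ys!)
        (λ (ω , y) → φ ω y , h ω y)
        (λ {(ω , y)} p → let a , b = mem p; c , d = ok ω y a b in
           ∈-cartesianProduct⁺ (∈-filter⁺ Q? (all-complete _) c) d)
        (λ {(ω , y)} {(ω′ , y′)} p q e → let a , b = mem p; a′ , b′ = mem q; e₁ , e₂ = ,-injective e in
           ×-≡,≡→≡ (inj ω y ω′ y′ a b a′ b′ e₁ e₂)))
    where
    mem : ∀ {ω y} → (ω , y) ∈ cartesianProduct (filter P? all) ys → _ × y ∈ ys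
    mem p = let a , b = ∈-cartesianProduct⁻ (filter P? all) ys p in proj₂ (∈-filter⁻ P? {xs = all} a) , b

  #-mono : ∀ {P Q : Ω → Set} (P? : Decidable P) (Q? : Decidable Q) → (∀ {ω} → P ω → Q ω) → # P? ≤ # Q?
  #-mono P? Q? imp = injection⇒length≤ (Unique.filter⁺ P? all-unique) id
    (λ p → ∈-filter⁺ Q? (all-complete _) (imp (proj₂ (∈-filter⁻ P? {xs = all} p)))) (λ _ _ e → e)

  #-⊎ : ∀ {P Q R : Ω → Set} (P? : Decidable P) (Q? : Decidable Q) (R? : Decidable R) →
    (∀ {ω} → P ω → Q ω ⊎ R ω) → # P? ≤ # Q? + # R?
  #-⊎ P? Q? R? imp = subst (_ ≤_) (List.length-++ (filter Q? all))
    (injection⇒length≤ (Unique.filter⁺ P? all-unique) id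
      (λ p → [ (λ q → ∈-++⁺ˡ (∈-filter⁺ Q? (all-complete _) q))
             , (λ r → ∈-++⁺ʳ (filter Q? all) (∈-filter⁺ R? (all-complete _) r)) ]′
             (imp (proj₂ (∈-filter⁻ P? {xs = all} p))))
      (λ _ _ e → e))

  -- Each event is absorbed in turn into the good set, so the induction has to vary `G`.
  #-union : ∀ {I : Set} {B : I → Ω → Set} (B? : ∀ i → Decidable (B i)) {P G : Ω → Set}
    (P? : Decidable P) (G? : Decidable G) (is : List I) →
    (∀ {ω} → P ω → G ω ⊎ Any (λ i → B i ω) is) → # P? ≤ # G? + sum (map (λ i → # (B? i)) is)
  #-union B? P? G? [] imp = subst (# P? ≤_) (sym (ℕ.+-identityʳ _))
    (#-mono P? G? (λ p → [ id , (λ ()) ]′ (imp p)))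
  #-union {B = B} B? P? G? (i ∷ is) imp = begin
    # P?  ≤⟨ #-union B? P? G∪B? is cover ⟩
    # G∪B? + sum (map (λ i → # (B? i)) is)  ≤⟨ ℕ.+-monoˡ-≤ _ (#-⊎ G∪B? G? (B? i) id) ⟩
    # G? + # (B? i) + sum (map (λ i → # (B? i)) is)  ≡⟨ ℕ.+-assoc (# G?) _ _ ⟩
    # G? + sum (map (λ i → # (B? i)) (i ∷ is))  ∎
    where
    open ℕ.≤-Reasoning
    G∪B? : Decidable (λ ω → _ ⊎ B i ω)
    G∪B? ω = G? ω ⊎-dec B? i ω
    cover : ∀ {ω} → _ → (_ ⊎ B i ω) ⊎ Any (λ i → B i ω) is
    cover p with imp p
    ... | inj₁ g = inj₁ (inj₁ g)
    ... | inj₂ (here b) = inj₁ (inj₂ b)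
    ... | inj₂ (there b) = inj₂ b

-- Numbering permutations

decode : ∀ m → Fin (m !) → Permutation m m
decode zero    _ = Perm.id
decode (suc m) i = Perm.insert Fin.zero (proj₁ (remQuot {suc m} (m !) i)) (decode m (proj₂ (remQuot {suc m} (m !) i)))

-- The Lehmer code: the image of `zero` is the leading digit in the factorial number system, and the
-- other points are renumbered before the recursion.
encode : ∀ {m} → Permutation m m → Fin (m !)
encode {zero}  π = Fin.zero
encode {suc m} π = combine (π ⟨$⟩ʳ Fin.zero) (encode (Perm.remove Fin.zero π))

decode-encode : ∀ {m} (π : Permutation m m) → decode m (encode π) Perm.≈ π
decode-encode {suc m} π i = trans
  (cong (λ qr → Perm.insert Fin.zero (proj₁ qr) (decode m (proj₂ qr)) ⟨$⟩ʳ i) (remQuot-combine a (encode τ)))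
  (step i)
  where
  a = π ⟨$⟩ʳ Fin.zero
  τ = Perm.remove Fin.zero π
  step : ∀ i → Perm.insert Fin.zero a (decode m (encode τ)) ⟨$⟩ʳ i ≡ π ⟨$⟩ʳ i
  step Fin.zero    = refl
  step (Fin.suc i) = trans (cong (punchIn a) (decode-encode τ i)) (Perm.insert-remove Fin.zero π (Fin.suc i))

decode-injective : ∀ m {i j} → decode m i Perm.≈ decode m j → i ≡ j
decode-injective zero    {Fin.zero} {Fin.zero} e = refl
decode-injective (suc m) {i} {j} e = begin
  i  ≡⟨ combine-remQuot {suc m} (m !) i ⟨
  uncurry combine (remQuot {suc m} (m !) i) ≡⟨ cong₂ combine (e Fin.zero) (decode-injective m tails) ⟩
  uncurry combine (remQuot {suc m} (m !) j) ≡⟨ combine-remQuot {suc m} (m !) j ⟩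
  j  ∎
  where
  open ≡-Reasoning
  tails : decode m (proj₂ (remQuot {suc m} (m !) i)) Perm.≈ decode m (proj₂ (remQuot {suc m} (m !) j))
  tails k = punchIn-injective (proj₁ (remQuot {suc m} (m !) i)) _ _
    (trans (e (Fin.suc k)) (cong (λ z → punchIn z _) (sym (e Fin.zero))))

-- Arithmetic of residues modulo `v`

m+m≡n+n⇒m≡n : ∀ {m n} → m + m ≡ n + n → m ≡ n
m+m≡n+n⇒m≡n {m} {n} e = ℕ.*-cancelˡ-≡ m n 2
  (subst₂ _≡_ (cong (λ z → m + z) (sym (ℕ.+-identityʳ m))) (cong (λ z → n + z) (sym (ℕ.+-identityʳ n))) e)

module Cyclic (v : ℕ) .{{_ : NonZero v}} where

  [_] : ℕ → Fin v
  [ m ] = m mod v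

  neg : Fin v → Fin v
  neg x = [ v ∸ toℕ x ]

  toℕ-[] : ∀ m → toℕ [ m ] ≡ m % v
  toℕ-[] m = toℕ-fromℕ< (m%n<n m v)

  []-cong : ∀ {m n} → m % v ≡ n % v → [ m ] ≡ [ n ]
  []-cong {m} {n} e = toℕ-injective (trans (toℕ-[] m) (trans e (sym (toℕ-[] n))))

  []-injective : ∀ {m n} → m < v → n < v → [ m ] ≡ [ n ] → m ≡ n
  []-injective {m} {n} m<v n<v e = trans (sym (m<n⇒m%n≡m m<v)) (trans (sym (toℕ-[] m))
    (trans (cong toℕ e) (trans (toℕ-[] n) (m<n⇒m%n≡m n<v))))

  toℕ-[]-< : ∀ {m} → m < v → toℕ [ m ] ≡ m
  toℕ-[]-< {m} m<v = trans (toℕ-[] m) (m<n⇒m%n≡m m<v)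

  []-toℕ : ∀ x → [ toℕ x ] ≡ x
  []-toℕ x = toℕ-injective (toℕ-[]-< (toℕ<n x))

  []-⊕ : ∀ m n → [ m ] ⊕ [ n ] ≡ [ m + n ]
  []-⊕ m n = []-cong (trans (cong (_% v) (cong₂ _+_ (toℕ-[] m) (toℕ-[] n))) (sym (%-distribˡ-+ m n v)))

  [v] : [ v ] ≡ [ 0 ]
  [v] = []-cong (trans (n%n≡0 v) (sym (m<n⇒m%n≡m (>-nonZero⁻¹ v))))

  [v*] : ∀ m → [ m * v ] ≡ [ 0 ]
  [v*] m = []-cong (trans (m*n%n≡0 m v) (sym (m<n⇒m%n≡m (>-nonZero⁻¹ v))))

  [v+] : ∀ m → [ v + m ] ≡ [ m ]
  [v+] m = []-cong (trans (cong (_% v) (ℕ.+-comm v m)) ([m+n]%n≡m%n m v))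

  []≡0⇒∣ : ∀ m → [ m ] ≡ [ 0 ] → v ∣ m
  []≡0⇒∣ m e = m%n≡0⇒n∣m m v (trans (sym (toℕ-[] m)) (trans (cong toℕ e) (toℕ-[]-< (>-nonZero⁻¹ v))))

  ⊕-comm : ∀ x y → x ⊕ y ≡ y ⊕ x
  ⊕-comm x y = cong [_] (ℕ.+-comm (toℕ x) (toℕ y))

  ⊕-assoc : ∀ x y z → (x ⊕ y) ⊕ z ≡ x ⊕ (y ⊕ z)
  ⊕-assoc x y z = begin
    (x ⊕ y) ⊕ z  ≡⟨ cong ((x ⊕ y) ⊕_) ([]-toℕ z) ⟨
    [ toℕ x + toℕ y ] ⊕ [ toℕ z ]  ≡⟨ []-⊕ (toℕ x + toℕ y) (toℕ z) ⟩
    [ toℕ x + toℕ y + toℕ z ]  ≡⟨ cong [_] (ℕ.+-assoc (toℕ x) _ _) ⟩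
    [ toℕ x + (toℕ y + toℕ z) ]  ≡⟨ []-⊕ (toℕ x) (toℕ y + toℕ z) ⟨
    [ toℕ x ] ⊕ (y ⊕ z)  ≡⟨ cong (_⊕ (y ⊕ z)) ([]-toℕ x) ⟩
    x ⊕ (y ⊕ z)  ∎
    where open ≡-Reasoning

  ⊕-identityˡ : ∀ x → [ 0 ] ⊕ x ≡ x
  ⊕-identityˡ x = trans (cong (_ ⊕_) (sym ([]-toℕ x))) (trans ([]-⊕ 0 (toℕ x)) ([]-toℕ x))

  ⊖≡⊕neg : ∀ x y → x ⊖ y ≡ x ⊕ neg y
  ⊖≡⊕neg x y = trans (sym ([]-⊕ (toℕ x) (v ∸ toℕ y))) (cong (_⊕ neg y) ([]-toℕ x))

  neg-inverseʳ : ∀ x → x ⊕ neg x ≡ [ 0 ]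
  neg-inverseʳ x = begin
    x ⊕ neg x  ≡⟨ ⊖≡⊕neg x x ⟨
    [ toℕ x + (v ∸ toℕ x) ]  ≡⟨ cong [_] (ℕ.m+[n∸m]≡n (toℕ≤n x)) ⟩
    [ v ]  ≡⟨ [v] ⟩
    [ 0 ]  ∎
    where open ≡-Reasoning

  ⊕-abelianGroup : AbelianGroup _ _
  ⊕-abelianGroup = record
    { Carrier = Fin v ; _≈_ = _≡_ ; _∙_ = _⊕_ ; ε = [ 0 ] ; _⁻¹ = neg
    ; isAbelianGroup = record
      { isGroup = record
        { isMonoid = record
          { isSemigroup = record
            { isMagma = record { isEquivalence = isEquivalence ; ∙-cong = cong₂ _⊕_ }
            ; assoc = ⊕-assoc }
          ; identity = ⊕-identityˡ , λ x → trans (⊕-comm x _) (⊕-identityˡ x) }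
        ; inverse = (λ x → trans (⊕-comm (neg x) x) (neg-inverseʳ x)) , neg-inverseʳ
        ; ⁻¹-cong = cong neg }
      ; comm = ⊕-comm } }

  open AbelianGroup ⊕-abelianGroup public using ()
    renaming (identityʳ to ⊕-identityʳ; inverseˡ to neg-inverseˡ)
  open AbelianGroupProperties ⊕-abelianGroup public using ()
    renaming ( ∙-cancelˡ to ⊕-cancelˡ; ∙-cancelʳ to ⊕-cancelʳ; ⁻¹-involutive to neg-involutive
             ; ⁻¹-injective to neg-injective; ⁻¹-∙-comm to neg-⊕; ε⁻¹≈ε to neg-0
             ; inverseʳ-unique to ⊕≡0⇒≡neg; \\-leftDividesˡ to ⊕-⊕neg
             ; //-rightDividesˡ to ⊕neg-⊕; //-rightDividesʳ to ⊕-⊕neg′)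

  ⊖-⊕ : ∀ x y → x ⊕ (y ⊖ x) ≡ y
  ⊖-⊕ x y = begin
    x ⊕ (y ⊖ x)  ≡⟨ cong (x ⊕_) (trans (⊖≡⊕neg y x) (⊕-comm y (neg x))) ⟩
    x ⊕ (neg x ⊕ y)  ≡⟨ ⊕-⊕neg x y ⟩
    y  ∎
    where open ≡-Reasoning

  ⊕-⊖ : ∀ x y → (x ⊕ y) ⊖ x ≡ y
  ⊕-⊖ x y = ⊕-cancelˡ x _ _ (⊖-⊕ x (x ⊕ y))

  neg-[]≢ : ∀ {m n} → 0 < m + n → m + n < v → neg [ m ] ≢ [ n ]
  neg-[]≢ {m} {n} 0<m+n m+n<v e = ℕ.<⇒≢ 0<m+n (sym ([]-injective m+n<v (>-nonZero⁻¹ v) (begin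
    [ m + n ]  ≡⟨ []-⊕ m n ⟨
    [ m ] ⊕ [ n ]  ≡⟨ cong ([ m ] ⊕_) (sym e) ⟩
    [ m ] ⊕ neg [ m ] ≡⟨ neg-inverseʳ _ ⟩
    [ 0 ]  ∎)))
    where open ≡-Reasoning

  translate : Fin v → Fin v ↔ Fin v
  translate g = mk↔ₛ′ (_⊕ g) (_⊕ neg g)
    (λ x → trans (⊕-assoc x _ _) (trans (cong (x ⊕_) (neg-inverseˡ g)) (⊕-identityʳ x)))
    (λ x → trans (⊕-assoc x _ _) (trans (cong (x ⊕_) (neg-inverseʳ g)) (⊕-identityʳ x)))

  -- 2 x determines x up to the choice between the two halves of [0 , v).
  double-injective : ∀ x y → x ⊕ x ≡ y ⊕ y →
    does (toℕ x + toℕ x ℕ.<? v) ≡ does (toℕ y + toℕ y ℕ.<? v) → x ≡ y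
  double-injective x y e = cases (toℕ x + toℕ x ℕ.<? v) (toℕ y + toℕ y ℕ.<? v)
    where
    small : ∀ x → toℕ x + toℕ x ∸ v < v
    small x = ℕ.≤-<-trans (ℕ.∸-monoʳ-≤ (toℕ x + toℕ x) (ℕ.<⇒≤ (toℕ<n x)))
      (subst (_< v) (sym (ℕ.m+n∸n≡m (toℕ x) (toℕ x))) (toℕ<n x))
    fold : ∀ x → ¬ (toℕ x + toℕ x < v) → [ toℕ x + toℕ x ∸ v ] ≡ [ toℕ x + toℕ x ]
    fold x p = trans (sym ([v+] _)) (cong [_] (ℕ.m+[n∸m]≡n (ℕ.≮⇒≥ p)))
    cases : (d : Dec (toℕ x + toℕ x < v)) (d′ : Dec (toℕ y + toℕ y < v)) → does d ≡ does d′ → x ≡ y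
    cases (yes p) (yes q) _ = toℕ-injective (m+m≡n+n⇒m≡n ([]-injective p q e))
    cases (no p) (no q) _ = toℕ-injective (m+m≡n+n⇒m≡n (ℕ.∸-cancelʳ-≡ (ℕ.≮⇒≥ p) (ℕ.≮⇒≥ q)
      ([]-injective (small x) (small y) (trans (fold x p) (trans e (sym (fold y q)))))))

-- From a labelled array to a biembedding

least : ∀ {P : ℕ → Set} → Decidable P → ∀ {n} → P n → ∃[ m ] P m × (∀ j → j < m → ¬ P j)
least P? {zero}  p = zero , p , λ _ ()
least {P} P? {suc n} p with P? zero
... | yes p₀ = zero , p₀ , λ _ ()
... | no ¬p₀ with m , q , below ← least {λ j → P (suc j)} (λ j → P? (suc j)) {n} p =
  suc m , q , λ { zero _ → ¬p₀ ; (suc j) j<m → below j (s≤s⁻¹ j<m) }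

iterate-+ : ∀ {A : Set} (f : A → A) x m n → iterate f x (m + n) ≡ iterate f (iterate f x m) n
iterate-+ f x zero    n = refl
iterate-+ f x (suc m) n = iterate-+ f (f x) m n

iterate-cong : ∀ {A B : Set} (f : A → A) (g : B → B) (h : A → B) → (∀ x → g (h x) ≡ h (f x)) →
  ∀ x m → iterate g (h x) m ≡ h (iterate f x m)
iterate-cong f g h e x zero    = refl
iterate-cong f g h e x (suc m) = trans (cong (λ z → iterate g z m) (e x)) (iterate-cong f g h e (f x) m)

dart-≡ : ∀ {v} {Γ : Graph v} {d e : Dart Γ} → src d ≡ src e → tgt d ≡ tgt e → d ≡ e
dart-≡ {d = dart _ _ _} {dart _ _ _} refl refl = refl

-- The labels `A × Bool` run through the residues outside `J` exactly once, with the Boolean as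
-- sign; a cell holds one member of a pair {α , -α} and stands for both.
record Labelling (v t : ℕ) .{{_ : NonZero v}} .{{_ : NonZero t}} (A : Set) : Set where
  open Cyclic v
  field
    val            : A → Bool → Fin v
    val-not        : ∀ a b → val a (not b) ≡ neg (val a b)
    val-∉J         : ∀ a b → ¬ J v t (val a b)
    val-injective  : ∀ {a b a′ b′} → val a b ≡ val a′ b′ → (a , b) ≡ (a′ , b′)
    val-surjective : ∀ α → ¬ J v t α → Σ[ l ∈ A × Bool ] val (proj₁ l) (proj₂ l) ≡ α

-- Archdeacon's embedding, known from Heffter arrays. Connectedness comes from `1∉J`, which makes x,
-- x + 1, x + 2, ... a walk; `transitive` makes each local rotation a single cycle.
module Archdeacon
  (v t : ℕ) .{{_ : NonZero v}} .{{_ : NonZero t}} (t∣v : t ∣ v)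
  (1∉J : ¬ J v t (Cyclic.[_] v 1))
  {A : Set} (row col : A ↔ A)
  (transitive : ∀ a b → ∃[ m ] iterate (Inverse.to col ∘ Inverse.to row) a m ≡ b)
  where

  open Cyclic v

  Γ : Graph v
  Γ = K v t t∣v

  -- (x , a , b) stands for the dart from x to x ⊕ val a b; column faces run
  -- through the entries of the array, row faces through their negatives.
  Flag : Set
  Flag = Fin v × A × Bool

  row→ row← col→ col← : A → A
  row→ = Inverse.to row
  row← = Inverse.from row
  col→ = Inverse.to col
  col← = Inverse.from col

  turn turn⁻¹ : Flag → Flag
  turn (x , a , true)    = x , row→ a , false
  turn (x , a , false)   = x , col→ a , true
  turn⁻¹ (x , a , true)  = x , col← a , false
  turn⁻¹ (x , a , false) = x , row← a , true

  turn-turn⁻¹ : ∀ f → turn (turn⁻¹ f) ≡ f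
  turn-turn⁻¹ (x , a , true)  = cong (λ z → x , z , true) (Inverse.inverseˡ col refl)
  turn-turn⁻¹ (x , a , false) = cong (λ z → x , z , false) (Inverse.inverseˡ row refl)

  turn⁻¹-turn : ∀ f → turn⁻¹ (turn f) ≡ f
  turn⁻¹-turn (x , a , true)  = cong (λ z → x , z , true) (Inverse.inverseʳ row refl)
  turn⁻¹-turn (x , a , false) = cong (λ z → x , z , false) (Inverse.inverseʳ col refl)

  line : Bool → A → A
  line true  = col→
  line false = row→

  -- Two turns from an entry act on its cell as `col ∘ row`, whose single cycle reaches every entry.
  -- The negative at `a′` is one turn beyond the entry at `row← a′`, and a start at a negative first
  -- turns into an entry.
  turn-reach : ∀ x (l l′ : A × Bool) → ∃[ m ] iterate turn (x , l) m ≡ (x , l′)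
  turn-reach x = reach
    where
    step² : ∀ m a → iterate turn (x , a , true) (m + m) ≡ (x , iterate (col→ ∘ row→) a m , true)
    step² zero    a = refl
    step² (suc m) a = trans (cong (iterate turn (x , a , true)) (ℕ.+-suc (suc m) m)) (step² m (col→ (row→ a)))
    from-true : ∀ a l → ∃[ m ] iterate turn (x , a , true) m ≡ (x , l)
    from-true a (a′ , true) with m , e ← transitive a a′ = m + m , trans (step² m a) (cong (λ z → x , z , true) e)
    from-true a (a′ , false) with m , e ← transitive a (row← a′) = m + m + 1 , (begin
      iterate turn (x , a , true) (m + m + 1)  ≡⟨ iterate-+ turn _ (m + m) 1 ⟩
      turn (iterate turn (x , a , true) (m + m))  ≡⟨ cong turn (trans (step² m a) (cong (λ z → x , z , true) e)) ⟩
      (x , row→ (row← a′) , false)  ≡⟨ cong (λ z → x , z , false) (Inverse.inverseˡ row refl) ⟩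
      (x , a′ , false)  ∎)
      where open ≡-Reasoning
    reach : ∀ l l′ → ∃[ m ] iterate turn (x , l) m ≡ (x , l′)
    reach (a , true)  l′ = from-true a l′
    reach (a , false) l′ with m , e ← from-true (col→ a) l′ = suc m , e

  adjacent : ∀ x {α} → ¬ J v t α → Adj Γ x (x ⊕ α)
  adjacent x {α} ¬Jα = symm Γ {x ⊕ α} {x} (subst (λ z → ¬ J v t z) (sym (⊕-⊖ x α)) ¬Jα)

  translation : Fin v → GraphIso Γ Γ
  translation g = record
    { vertices = translate g
    ; adjacent = λ x y → let e = shift x y in mk⇔ (λ p q → p (subst (J v t) e q)) (λ p q → p (subst (J v t) (sym e) q)) }
    where
    shift : ∀ x y → (x ⊕ g) ⊖ (y ⊕ g) ≡ x ⊖ y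
    shift x y = ⊕-cancelˡ (y ⊕ g) _ _ (trans (⊖-⊕ (y ⊕ g) (x ⊕ g)) (sym (begin
      (y ⊕ g) ⊕ (x ⊖ y)  ≡⟨ cong (_⊕ (x ⊖ y)) (⊕-comm y g) ⟩
      (g ⊕ y) ⊕ (x ⊖ y)  ≡⟨ ⊕-assoc g y _ ⟩
      g ⊕ (y ⊕ (x ⊖ y))  ≡⟨ cong (g ⊕_) (⊖-⊕ y x) ⟩
      g ⊕ x  ≡⟨ ⊕-comm g x ⟩
      x ⊕ g  ∎)))
      where open ≡-Reasoning

  module Labelled (L : Labelling v t A) where

    open Labelling L

    flip advance : Flag → Flag
    flip (x , a , b) = x ⊕ val a b , a , not b
    advance f        = turn (flip f)

    unlabel : Flag → Dart Γ
    unlabel (x , a , b) = dart x (x ⊕ val a b) (adjacent x (val-∉J a b))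

    abstract
      label′ : ∀ x y → .(Adj Γ x y) → Σ[ l ∈ A × Bool ] val (proj₁ l) (proj₂ l) ≡ y ⊖ x
      -- The adjacency proof is irrelevant but is a negation, so it can be recomputed and used to
      -- find the label.
      label′ x y xy = val-surjective (y ⊖ x) (¬-recompute (symm Γ {x} {y} xy))

      label : Dart Γ → Flag
      label (dart x y xy) = x , proj₁ (label′ x y xy)

      unlabel-label : ∀ d → unlabel (label d) ≡ d
      unlabel-label (dart x y xy) = dart-≡ refl (trans (cong (x ⊕_) (proj₂ (label′ x y xy))) (⊖-⊕ x y))

    unlabel-injective : ∀ {f g} → unlabel f ≡ unlabel g → f ≡ g
    unlabel-injective {x , a , b} {y , a′ , b′} e with refl ← cong src e =
      cong (x ,_) (val-injective (⊕-cancelˡ x _ _ (cong tgt e)))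

    label-unlabel : ∀ f → label (unlabel f) ≡ f
    label-unlabel f = unlabel-injective (unlabel-label (unlabel f))

    reverse-unlabel : ∀ f → reverse (unlabel f) ≡ unlabel (flip f)
    reverse-unlabel (x , a , b) = dart-≡ refl (sym (begin
      (x ⊕ val a b) ⊕ val a (not b)  ≡⟨ cong ((x ⊕ val a b) ⊕_) (val-not a b) ⟩
      (x ⊕ val a b) ⊕ neg (val a b)  ≡⟨ ⊕-⊕neg′ (val a b) x ⟩
      x  ∎))
      where open ≡-Reasoning

    embedding : Embedding Γ
    embedding = record
      { connected = λ x y → subst (Star (Adj Γ) x)
          (trans (cong (x ⊕_) ([]-toℕ (y ⊖ x))) (⊖-⊕ x y)) (path (toℕ (y ⊖ x)) x)
      ; ρ = mk↔ₛ′ (unlabel ∘ turn ∘ label) (unlabel ∘ turn⁻¹ ∘ label)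
          (λ d → trans (cong (unlabel ∘ turn) (label-unlabel (turn⁻¹ (label d))))
            (trans (cong unlabel (turn-turn⁻¹ (label d))) (unlabel-label d)))
          (λ d → trans (cong (unlabel ∘ turn⁻¹) (label-unlabel (turn (label d))))
            (trans (cong unlabel (turn⁻¹-turn (label d))) (unlabel-label d)))
      ; ρ-src = λ d → trans (src-turn (label d)) (cong src (unlabel-label d))
      ; ρ-cyclic = cyclic }
      where
      path : ∀ m x → Star (Adj Γ) x (x ⊕ [ m ])
      path zero    x = subst (Star (Adj Γ) x) (sym (⊕-identityʳ x)) ε
      path (suc m) x = adjacent x 1∉J ◅ subst (Star (Adj Γ) (x ⊕ [ 1 ]))
        (trans (⊕-assoc x [ 1 ] [ m ]) (cong (x ⊕_) ([]-⊕ 1 m))) (path m (x ⊕ [ 1 ]))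
      src-turn : ∀ f → src (unlabel (turn f)) ≡ proj₁ f
      src-turn (x , a , true)  = refl
      src-turn (x , a , false) = refl
      cyclic : ∀ d e → src d ≡ src e → ∃[ m ] iterate (unlabel ∘ turn ∘ label) d m ≡ e
      cyclic d e eq with m , p ← turn-reach (proj₁ (label d)) (proj₂ (label d)) (proj₂ (label e)) = m , (begin
        iterate (unlabel ∘ turn ∘ label) d m  ≡⟨ cong (λ z → iterate (unlabel ∘ turn ∘ label) z m) (unlabel-label d) ⟨
        iterate (unlabel ∘ turn ∘ label) (unlabel (label d)) m  ≡⟨ iterate-cong turn (unlabel ∘ turn ∘ label) unlabel (λ f → cong (unlabel ∘ turn) (label-unlabel f)) (label d) m ⟩
        unlabel (iterate turn (label d) m)  ≡⟨ cong unlabel p ⟩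
        unlabel (proj₁ (label d) , proj₂ (label e))  ≡⟨ cong (λ z → unlabel (z , proj₂ (label e))) same-src ⟩
        unlabel (label e)  ≡⟨ unlabel-label e ⟩
        e  ∎)
        where
        open ≡-Reasoning
        same-src : proj₁ (label d) ≡ proj₁ (label e)
        same-src = trans (cong src (unlabel-label d)) (trans eq (sym (cong src (unlabel-label e))))

    rot-unlabel : ∀ f → rot embedding (unlabel f) ≡ unlabel (turn f)
    rot-unlabel f = cong (unlabel ∘ turn) (label-unlabel f)

    rot⁻¹-unlabel : ∀ f → rot⁻¹ embedding (unlabel f) ≡ unlabel (turn⁻¹ f)
    rot⁻¹-unlabel f = cong (unlabel ∘ turn⁻¹) (label-unlabel f)

    faceStep-unlabel : ∀ f → faceStep embedding (unlabel f) ≡ unlabel (advance f)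
    faceStep-unlabel f = trans (cong (rot embedding) (reverse-unlabel f)) (rot-unlabel (flip f))

    isBiembedding : IsBiembedding embedding
    isBiembedding = colour , (λ d → on-unlabel (λ d → colour (faceStep embedding d) ≡ colour d) faces d)
                           , on-unlabel (λ d → colour (reverse d) ≢ colour d) edges
      where
      colour : Dart Γ → Bool
      colour d = proj₂ (proj₂ (label d))
      on-unlabel : (P : Dart Γ → Set) → (∀ f → P (unlabel f)) → ∀ d → P d
      on-unlabel P p d = subst P (unlabel-label d) (p (label d))
      colour-unlabel : ∀ f → colour (unlabel f) ≡ proj₂ (proj₂ f)
      colour-unlabel f = cong (proj₂ ∘ proj₂) (label-unlabel f)
      advance-colour : ∀ f → proj₂ (proj₂ (advance f)) ≡ proj₂ (proj₂ f)
      advance-colour (x , a , true)  = refl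
      advance-colour (x , a , false) = refl
      faces : ∀ f → colour (faceStep embedding (unlabel f)) ≡ colour (unlabel f)
      faces f = trans (cong colour (faceStep-unlabel f)) (trans (colour-unlabel _)
        (trans (advance-colour f) (sym (colour-unlabel f))))
      edges : ∀ f → colour (reverse (unlabel f)) ≢ colour (unlabel f)
      edges f e = Bool.not-¬ refl (sym (trans (sym (trans (cong colour (reverse-unlabel f)) (colour-unlabel (flip f))))
        (trans e (colour-unlabel f))))

    translation-unlabel : ∀ g x l → onDart (translation g) (unlabel (x , l)) ≡ unlabel (x ⊕ g , l)
    translation-unlabel g x (a , b) = dart-≡ refl (begin
      (x ⊕ val a b) ⊕ g  ≡⟨ ⊕-assoc x _ g ⟩
      x ⊕ (val a b ⊕ g)  ≡⟨ cong (x ⊕_) (⊕-comm _ g) ⟩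
      x ⊕ (g ⊕ val a b)  ≡⟨ ⊕-assoc x g _ ⟨
      (x ⊕ g) ⊕ val a b  ∎)
      where open ≡-Reasoning

    translation-automorphism : ∀ g → IsEmbeddingIso embedding embedding (translation g)
    translation-automorphism g = inj₁ λ d → subst (λ d → onDart (translation g) (rot embedding d) ≡ rot embedding (onDart (translation g) d))
      (unlabel-label d) (commutes (label d))
      where
      commutes : ∀ f → onDart (translation g) (rot embedding (unlabel f)) ≡ rot embedding (onDart (translation g) (unlabel f))
      commutes f@(x , a , true) = trans (cong (onDart (translation g)) (rot-unlabel f)) (trans (translation-unlabel g x _)
        (sym (trans (cong (rot embedding) (translation-unlabel g x _)) (rot-unlabel _))))
      commutes f@(x , a , false) = trans (cong (onDart (translation g)) (rot-unlabel f)) (trans (translation-unlabel g x _)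
        (sym (trans (cong (rot embedding) (translation-unlabel g x _)) (rot-unlabel _))))

    partialSum : Bool → A → ℕ → Fin v
    partialSum b a zero    = [ 0 ]
    partialSum b a (suc j) = val a b ⊕ partialSum b (line b a) j

    module Faces (k : ℕ) .{{_ : NonZero k}}
      (line-period : ∀ b a → iterate (line b) a k ≡ a)
      (line-period⁻¹ : ∀ b a j → iterate (line b) a j ≡ a → k ∣ j)
      (sum≢0 : ∀ b a → partialSum b a k ≢ [ 0 ])
      where

      iterate-advance : ∀ b x a j → iterate advance (x , a , b) j ≡ (x ⊕ partialSum b a j , iterate (line b) a j , b)
      iterate-advance b x a zero    = cong (_, a , b) (sym (⊕-identityʳ x))
      iterate-advance b x a (suc j) = begin
        iterate advance (advance (x , a , b)) j  ≡⟨ cong (λ z → iterate advance z j) (one b) ⟩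
        iterate advance (x ⊕ val a b , line b a , b) j  ≡⟨ iterate-advance b _ _ j ⟩
        ((x ⊕ val a b) ⊕ partialSum b (line b a) j , _ , b)  ≡⟨ cong (_, iterate (line b) (line b a) j , b) (⊕-assoc x _ _) ⟩
        (x ⊕ partialSum b a (suc j) , _ , b)  ∎
        where
        open ≡-Reasoning
        one : ∀ b → advance (x , a , b) ≡ (x ⊕ val a b , line b a , b)
        one true  = refl
        one false = refl

      total : Bool → A → Fin v
      total b a = partialSum b a k

      iterate-advance-* : ∀ q b x a → iterate advance (x , a , b) (q * k) ≡ (x ⊕ [ q * toℕ (total b a) ] , a , b)
      iterate-advance-* zero    b x a = cong (_, a , b) (sym (⊕-identityʳ x))
      iterate-advance-* (suc q) b x a = begin
        iterate advance (x , a , b) (k + q * k)  ≡⟨ iterate-+ advance _ k (q * k) ⟩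
        iterate advance (iterate advance (x , a , b) k) (q * k)  ≡⟨ cong (λ z → iterate advance z (q * k)) (trans (iterate-advance b x a k) (cong (λ z → x ⊕ total b a , z , b) (line-period b a))) ⟩
        iterate advance (x ⊕ total b a , a , b) (q * k)  ≡⟨ iterate-advance-* q b _ a ⟩
        ((x ⊕ total b a) ⊕ [ q * toℕ (total b a) ] , a , b)  ≡⟨ cong (_, a , b) (trans (⊕-assoc x (total b a) [ q * toℕ (total b a) ]) (cong (x ⊕_) (add (total b a)))) ⟩
        (x ⊕ [ suc q * toℕ (total b a) ] , a , b)  ∎
        where
        open ≡-Reasoning
        add : ∀ y → y ⊕ [ q * toℕ y ] ≡ [ toℕ y + q * toℕ y ]
        add y = trans (cong (_⊕ [ q * toℕ y ]) (sym ([]-toℕ y))) ([]-⊕ (toℕ y) (q * toℕ y))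

      Order : Bool → A → ℕ → Set
      Order b a m = (0 < m × [ m * toℕ (total b a) ] ≡ [ 0 ])
                  × (∀ j → j < m → ¬ (0 < j × [ j * toℕ (total b a) ] ≡ [ 0 ]))

      order : ∀ b a → ∃ (Order b a)
      -- `v` itself annihilates the line sum, so the search has a bound.
      order b a = least (λ j → (0 ℕ.<? j) ×-dec ([ j * toℕ (total b a) ] Fin.≟ [ 0 ])) {v}
        (>-nonZero⁻¹ v , trans (cong [_] (ℕ.*-comm v (toℕ (total b a)))) ([v*] (toℕ (total b a))))

      iterate-face : ∀ f j → iterate (faceStep embedding) (unlabel f) j ≡ unlabel (iterate advance f j)
      iterate-face = iterate-cong advance (faceStep embedding) unlabel faceStep-unlabel

      advance-fixed : ∀ b x a m → [ m * toℕ (total b a) ] ≡ [ 0 ] → iterate advance (x , a , b) (k * m) ≡ (x , a , b)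
      advance-fixed b x a m mS≡0 = begin
        iterate advance (x , a , b) (k * m)  ≡⟨ cong (iterate advance (x , a , b)) (ℕ.*-comm k m) ⟩
        iterate advance (x , a , b) (m * k)  ≡⟨ iterate-advance-* m b x a ⟩
        (x ⊕ [ m * toℕ (total b a) ] , a , b)  ≡⟨ cong (λ z → x ⊕ z , a , b) mS≡0 ⟩
        (x ⊕ [ 0 ] , a , b)  ≡⟨ cong (_, a , b) (⊕-identityʳ x) ⟩
        (x , a , b)  ∎
        where open ≡-Reasoning

      advance-fixed⁻¹ : ∀ b x a q → iterate advance (x , a , b) (q * k) ≡ (x , a , b) → [ q * toℕ (total b a) ] ≡ [ 0 ]
      advance-fixed⁻¹ b x a q e = ⊕-cancelˡ x _ _
        (trans (cong proj₁ (trans (sym (iterate-advance-* q b x a)) e)) (sym (⊕-identityʳ x)))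

      advance-period : ∀ b x a j → iterate advance (x , a , b) j ≡ (x , a , b) → k ∣ j
      advance-period b x a j e = line-period⁻¹ b a j
        (cong (proj₁ ∘ proj₂) (trans (sym (iterate-advance b x a j)) e))

      -- A face closes only after whole trips round its line, because the cell has to recur. Each
      -- trip moves the base vertex by the line sum, so the number of trips is the additive order of
      -- that sum.
      faceLength : ∀ b x a {m} → Order b a m → HasFaceLength embedding (unlabel (x , a , b)) (k * m)
      faceLength b x a {m} ((0<m , mS≡0) , below) =
        ℕ.*-mono-< (>-nonZero⁻¹ k) 0<m
        , trans (iterate-face (x , a , b) (k * m)) (cong unlabel (advance-fixed b x a m mS≡0))
        , λ j 0<j j<km e → no-earlier j 0<j j<km (unlabel-injective (trans (sym (iterate-face (x , a , b) j)) e))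
        where
        no-earlier : ∀ j → 0 < j → j < k * m → iterate advance (x , a , b) j ≢ (x , a , b)
        no-earlier j 0<j j<km e = contra (advance-period b x a j e) 0<j j<km e
          where
          contra : ∀ {j} → k ∣ j → 0 < j → j < k * m → iterate advance (x , a , b) j ≢ (x , a , b)
          contra (divides q refl) 0<j j<km e = below q (ℕ.*-cancelʳ-< k q m (subst (q * k <_) (ℕ.*-comm k m) j<km))
            (ℕ.n≢0⇒n>0 (λ { refl → ℕ.<-irrefl refl 0<j }) , advance-fixed⁻¹ b x a q e)

      order≢1 : ∀ b a → ¬ Order b a 1
      order≢1 b a ((_ , S≡0) , _) = sum≢0 b a (trans (sym ([]-toℕ (total b a)))
        (trans (cong [_] (sym (ℕ.*-identityˡ (toℕ (total b a))))) S≡0))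

      1<order : ∀ b a {m} → Order b a m → 1 < m
      1<order b a {suc zero}    o = contradiction o (order≢1 b a)
      1<order b a {suc (suc m)} o = s≤s (s≤s z≤n)

      prime⇒order≡v : Prime v → ∀ b a {m} → Order b a m → m ≡ v
      prime⇒order≡v v-prime b a {m} ((0<m , mS≡0) , below) = ℕ.≤-antisym m≤v (v≤m {m} 0<m mS≡0)
        where
        m≤v : m ≤ v
        m≤v = ℕ.≮⇒≥ (λ v<m → below v v<m
          (>-nonZero⁻¹ v , trans (cong [_] (ℕ.*-comm v (toℕ (total b a)))) ([v*] (toℕ (total b a)))))
        v∤S : ¬ v ∣ toℕ (total b a)
        v∤S v∣S = sum≢0 b a (trans (sym ([]-toℕ (total b a)))
          ([]-cong (trans (n∣m⇒m%n≡0 (toℕ (total b a)) v v∣S) (sym (m<n⇒m%n≡m (>-nonZero⁻¹ v))))))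
        v≤m : ∀ {m} → 0 < m → [ m * toℕ (total b a) ] ≡ [ 0 ] → v ≤ m
        v≤m {suc m} _ mS≡0 with euclidsLemma (suc m) (toℕ (total b a)) v-prime ([]≡0⇒∣ (suc m * toℕ (total b a)) mS≡0)
        ... | inj₁ v∣m = ∣⇒≤ v∣m
        ... | inj₂ v∣S = contradiction v∣S v∤S

      faceLengths : ∀ d → ∃[ ℓ ] HasFaceLength embedding d ℓ × k ∣ ℓ × k < ℓ
      faceLengths d = from (label d) (unlabel-label d)
        where
        from : ∀ f → unlabel f ≡ d → ∃[ ℓ ] HasFaceLength embedding d ℓ × k ∣ ℓ × k < ℓ
        from (x , a , b) e = let m , o = order b a in
          k * m , subst (λ d → HasFaceLength embedding d (k * m)) e (faceLength b x a o)
          , m∣m*n m , subst (_< k * m) (ℕ.*-identityʳ k) (ℕ.*-monoʳ-< k (1<order b a o))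

      gonal : Prime v → Gonal embedding (k * v)
      gonal v-prime d = from (label d) (unlabel-label d)
        where
        from : ∀ f → unlabel f ≡ d → HasFaceLength embedding d (k * v)
        from (x , a , b) e = let m , o = order b a in
          subst₂ (λ d ℓ → HasFaceLength embedding d (k * ℓ)) e (prime⇒order≡v v-prime b a o) (faceLength b x a o)

-- Isomorphisms between marked embeddings are translations

module Rigidity
  (v t : ℕ) .{{_ : NonZero v}} .{{_ : NonZero t}} (t∣v : t ∣ v) (7<v : 7 < v)
  (1∉J : ¬ J v t (Cyclic.[_] v 1))
  {A : Set} (row col : A ↔ A)
  (transitive : ∀ a b → ∃[ m ] iterate (Inverse.to col ∘ Inverse.to row) a m ≡ b)
  (a₀ : A)
  where

  open Cyclic v
  open Archdeacon v t t∣v 1∉J row col transitive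

  TriangleAt TriangleAt⁻¹ : (A → Fin v) → A → Set
  TriangleAt f a   = (f a ⊕ f (col→ a)) ⊕ f (row→ a) ≡ [ 0 ]
  TriangleAt⁻¹ f a = (f a ⊕ f (col← a)) ⊕ f (row← a) ≡ [ 0 ]

  entry : Labelling v t A → A → Fin v
  entry L a = Labelling.val L a true

  -- The two triangles are 1 + 2 - 3 and 1 + 4 - 5. The four outer values differ even up to sign, so
  -- that reversing the marked dart or the orientation shows in the rotation around it.
  record Forced (f : A → Fin v) : Set where
    constructor forced
    field
      at-a₀    : f a₀ ≡ [ 1 ]
      at-col→  : f (col→ a₀) ≡ [ 2 ]
      at-row→  : f (row→ a₀) ≡ neg [ 3 ]
      at-col←  : f (col← a₀) ≡ [ 4 ]
      at-row←  : f (row← a₀) ≡ neg [ 5 ]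

  record Marked (L : Labelling v t A) : Set where
    field
      values : Forced (entry L)
      unique : ∀ a → TriangleAt (entry L) a → TriangleAt⁻¹ (entry L) a → a ≡ a₀
    open Forced values public

  -- An isomorphism invariant of darts; reversing the orientation swaps the two
  -- equations.
  Special : (Π : Embedding Γ) → Dart Γ → Set
  Special Π d = tgt (rot Π (reverse d)) ≡ tgt (rot Π d) × tgt (rot⁻¹ Π (reverse d)) ≡ tgt (rot⁻¹ Π d)

  private
    move : ∀ x p q r → (x ⊕ p) ⊕ q ≡ x ⊕ neg r → (p ⊕ q) ⊕ r ≡ [ 0 ]
    move x p q r e = begin
      (p ⊕ q) ⊕ r  ≡⟨ cong (_⊕ r) (⊕-cancelˡ x _ _ (trans (sym (⊕-assoc x p q)) e)) ⟩
      neg r ⊕ r  ≡⟨ neg-inverseˡ r ⟩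
      [ 0 ]  ∎
      where open ≡-Reasoning

    move⁻¹ : ∀ x p q r → (p ⊕ q) ⊕ r ≡ [ 0 ] → (x ⊕ p) ⊕ q ≡ x ⊕ neg r
    move⁻¹ x p q r e = trans (⊕-assoc x p q) (cong (x ⊕_)
      (⊕-cancelʳ r _ _ (trans e (sym (neg-inverseˡ r)))))

    rearrange : ∀ p q r → (neg p ⊕ neg q) ⊕ neg r ≡ [ 0 ] → (p ⊕ r) ⊕ q ≡ [ 0 ]
    rearrange p q r e = neg-injective (begin
      neg ((p ⊕ r) ⊕ q)  ≡⟨ cong neg (trans (⊕-assoc p r q) (trans (cong (p ⊕_) (⊕-comm r q)) (sym (⊕-assoc p q r)))) ⟩
      neg ((p ⊕ q) ⊕ r)  ≡⟨ neg-⊕ (p ⊕ q) r ⟨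
      neg (p ⊕ q) ⊕ neg r  ≡⟨ cong (_⊕ neg r) (neg-⊕ p q) ⟨
      (neg p ⊕ neg q) ⊕ neg r  ≡⟨ e ⟩
      [ 0 ]  ≡⟨ neg-0 ⟨
      neg [ 0 ]  ∎)
      where open ≡-Reasoning

    swap-last : ∀ (p q r : Fin v) → (p ⊕ q) ⊕ r ≡ (p ⊕ r) ⊕ q
    swap-last p q r = trans (⊕-assoc p q r) (trans (cong (p ⊕_) (⊕-comm q r)) (sym (⊕-assoc p r q)))

  module _ (L : Labelling v t A) where
    open Labelling L
    open Labelled L
    open ≡-Reasoning

    private
      f : A → Fin v
      f = entry L

    tgt-rot-reverse : ∀ f → tgt (rot embedding (reverse (unlabel f))) ≡ tgt (unlabel (advance f))
    tgt-rot-reverse f = cong tgt (faceStep-unlabel f)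

    tgt-rot⁻¹-reverse : ∀ f → tgt (rot⁻¹ embedding (reverse (unlabel f))) ≡ tgt (unlabel (turn⁻¹ (flip f)))
    tgt-rot⁻¹-reverse f = cong tgt (trans (cong (rot⁻¹ embedding) (reverse-unlabel f)) (rot⁻¹-unlabel (flip f)))

    -- Reversing a dart negates the entries and exchanges the roles of `row` and `col`, which leaves
    -- both equations as they are up to sign. So `Special` sees the cell but not the direction `b`.
    special⇒triangles : ∀ x a b → Special embedding (unlabel (x , a , b)) → TriangleAt (entry L) a × TriangleAt⁻¹ (entry L) a
    special⇒triangles x a b (p , q) = cases b
      (trans (sym (tgt-rot-reverse (x , a , b))) (trans p (cong tgt (rot-unlabel (x , a , b)))))
      (trans (sym (tgt-rot⁻¹-reverse (x , a , b))) (trans q (cong tgt (rot⁻¹-unlabel (x , a , b)))))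
      where
      cases : ∀ b → tgt (unlabel (advance (x , a , b))) ≡ tgt (unlabel (turn (x , a , b))) →
        tgt (unlabel (turn⁻¹ (flip (x , a , b)))) ≡ tgt (unlabel (turn⁻¹ (x , a , b))) →
        TriangleAt (entry L) a × TriangleAt⁻¹ (entry L) a
      cases true p q =
          move x (f a) (f (col→ a)) (f (row→ a)) (trans p (cong (x ⊕_) (val-not (row→ a) true)))
        , trans (swap-last (f a) (f (col← a)) (f (row← a)))
            (move x (f a) (f (row← a)) (f (col← a)) (trans q (cong (x ⊕_) (val-not (col← a) true))))
      cases false p q =
          rearrange (f a) (f (row→ a)) (f (col→ a)) (neg-form (row→ a) (col→ a) p)
        , trans (swap-last (f a) (f (col← a)) (f (row← a)))
            (rearrange (f a) (f (col← a)) (f (row← a)) (neg-form (col← a) (row← a) q))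
        where
        neg-form : ∀ c d → (x ⊕ val a false) ⊕ val c false ≡ x ⊕ val d true →
          (neg (val a true) ⊕ neg (val c true)) ⊕ neg (val d true) ≡ [ 0 ]
        neg-form c d e = move x (neg (f a)) (neg (f c)) (neg (f d)) (begin
          (x ⊕ neg (val a true)) ⊕ neg (val c true)  ≡⟨ cong₂ (λ y z → (x ⊕ y) ⊕ z) (val-not a true) (val-not c true) ⟨
          (x ⊕ val a false) ⊕ val c false  ≡⟨ e ⟩
          x ⊕ val d true  ≡⟨ cong (x ⊕_) (neg-involutive (f d)) ⟨
          x ⊕ neg (neg (val d true))  ∎)

    triangles⇒special : ∀ x a → TriangleAt (entry L) a → TriangleAt⁻¹ (entry L) a → Special embedding (unlabel (x , a , true))
    triangles⇒special x a p q =
        trans (tgt-rot-reverse (x , a , true)) (trans (move⁻¹ x (f a) (f (col→ a)) (f (row→ a)) p)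
          (trans (cong (x ⊕_) (sym (val-not (row→ a) true))) (sym (cong tgt (rot-unlabel (x , a , true))))))
      , trans (tgt-rot⁻¹-reverse (x , a , true)) (trans (move⁻¹ x (f a) (f (row← a)) (f (col← a)) (trans (swap-last (f a) (f (row← a)) (f (col← a))) q))
          (trans (cong (x ⊕_) (sym (val-not (col← a) true))) (sym (cong tgt (rot⁻¹-unlabel (x , a , true))))))

    marked-triangle : Marked L → TriangleAt (entry L) a₀ × TriangleAt⁻¹ (entry L) a₀
    marked-triangle M = sum-zero at-a₀ at-col→ at-row→ , sum-zero at-a₀ at-col← at-row←
      where
      open Marked M
      sum-zero : ∀ {m n α β γ} → α ≡ [ m ] → β ≡ [ n ] → γ ≡ neg [ m + n ] → (α ⊕ β) ⊕ γ ≡ [ 0 ]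
      sum-zero {m} {n} refl refl refl = trans (cong (_⊕ neg [ m + n ]) ([]-⊕ m n)) (neg-inverseʳ [ m + n ])

  onDart-reverse : ∀ (σ : GraphIso Γ Γ) d → onDart σ (reverse d) ≡ reverse (onDart σ d)
  onDart-reverse σ (dart x y xy) = refl

  tgt-onDart : ∀ (σ : GraphIso Γ Γ) d → tgt (onDart σ d) ≡ onVertex σ (tgt d)
  tgt-onDart σ (dart x y xy) = refl

  inverse-commutes : ∀ {D : Set} (f g : D ↔ D) (h : D → D) →
    (∀ d → h (Inverse.to f d) ≡ Inverse.to g (h d)) → ∀ d → h (Inverse.from f d) ≡ Inverse.from g (h d)
  inverse-commutes f g h e d = begin
    h (Inverse.from f d)  ≡⟨ Inverse.inverseʳ g refl ⟨
    Inverse.from g (Inverse.to g (h (Inverse.from f d)))  ≡⟨ cong (Inverse.from g) (e (Inverse.from f d)) ⟨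
    Inverse.from g (h (Inverse.to f (Inverse.from f d)))  ≡⟨ cong (Inverse.from g ∘ h) (Inverse.inverseˡ f refl) ⟩
    Inverse.from g (h d)  ∎
    where open ≡-Reasoning

  special-invariant : ∀ (Π Π′ : Embedding Γ) σ → IsEmbeddingIso Π Π′ σ → ∀ d → Special Π d → Special Π′ (onDart σ d)
  special-invariant Π Π′ σ iso d (p , q) = cases iso
    where
    transfer : ∀ {f : Dart Γ → Dart Γ} {g : Dart Γ → Dart Γ} → (∀ d → onDart σ (f d) ≡ g (onDart σ d)) →
      tgt (f (reverse d)) ≡ tgt (f d) → tgt (g (reverse (onDart σ d))) ≡ tgt (g (onDart σ d))
    transfer {f} {g} e eq = begin
      tgt (g (reverse (onDart σ d)))  ≡⟨ cong (tgt ∘ g) (onDart-reverse σ d) ⟨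
      tgt (g (onDart σ (reverse d)))  ≡⟨ cong tgt (e (reverse d)) ⟨
      tgt (onDart σ (f (reverse d)))  ≡⟨ tgt-onDart σ (f (reverse d)) ⟩
      onVertex σ (tgt (f (reverse d)))  ≡⟨ cong (onVertex σ) eq ⟩
      onVertex σ (tgt (f d))  ≡⟨ tgt-onDart σ (f d) ⟨
      tgt (onDart σ (f d))  ≡⟨ cong tgt (e d) ⟩
      tgt (g (onDart σ d))  ∎
      where open ≡-Reasoning
    cases : IsEmbeddingIso Π Π′ σ → Special Π′ (onDart σ d)
    cases (inj₁ e) = transfer {rot Π} {rot Π′} e p
                   , transfer {rot⁻¹ Π} {rot⁻¹ Π′} (inverse-commutes (Embedding.ρ Π) (Embedding.ρ Π′) (onDart σ) e) q
    cases (inj₂ e) = transfer {rot⁻¹ Π} {rot Π′}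
                       (inverse-commutes (Embedding.ρ Π) (↔-sym (Embedding.ρ Π′)) (onDart σ) e) q
                   , transfer {rot Π} {rot⁻¹ Π′} e p

  module _ (L L′ : Labelling v t A) (M : Marked L) (M′ : Marked L′)
    (σ : GraphIso Γ Γ) (iso : IsEmbeddingIso (Labelled.embedding L) (Labelled.embedding L′) σ) where

    private
      module X = Labelled L
      module Y = Labelled L′
      val = Labelling.val L
      val′ = Labelling.val L′
      module M = Marked M
      module M′ = Marked M′

      s : Fin v → Fin v
      s = onVertex σ

      s-injective : ∀ {x y} → s x ≡ s y → x ≡ y
      s-injective {x} {y} e = trans (sym (Inverse.inverseʳ (GraphIso.vertices σ) refl))
        (trans (cong (Inverse.from (GraphIso.vertices σ)) e) (Inverse.inverseʳ (GraphIso.vertices σ) refl))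

      MapsTo : Fin v → Bool → Set
      MapsTo x b = onDart σ (X.unlabel (x , a₀ , true)) ≡ Y.unlabel (s x , a₀ , b)

      -- The image dart is special, hence lies over a cell of `L′` satisfying both equations, and
      -- uniqueness makes that cell `a₀`. Only the sign remains open.
      marked-image : ∀ x → ∃ (MapsTo x)
      marked-image x = found (Y.label image) (Y.unlabel-label image)
        where
        image = onDart σ (X.unlabel (x , a₀ , true))
        special : Special Y.embedding image
        special = special-invariant X.embedding Y.embedding σ iso (X.unlabel (x , a₀ , true))
          (uncurry (triangles⇒special L x a₀) (marked-triangle L M))
        found : ∀ f → Y.unlabel f ≡ image → ∃ (MapsTo x)
        found (y , a , b) e = b , trans (sym e) (cong₂ (λ y a → Y.unlabel (y , a , b)) (cong src e) (M′.unique a (proj₁ triangles) (proj₂ triangles)))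
          where
          triangles : TriangleAt (entry L′) a × TriangleAt⁻¹ (entry L′) a
          triangles = special⇒triangles L′ y a b (subst (Special Y.embedding) (sym e) special)

      tip-image : ∀ {x l y l′} → onDart σ (X.unlabel (x , l)) ≡ Y.unlabel (y , l′) →
        s (x ⊕ uncurry val l) ≡ y ⊕ uncurry val′ l′
      tip-image e = cong tgt e

      next-true : ∀ x → MapsTo x true → s (x ⊕ [ 1 ]) ≡ s x ⊕ [ 1 ]
      next-true x e = subst₂ (λ α β → s (x ⊕ α) ≡ s x ⊕ β) M.at-a₀ M′.at-a₀ (tip-image e)

      next-false : ∀ x → MapsTo x false → s (x ⊕ [ 1 ]) ≡ s x ⊕ neg [ 1 ]
      next-false x e = subst₂ (λ α β → s (x ⊕ α) ≡ s x ⊕ β) M.at-a₀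
        (trans (Labelling.val-not L′ a₀ true) (cong neg M′.at-a₀)) (tip-image e)

      ≤7⇒<v : ∀ {m} → m ≤ 7 → m < v
      ≤7⇒<v m≤7 = ℕ.≤-<-trans m≤7 7<v

      regroup : ∀ (x y z : Fin v) {w} → y ⊕ z ≡ w → (x ⊕ y) ⊕ z ≡ x ⊕ w
      regroup x y z e = trans (⊕-assoc x y z) (cong (x ⊕_) e)

      no-return : ∀ (x : Fin v) → x ≢ (x ⊕ [ 1 ]) ⊕ [ 1 ]
      no-return x e = contradiction ([]-injective {0} {2} (≤7⇒<v z≤n) (≤7⇒<v (s≤s (s≤s z≤n)))
        (⊕-cancelˡ x [ 0 ] [ 2 ] (trans (⊕-identityʳ x) (trans e (regroup x [ 1 ] [ 1 ] ([]-⊕ 1 1)))))) λ ()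

      -- A change of sign between x and x + 1 would give `s` the same value at x and x + 2, against
      -- injectivity, as 2 is not 0 modulo v. So one sign governs all the vertices.
      step-true : ∀ x → MapsTo x true → MapsTo (x ⊕ [ 1 ]) true
      step-true x e = cases (marked-image (x ⊕ [ 1 ]))
        where
        open ≡-Reasoning
        cases : ∃ (MapsTo (x ⊕ [ 1 ])) → MapsTo (x ⊕ [ 1 ]) true
        cases (true , e′) = e′
        cases (false , e′) = contradiction (sym (s-injective {(x ⊕ [ 1 ]) ⊕ [ 1 ]} {x} (begin
          s ((x ⊕ [ 1 ]) ⊕ [ 1 ])  ≡⟨ next-false (x ⊕ [ 1 ]) e′ ⟩
          s (x ⊕ [ 1 ]) ⊕ neg [ 1 ]  ≡⟨ cong (_⊕ neg [ 1 ]) (next-true x e) ⟩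
          (s x ⊕ [ 1 ]) ⊕ neg [ 1 ]  ≡⟨ ⊕-⊕neg′ [ 1 ] (s x) ⟩
          s x  ∎))) (no-return x)

      step-false : ∀ x → MapsTo x false → MapsTo (x ⊕ [ 1 ]) false
      step-false x e = cases (marked-image (x ⊕ [ 1 ]))
        where
        open ≡-Reasoning
        cases : ∃ (MapsTo (x ⊕ [ 1 ])) → MapsTo (x ⊕ [ 1 ]) false
        cases (false , e′) = e′
        cases (true , e′) = contradiction (sym (s-injective {(x ⊕ [ 1 ]) ⊕ [ 1 ]} {x} (begin
          s ((x ⊕ [ 1 ]) ⊕ [ 1 ])  ≡⟨ next-true (x ⊕ [ 1 ]) e′ ⟩
          s (x ⊕ [ 1 ]) ⊕ [ 1 ]  ≡⟨ cong (_⊕ [ 1 ]) (next-false x e) ⟩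
          (s x ⊕ neg [ 1 ]) ⊕ [ 1 ]  ≡⟨ ⊕neg-⊕ [ 1 ] (s x) ⟩
          s x  ∎))) (no-return x)

      three : ∀ (x : Fin v) → ((x ⊕ [ 1 ]) ⊕ [ 1 ]) ⊕ [ 1 ] ≡ x ⊕ [ 3 ]
      three x = trans (cong (_⊕ [ 1 ]) (regroup x [ 1 ] [ 1 ] ([]-⊕ 1 1))) (regroup x [ 2 ] [ 1 ] ([]-⊕ 2 1))

      three-neg : ∀ (x : Fin v) → ((x ⊕ neg [ 1 ]) ⊕ neg [ 1 ]) ⊕ neg [ 1 ] ≡ x ⊕ neg [ 3 ]
      three-neg x = trans
        (cong (_⊕ neg [ 1 ]) (regroup x (neg [ 1 ]) (neg [ 1 ]) (trans (neg-⊕ [ 1 ] [ 1 ]) (cong neg ([]-⊕ 1 1)))))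
        (regroup x (neg [ 2 ]) (neg [ 1 ]) (trans (neg-⊕ [ 2 ] [ 1 ]) (cong neg ([]-⊕ 2 1))))

      ahead-true : ∀ x → MapsTo x true → s (x ⊕ [ 3 ]) ≡ s x ⊕ [ 3 ]
      ahead-true x e = begin
        s (x ⊕ [ 3 ])  ≡⟨ cong s (three x) ⟨
        s (((x ⊕ [ 1 ]) ⊕ [ 1 ]) ⊕ [ 1 ])  ≡⟨ next-true ((x ⊕ [ 1 ]) ⊕ [ 1 ]) (step-true (x ⊕ [ 1 ]) (step-true x e)) ⟩
        s ((x ⊕ [ 1 ]) ⊕ [ 1 ]) ⊕ [ 1 ]  ≡⟨ cong (_⊕ [ 1 ]) (next-true (x ⊕ [ 1 ]) (step-true x e)) ⟩
        (s (x ⊕ [ 1 ]) ⊕ [ 1 ]) ⊕ [ 1 ]  ≡⟨ cong (λ z → (z ⊕ [ 1 ]) ⊕ [ 1 ]) (next-true x e) ⟩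
        ((s x ⊕ [ 1 ]) ⊕ [ 1 ]) ⊕ [ 1 ]  ≡⟨ three (s x) ⟩
        s x ⊕ [ 3 ]  ∎
        where open ≡-Reasoning

      ahead-false : ∀ x → MapsTo x false → s (x ⊕ [ 3 ]) ≡ s x ⊕ neg [ 3 ]
      ahead-false x e = begin
        s (x ⊕ [ 3 ])  ≡⟨ cong s (three x) ⟨
        s (((x ⊕ [ 1 ]) ⊕ [ 1 ]) ⊕ [ 1 ])  ≡⟨ next-false ((x ⊕ [ 1 ]) ⊕ [ 1 ]) (step-false (x ⊕ [ 1 ]) (step-false x e)) ⟩
        s ((x ⊕ [ 1 ]) ⊕ [ 1 ]) ⊕ neg [ 1 ]  ≡⟨ cong (_⊕ neg [ 1 ]) (next-false (x ⊕ [ 1 ]) (step-false x e)) ⟩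
        (s (x ⊕ [ 1 ]) ⊕ neg [ 1 ]) ⊕ neg [ 1 ]  ≡⟨ cong (λ z → (z ⊕ neg [ 1 ]) ⊕ neg [ 1 ]) (next-false x e) ⟩
        ((s x ⊕ neg [ 1 ]) ⊕ neg [ 1 ]) ⊕ neg [ 1 ]  ≡⟨ three-neg (s x) ⟩
        s x ⊕ neg [ 3 ]  ∎
        where open ≡-Reasoning

      -- The dart following the marked one in the rotation ends at x + 3, because `row→ a₀` carries
      -- -3. Its image gives a second formula for the value of `s` there, to be compared with
      -- `ahead-true` and `ahead-false`.
      via-row : ∀ x {y l′ β} → onDart σ (rot X.embedding (X.unlabel (x , a₀ , true))) ≡ Y.unlabel (y , l′) →
        uncurry val′ l′ ≡ β → s (x ⊕ [ 3 ]) ≡ y ⊕ β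
      via-row x {y} e refl = trans (cong (λ α → s (x ⊕ α)) (sym (begin
          val (row→ a₀) false  ≡⟨ Labelling.val-not L (row→ a₀) true ⟩
          neg (val (row→ a₀) true)  ≡⟨ cong neg M.at-row→ ⟩
          neg (neg [ 3 ])  ≡⟨ neg-involutive [ 3 ] ⟩
          [ 3 ]  ∎)))
        (tip-image {x} {row→ a₀ , false} (trans (sym (cong (onDart σ) (X.rot-unlabel (x , a₀ , true)))) e))
        where open ≡-Reasoning

      -- With every sign true, `s` commutes with adding 1 and is a translation. As σ respects the
      -- rotation, m turns after a marked dart correspond to m turns after its image, and these lead
      -- to the same cell in both embeddings; comparing tips then compares the two entries of that
      -- cell.
      preserving : ¬ (∃[ x ] MapsTo x false) →
        (∀ d → onDart σ (rot X.embedding d) ≡ rot Y.embedding (onDart σ d)) →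
        (∃[ g ] (∀ x → s x ≡ x ⊕ g)) × (∀ a → val a true ≡ val′ a true)
      preserving no-false comm = (s [ 0 ] , s-translation) , same
        where
        always : ∀ x → MapsTo x true
        always x = cases (marked-image x)
          where
          cases : ∃ (MapsTo x) → MapsTo x true
          cases (true , e)  = e
          cases (false , e) = contradiction (x , e) no-false
        s-[] : ∀ m → s [ m ] ≡ [ m ] ⊕ s [ 0 ]
        s-[] zero    = sym (⊕-identityˡ (s [ 0 ]))
        s-[] (suc m) = begin
          s [ suc m ]  ≡⟨ cong s (trans (cong [_] (ℕ.+-comm 1 m)) (sym ([]-⊕ m 1))) ⟩
          s ([ m ] ⊕ [ 1 ])  ≡⟨ next-true [ m ] (always [ m ]) ⟩
          s [ m ] ⊕ [ 1 ]  ≡⟨ cong (_⊕ [ 1 ]) (s-[] m) ⟩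
          ([ m ] ⊕ s [ 0 ]) ⊕ [ 1 ]  ≡⟨ swap-last [ m ] (s [ 0 ]) [ 1 ] ⟩
          ([ m ] ⊕ [ 1 ]) ⊕ s [ 0 ]  ≡⟨ cong (_⊕ s [ 0 ]) (trans ([]-⊕ m 1) (cong [_] (ℕ.+-comm m 1))) ⟩
          [ suc m ] ⊕ s [ 0 ]  ∎
          where open ≡-Reasoning
        s-translation : ∀ x → s x ≡ x ⊕ s [ 0 ]
        s-translation x = subst (λ z → s z ≡ z ⊕ s [ 0 ]) ([]-toℕ x) (s-[] (toℕ x))
        turned : ∀ m f f′ → onDart σ (X.unlabel f) ≡ Y.unlabel f′ →
          onDart σ (X.unlabel (iterate turn f m)) ≡ Y.unlabel (iterate turn f′ m)
        turned zero    f f′ e = e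
        turned (suc m) f f′ e = turned m (turn f) (turn f′) (begin
          onDart σ (X.unlabel (turn f))  ≡⟨ cong (onDart σ) (X.rot-unlabel f) ⟨
          onDart σ (rot X.embedding (X.unlabel f))  ≡⟨ comm (X.unlabel f) ⟩
          rot Y.embedding (onDart σ (X.unlabel f))  ≡⟨ cong (rot Y.embedding) e ⟩
          rot Y.embedding (Y.unlabel f′)  ≡⟨ Y.rot-unlabel f′ ⟩
          Y.unlabel (turn f′)  ∎)
          where open ≡-Reasoning
        turn-src : ∀ f y → turn (y , proj₂ f) ≡ (y , proj₂ (turn f))
        turn-src (x , a , true)  y = refl
        turn-src (x , a , false) y = refl
        iterate-src : ∀ m f y → iterate turn (y , proj₂ f) m ≡ (y , proj₂ (iterate turn f m))
        iterate-src zero    f y = refl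
        iterate-src (suc m) f y = trans (cong (λ z → iterate turn z m) (turn-src f y)) (iterate-src m (turn f) y)
        same : ∀ a → val a true ≡ val′ a true
        same a = from (turn-reach [ 0 ] (a₀ , true) (a , true))
          where
          open ≡-Reasoning
          image : ∃[ m ] iterate turn ([ 0 ] , a₀ , true) m ≡ ([ 0 ] , a , true) →
            onDart σ (X.unlabel ([ 0 ] , a , true)) ≡ Y.unlabel (s [ 0 ] , a , true)
          image (m , e) = begin
            onDart σ (X.unlabel ([ 0 ] , a , true))  ≡⟨ cong (onDart σ ∘ X.unlabel) e ⟨
            onDart σ (X.unlabel (iterate turn ([ 0 ] , a₀ , true) m))  ≡⟨ turned m ([ 0 ] , a₀ , true) (s [ 0 ] , a₀ , true) (always [ 0 ]) ⟩
            Y.unlabel (iterate turn (s [ 0 ] , a₀ , true) m)  ≡⟨ cong Y.unlabel (iterate-src m ([ 0 ] , a₀ , true) (s [ 0 ])) ⟩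
            Y.unlabel (s [ 0 ] , proj₂ (iterate turn ([ 0 ] , a₀ , true) m))  ≡⟨ cong (λ z → Y.unlabel (s [ 0 ] , proj₂ z)) e ⟩
            Y.unlabel (s [ 0 ] , a , true)  ∎
          from : ∃[ m ] iterate turn ([ 0 ] , a₀ , true) m ≡ ([ 0 ] , a , true) → val a true ≡ val′ a true
          from r = ⊕-cancelˡ ([ 0 ] ⊕ s [ 0 ]) (val a true) (val′ a true) (begin
            ([ 0 ] ⊕ s [ 0 ]) ⊕ val a true  ≡⟨ swap-last [ 0 ] (s [ 0 ]) (val a true) ⟩
            ([ 0 ] ⊕ val a true) ⊕ s [ 0 ]  ≡⟨ s-translation ([ 0 ] ⊕ val a true) ⟨
            s ([ 0 ] ⊕ val a true)  ≡⟨ tip-image {[ 0 ]} {a , true} {s [ 0 ]} {a , true} (image r) ⟩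
            s [ 0 ] ⊕ val′ a true  ≡⟨ cong (_⊕ val′ a true) (⊕-identityˡ (s [ 0 ])) ⟨
            ([ 0 ] ⊕ s [ 0 ]) ⊕ val′ a true  ∎)

    -- Orientation and sign give four cases. The images of x and x + 3 differ by 3 or -3 according
    -- to the sign, and by 3, 2, -4 or -5 according to the rotation. The mismatches 2 against -3, -4
    -- against 3 and -5 against -3 are impossible because 5, 7 and 2 are nonzero modulo v; hence
    -- `7<v`.
    iso-translation : (∃[ g ] (∀ x → s x ≡ x ⊕ g)) × (∀ a → val a true ≡ val′ a true)
    iso-translation = cases iso
      where
      rotated : ∀ x b → (∀ d → onDart σ (rot X.embedding d) ≡ rot Y.embedding (onDart σ d)) → MapsTo x b →
        onDart σ (rot X.embedding (X.unlabel (x , a₀ , true))) ≡ Y.unlabel (turn (s x , a₀ , b))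
      rotated x b comm e = trans (comm (X.unlabel (x , a₀ , true))) (trans (cong (rot Y.embedding) e) (Y.rot-unlabel (s x , a₀ , b)))
      counter-rotated : ∀ x b → (∀ d → onDart σ (rot X.embedding d) ≡ rot⁻¹ Y.embedding (onDart σ d)) → MapsTo x b →
        onDart σ (rot X.embedding (X.unlabel (x , a₀ , true))) ≡ Y.unlabel (turn⁻¹ (s x , a₀ , b))
      counter-rotated x b comm e = trans (comm (X.unlabel (x , a₀ , true))) (trans (cong (rot⁻¹ Y.embedding) e) (Y.rot⁻¹-unlabel (s x , a₀ , b)))
      cases : IsEmbeddingIso X.embedding Y.embedding σ → (∃[ g ] (∀ x → s x ≡ x ⊕ g)) × (∀ a → val a true ≡ val′ a true)
      cases (inj₁ comm) = preserving (λ { (x , e) → neg-[]≢ {3} {2} (s≤s z≤n) (≤7⇒<v (s≤s (s≤s (s≤s (s≤s (s≤s z≤n))))))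
        (⊕-cancelˡ (s x) (neg [ 3 ]) [ 2 ] (trans (sym (ahead-false x e))
          (via-row x (rotated x false comm e) M′.at-col→))) }) comm
      cases (inj₂ comm) = impossible (marked-image [ 0 ])
        where
        impossible : ∃ (MapsTo [ 0 ]) → (∃[ g ] (∀ x → s x ≡ x ⊕ g)) × (∀ a → val a true ≡ val′ a true)
        impossible (true , e) = contradiction
          (⊕-cancelˡ (s [ 0 ]) (neg [ 4 ]) [ 3 ] (trans
            (sym (via-row [ 0 ] (counter-rotated [ 0 ] true comm e)
              (trans (Labelling.val-not L′ (col← a₀) true) (cong neg M′.at-col←))))
            (ahead-true [ 0 ] e)))
          (neg-[]≢ {4} {3} (s≤s z≤n) (≤7⇒<v ℕ.≤-refl))
        impossible (false , e) = contradiction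
          ([]-injective {5} {3} (≤7⇒<v (s≤s (s≤s (s≤s (s≤s (s≤s z≤n)))))) (≤7⇒<v (s≤s (s≤s (s≤s z≤n))))
            (neg-injective {[ 5 ]} {[ 3 ]} (⊕-cancelˡ (s [ 0 ]) (neg [ 5 ]) (neg [ 3 ]) (trans
              (sym (via-row [ 0 ] (counter-rotated [ 0 ] false comm e) M′.at-row←))
              (ahead-false [ 0 ] e)))))
          λ ()

-- Arrays whose row and column permutations compose to a single cycle

parity : ∀ n → ∃[ i ] (n ≡ i + i ⊎ n ≡ suc (i + i))
parity zero = zero , inj₁ refl
parity (suc n) with parity n
... | i , inj₁ e = i , inj₂ (cong suc e)
... | i , inj₂ e = suc i , inj₁ (cong suc (trans e (sym (ℕ.+-suc i i))))

half-≤ : ∀ {i n} → i + i < suc (suc (n + n)) → i ≤ n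
half-≤ {i} {n} p = ℕ.≮⇒≥ λ n<i → ℕ.<⇒≱ p
  (ℕ.≤-trans (ℕ.≤-reflexive (cong suc (sym (ℕ.+-suc n n)))) (ℕ.+-mono-≤ n<i n<i))

-- Rows are added in pairs to a single one, so their number stays odd, and each array sits inside
-- the next under `old`.
data Row : ℕ → Set where
  base       : Row zero
  old        : ∀ {m} → Row m → Row (suc m)
  oddʳ evenʳ : ∀ {m} → Row (suc m)

_≟ʳ_ : ∀ {m} → DecidableEquality (Row m)
base  ≟ʳ base   = yes refl
old q ≟ʳ old q′ = map′ (cong old) (λ { refl → refl }) (q ≟ʳ q′)
old q ≟ʳ oddʳ   = no λ ()
old q ≟ʳ evenʳ  = no λ ()
oddʳ  ≟ʳ old q  = no λ ()
oddʳ  ≟ʳ oddʳ   = yes refl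
oddʳ  ≟ʳ evenʳ  = no λ ()
evenʳ ≟ʳ old q  = no λ ()
evenʳ ≟ʳ oddʳ   = no λ ()
evenʳ ≟ʳ evenʳ  = yes refl

rowCount : ℕ → ℕ
rowCount zero    = 1
rowCount (suc m) = rowCount m + 2

-- An array with rowCount m rows of odd length k = 3 + 2 j.  Its columns are the
-- images of the rows under an involution θ moving two cells of most rows.
module Array (j : ℕ) where

  k : ℕ
  k = suc (suc (suc (j + j)))

  open Cyclic k

  Cell : ℕ → Set
  Cell m = Row m × Fin k

  _≟ᶜ_ : ∀ {m} → DecidableEquality (Cell m)
  _≟ᶜ_ = ≡-dec _≟ʳ_ Fin._≟_

  last : Fin k
  last = [ suc (suc (j + j)) ]

  pattern odd  s = oddʳ , s
  pattern even s = evenʳ , s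

  embed : ∀ {m} → Cell m → Cell (suc m)
  embed (q , s) = old q , s

  -- The place where the next pair of rows is spliced in. It has to be fixed by `θ m`, so that
  -- exchanging it with a new cell extends the involution consistently.
  port : ∀ m → Cell m
  port zero    = base , [ 1 ]
  port (suc m) = even [ 1 ]

  -- The two transpositions added with a pair of rows have separate tasks: the one at index 0 links
  -- the new rows to each other, the one at `last` links them to the older array.
  θ : ∀ m → Cell m → Cell m
  θ zero    c = c
  θ (suc m) (old q , s) with (q , s) ≟ᶜ port m
  ... | yes _ = odd last
  ... | no  _ = embed (θ m (q , s))
  θ (suc m) (odd s) with s Fin.≟ [ 0 ] | s Fin.≟ last
  ... | yes _ | _     = even [ 0 ]
  ... | no  _ | yes _ = embed (port m)
  ... | no  _ | no  _ = odd s
  θ (suc m) (even s) with s Fin.≟ [ 0 ]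
  ... | yes _ = odd [ 0 ]
  ... | no  _ = even s

  next prev : ∀ {m} → Cell m → Cell m
  next (q , s) = q , s ⊕ [ 1 ]
  prev (q , s) = q , s ⊕ neg [ 1 ]

  next-prev : ∀ {m} (c : Cell m) → next (prev c) ≡ c
  next-prev (q , s) = cong (q ,_) (⊕neg-⊕ [ 1 ] s)

  prev-next : ∀ {m} (c : Cell m) → prev (next c) ≡ c
  prev-next (q , s) = cong (q ,_) (⊕-⊕neg′ [ 1 ] s)

  []≢ : ∀ {x y} → x < k → y < k → x ≢ y → [ x ] ≢ [ y ]
  []≢ x<k y<k x≢y e = x≢y ([]-injective x<k y<k e)

  private
    last<k : suc (suc (j + j)) < k
    last<k = ℕ.≤-refl

    []≢0 : ∀ {x} → suc x < k → [ suc x ] ≢ [ 0 ]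
    []≢0 x<k = []≢ x<k (s≤s z≤n) λ ()

    []≢last : ∀ {x} → x < suc (suc (j + j)) → [ x ] ≢ last
    []≢last x< = []≢ (ℕ.m<n⇒m<1+n x<) last<k (ℕ.<⇒≢ x<)

  [x]⊕[1] : ∀ x → [ x ] ⊕ [ 1 ] ≡ [ suc x ]
  [x]⊕[1] x = trans ([]-⊕ x 1) (cong [_] (ℕ.+-comm x 1))

  last⊕[1] : last ⊕ [ 1 ] ≡ [ 0 ]
  last⊕[1] = trans ([x]⊕[1] (suc (suc (j + j)))) [v]

  next≢ : ∀ {m} (c : Cell m) → next c ≢ c
  next≢ (q , s) e = []≢0 (s≤s (s≤s z≤n)) (⊕-cancelˡ s _ _ (trans (cong proj₂ e) (sym (⊕-identityʳ s))))

  prev≢ : ∀ {m} (c : Cell m) → prev c ≢ c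
  prev≢ c e = next≢ (prev c) (trans (next-prev c) (sym e))

  module _ {m : ℕ} where

    θ-even-0 : θ (suc m) (even [ 0 ]) ≡ odd [ 0 ]
    θ-even-0 with [ 0 ] Fin.≟ [ 0 ]
    ... | yes _ = refl
    ... | no ¬e = contradiction refl ¬e

    θ-even : ∀ {s} → s ≢ [ 0 ] → θ (suc m) (even s) ≡ even s
    θ-even {s} s≢0 with s Fin.≟ [ 0 ]
    ... | yes e = contradiction e s≢0
    ... | no _ = refl

    θ-odd-0 : θ (suc m) (odd [ 0 ]) ≡ even [ 0 ]
    θ-odd-0 with [ 0 ] Fin.≟ [ 0 ]
    ... | yes _ = refl
    ... | no ¬e = contradiction refl ¬e

    θ-odd-last : θ (suc m) (odd last) ≡ embed (port m)
    θ-odd-last with last Fin.≟ [ 0 ] | last Fin.≟ last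
    ... | yes e | _     = contradiction e ([]≢0 last<k)
    ... | no  _ | yes _ = refl
    ... | no  _ | no ¬e = contradiction refl ¬e

    θ-odd : ∀ {s} → s ≢ [ 0 ] → s ≢ last → θ (suc m) (odd s) ≡ odd s
    θ-odd {s} s≢0 s≢last with s Fin.≟ [ 0 ] | s Fin.≟ last
    ... | yes e | _     = contradiction e s≢0
    ... | no  _ | yes e = contradiction e s≢last
    ... | no  _ | no  _ = refl

    θ-embed-port : θ (suc m) (embed (port m)) ≡ odd last
    θ-embed-port with port m ≟ᶜ port m
    ... | yes _ = refl
    ... | no ¬e = contradiction refl ¬e

    θ-embed : ∀ {c} → c ≢ port m → θ (suc m) (embed c) ≡ embed (θ m c)
    θ-embed {c} c≢ with c ≟ᶜ port m
    ... | yes e = contradiction e c≢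
    ... | no _ = refl

  θ-port : ∀ m → θ m (port m) ≡ port m
  θ-port zero    = refl
  θ-port (suc m) = θ-even ([]≢0 (s≤s (s≤s z≤n)))

  θ-involutive : ∀ m c → θ m (θ m c) ≡ c
  θ-involutive zero    c = refl
  θ-involutive (suc m) (old q , s) = cases ((q , s) ≟ᶜ port m)
    where
    cases : Dec ((q , s) ≡ port m) → θ (suc m) (θ (suc m) (old q , s)) ≡ (old q , s)
    cases (yes refl) = trans (cong (θ (suc m)) θ-embed-port) θ-odd-last
    cases (no c≢) = trans (cong (θ (suc m)) (θ-embed c≢)) (trans
      (θ-embed (λ e → c≢ (trans (sym (θ-involutive m _)) (trans (cong (θ m) e) (θ-port m)))))
      (cong embed (θ-involutive m (q , s))))
  θ-involutive (suc m) (odd s) = cases (s Fin.≟ [ 0 ]) (s Fin.≟ last)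
    where
    cases : Dec (s ≡ [ 0 ]) → Dec (s ≡ last) → θ (suc m) (θ (suc m) (odd s)) ≡ odd s
    cases (yes refl) _          = trans (cong (θ (suc m)) θ-odd-0) θ-even-0
    cases (no _)     (yes refl) = trans (cong (θ (suc m)) θ-odd-last) θ-embed-port
    cases (no s≢0)   (no s≢l)   = trans (cong (θ (suc m)) (θ-odd s≢0 s≢l)) (θ-odd s≢0 s≢l)
  θ-involutive (suc m) (even s) = cases (s Fin.≟ [ 0 ])
    where
    cases : Dec (s ≡ [ 0 ]) → θ (suc m) (θ (suc m) (even s)) ≡ even s
    cases (yes refl) = trans (cong (θ (suc m)) θ-even-0) θ-odd-0
    cases (no s≢0)   = trans (cong (θ (suc m)) (θ-even s≢0)) (θ-even s≢0)

  -- Conjugation by `θ` gives the columns cycles of length k at once; what remains is to follow the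
  -- composite `θ ∘ next ∘ θ ∘ next`.
  rowPerm colPerm : ∀ m → Cell m ↔ Cell m
  rowPerm m = mk↔ₛ′ next prev next-prev prev-next
  colPerm m = mk↔ₛ′ (θ m ∘ next ∘ θ m) (θ m ∘ prev ∘ θ m)
    (λ c → trans (cong (θ m ∘ next) (θ-involutive m _)) (trans (cong (θ m) (next-prev (θ m c))) (θ-involutive m c)))
    (λ c → trans (cong (θ m ∘ prev) (θ-involutive m _)) (trans (cong (θ m) (prev-next (θ m c))) (θ-involutive m c)))

  step : ∀ {m} → Cell m → Cell m
  step {m} = Inverse.to (colPerm m) ∘ Inverse.to (rowPerm m)

  infix 4 _⟶_
  record _⟶_ {m} (c d : Cell m) : Set where
    constructor _,_
    field
      steps   : ℕ
      reaches : iterate step c steps ≡ d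

  ⟶-refl : ∀ {m} {c d : Cell m} → c ≡ d → c ⟶ d
  ⟶-refl e = 0 , e

  ⟶-step : ∀ {m} {c d : Cell m} → step c ≡ d → c ⟶ d
  ⟶-step e = 1 , e

  infixr 5 _⟫_
  _⟫_ : ∀ {m} {c d e : Cell m} → c ⟶ d → d ⟶ e → c ⟶ e
  (i , p) ⟫ (i′ , q) = i + i′ , trans (iterate-+ step _ i i′) (trans (cong (λ z → iterate step z i′) p) q)

  private
    module Gadget (m : ℕ) where

      step-at : ∀ (c : Cell (suc m)) {c₁ c₂ c₃} → next c ≡ c₁ → θ (suc m) c₁ ≡ c₂ → next c₂ ≡ c₃ → step c ≡ θ (suc m) c₃
      step-at c refl refl refl = refl

      e o : ℕ → Cell (suc m)
      e x = even [ x ]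
      o x = odd [ x ]

      ℓ : ℕ
      ℓ = suc (suc (j + j))

      next-e : ∀ x → next (e x) ≡ e (suc x)
      next-e x = cong (evenʳ ,_) ([x]⊕[1] x)

      next-o : ∀ x → next (o x) ≡ o (suc x)
      next-o x = cong (oddʳ ,_) ([x]⊕[1] x)

      next-e-last : next (e ℓ) ≡ e 0
      next-e-last = cong (evenʳ ,_) last⊕[1]

      next-o-last : next (o ℓ) ≡ o 0
      next-o-last = cong (oddʳ ,_) last⊕[1]

      θ-e : ∀ {x} → suc x < k → θ (suc m) (e (suc x)) ≡ e (suc x)
      θ-e x<k = θ-even ([]≢0 x<k)

      θ-o : ∀ {x} → suc x < ℓ → θ (suc m) (o (suc x)) ≡ o (suc x)
      θ-o x<ℓ = θ-odd ([]≢0 (ℕ.m<n⇒m<1+n x<ℓ)) ([]≢last x<ℓ)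

      double-step : ∀ x i → 2 + x + (i + i) ≡ x + (suc i + suc i)
      double-step = solve-∀

      even-run : ∀ x i y → x + (i + i) ≡ y → y < k → e x ⟶ e y
      even-run x zero    y eq y<k = ⟶-refl (cong e (trans (sym (ℕ.+-identityʳ x)) eq))
      even-run x (suc i) y eq y<k =
        ⟶-step (trans (step-at (e x) (next-e x) (θ-e {x} (ℕ.<-trans ℕ.≤-refl x+2<k)) (next-e (suc x))) (θ-e {suc x} x+2<k))
        ⟫ even-run (2 + x) i y eq′ y<k
        where
        eq′ : 2 + x + (i + i) ≡ y
        eq′ = trans (double-step x i) eq
        x+2<k : 2 + x < k
        x+2<k = ℕ.≤-<-trans (ℕ.m≤m+n (2 + x) (i + i)) (subst (_< k) (sym eq′) y<k)

      odd-run : ∀ x i y → x + (i + i) ≡ y → y < ℓ → o x ⟶ o y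
      odd-run x zero    y eq y<ℓ = ⟶-refl (cong o (trans (sym (ℕ.+-identityʳ x)) eq))
      odd-run x (suc i) y eq y<ℓ =
        ⟶-step (trans (step-at (o x) (next-o x) (θ-o {x} (ℕ.<-trans ℕ.≤-refl x+2<ℓ)) (next-o (suc x))) (θ-o {suc x} x+2<ℓ))
        ⟫ odd-run (2 + x) i y eq′ y<ℓ
        where
        eq′ : 2 + x + (i + i) ≡ y
        eq′ = trans (double-step x i) eq
        x+2<ℓ : 2 + x < ℓ
        x+2<ℓ = ℕ.≤-<-trans (ℕ.m≤m+n (2 + x) (i + i)) (subst (_< ℓ) (sym eq′) y<ℓ)

      i+d+i+d : ∀ i d → i + i + (d + d) ≡ i + d + (i + d)
      i+d+i+d = solve-∀

      fill : ∀ {i n} → i ≤ n → i + i + (n ∸ i + (n ∸ i)) ≡ n + n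
      fill {i} {n} i≤n = trans (i+d+i+d i (n ∸ i)) (cong (λ z → z + z) (ℕ.m+[n∸m]≡n i≤n))

      -- The two paths through the new rows: each is entered from, and left to,
      -- an embedded cell.
      last→1 : o ℓ ⟶ e 1
      last→1 = ⟶-step (trans (step-at (o ℓ) next-o-last θ-odd-0 (next-e 0)) (θ-e {0} (s≤s (s≤s z≤n))))

      even-odd→0 : ∀ i → i ≤ j → e (suc (i + i)) ⟶ o 0
      even-odd→0 i i≤j = even-run (suc (i + i)) (j ∸ i) (suc (j + j)) (cong suc (fill i≤j)) (ℕ.<-trans ℕ.≤-refl last<k)
        ⟫ ⟶-step (trans (step-at (e (suc (j + j))) (next-e (suc (j + j))) (θ-e {suc (j + j)} last<k) next-e-last) θ-even-0)

      odd-even→port : ∀ i → i ≤ j → o (i + i) ⟶ embed (port m)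
      odd-even→port i i≤j = odd-run (i + i) (j ∸ i) (j + j) (fill i≤j) (ℕ.m<n⇒m<1+n ℕ.≤-refl)
        ⟫ ⟶-step (trans (step-at (o (j + j)) (next-o (j + j)) (θ-o {j + j} ℕ.≤-refl) (next-o (suc (j + j)))) θ-odd-last)

      even-even→1 : ∀ i → i ≤ suc j → e (i + i) ⟶ o 1
      even-even→1 i i≤j = even-run (i + i) (suc j ∸ i) ℓ (trans (fill i≤j) (cong suc (ℕ.+-suc j j))) last<k
        ⟫ ⟶-step (trans (step-at (e ℓ) next-e-last θ-even-0 (next-o 0)) (θ-o {0} (s≤s (s≤s z≤n))))

      odd-odd→ : ∀ i → i ≤ j → o (suc (i + i)) ⟶ embed (θ m (next (port m)))
      odd-odd→ i i≤j = odd-run (suc (i + i)) (j ∸ i) (suc (j + j)) (cong suc (fill i≤j)) ℕ.≤-refl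
        ⟫ ⟶-step (trans (step-at (o (suc (j + j))) (next-o (suc (j + j))) θ-odd-last refl) (θ-embed (next≢ (port m))))

      -- This detour visits 0, 2, ..., ℓ in the even row and then 1, 3, ..., ℓ - 1 in the odd row.
      -- The one of `odd-last→` visits ℓ in the odd row, then 1, 3, ..., ℓ - 1 in the even row and
      -- 0, 2, ..., ℓ - 2 in the odd row. Between them they meet every new cell once.
      even-0→ : e 0 ⟶ embed (θ m (next (port m)))
      even-0→ = even-even→1 0 z≤n ⟫ odd-odd→ 0 z≤n

      odd-last→ : o ℓ ⟶ embed (port m)
      odd-last→ = last→1 ⟫ even-odd→0 0 z≤n ⟫ odd-even→port 0 z≤n

      →even-0 : ∀ w → next w ≡ port m → embed w ⟶ e 0
      →even-0 w p = ⟶-step (trans (step-at (embed w) (cong embed p) θ-embed-port next-o-last) θ-odd-0)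

      →odd-last : ∀ w → next w ≢ port m → next (θ m (next w)) ≡ port m → embed w ⟶ o ℓ
      →odd-last w ≢port p = ⟶-step (trans (step-at (embed w) refl (θ-embed ≢port) (cong embed p)) θ-embed-port)

      -- A step of the older array applies `next` twice and is disturbed only when one of the two
      -- lands on the port. This happens at one cell for each, and the detour taken instead ends
      -- where the old step would have ended.
      simulate : ∀ w → embed w ⟶ embed (step w)
      simulate w with next w ≟ᶜ port m
      ... | yes p = →even-0 w p ⟫ subst (λ z → e 0 ⟶ embed (θ m (next z))) (trans (sym (θ-port m)) (sym (cong (θ m) p))) even-0→
      ... | no ≢port with next (θ m (next w)) ≟ᶜ port m
      ...   | yes p = →odd-last w ≢port p ⟫ subst (λ z → o ℓ ⟶ embed z) (trans (sym (θ-port m)) (sym (cong (θ m) p))) odd-last→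
      ...   | no ≢port′ = ⟶-step (trans (step-at (embed w) refl (θ-embed ≢port) refl) (θ-embed ≢port′))

      embed-⟶ : ∀ {c d} → c ⟶ d → embed c ⟶ embed d
      embed-⟶ (zero  , p) = ⟶-refl (cong embed p)
      embed-⟶ {c} (suc i , p) = simulate c ⟫ embed-⟶ (i , p)

      entry-last : embed (prev (θ m (prev (port m)))) ⟶ o ℓ
      entry-last = →odd-last _
        (λ p → prev≢ (port m) (trans (sym (θ-involutive m _)) (trans (cong (θ m) (trans (sym (next-prev _)) p)) (θ-port m))))
        (trans (cong (next ∘ θ m) (next-prev _)) (trans (cong next (θ-involutive m _)) (next-prev _)))

      entry-0 : embed (prev (port m)) ⟶ e 0
      entry-0 = →even-0 _ (next-prev _)

      reached : ∀ (c : Cell (suc m)) → Σ[ a ∈ Cell m ] embed a ⟶ c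
      leaves : ∀ (c : Cell (suc m)) → Σ[ a ∈ Cell m ] c ⟶ embed a
      reached (old q , s) = (q , s) , ⟶-refl refl
      reached (even s) = cases (toℕ s) (toℕ<n s) ([]-toℕ s)
        where
        cases : ∀ x → x < k → [ x ] ≡ s → Σ[ a ∈ Cell m ] embed a ⟶ even s
        cases x x<k refl with parity x
        ... | i , inj₁ refl = _ , entry-0 ⟫ even-run 0 i _ refl x<k
        ... | i , inj₂ refl = _ , entry-last ⟫ last→1 ⟫ even-run 1 i _ refl x<k
      reached (odd s) = cases (toℕ s) (toℕ<n s) ([]-toℕ s)
        where
        cases : ∀ x → x < k → [ x ] ≡ s → Σ[ a ∈ Cell m ] embed a ⟶ odd s
        cases x x<k refl with x ℕ.≟ suc (suc (j + j))
        ... | yes refl = _ , entry-last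
        ... | no x≢ with parity x
        ...   | i , inj₁ refl = _ , entry-last ⟫ last→1 ⟫ even-odd→0 0 z≤n ⟫ odd-run 0 i _ refl (ℕ.≤∧≢⇒< (s≤s⁻¹ x<k) x≢)
        ...   | i , inj₂ refl = _ , entry-0 ⟫ even-even→1 0 z≤n ⟫ odd-run 1 i _ refl (ℕ.≤∧≢⇒< (s≤s⁻¹ x<k) x≢)
      leaves (old q , s) = (q , s) , ⟶-refl refl
      leaves (even s) = cases (toℕ s) (toℕ<n s) ([]-toℕ s)
        where
        cases : ∀ x → x < k → [ x ] ≡ s → Σ[ a ∈ Cell m ] even s ⟶ embed a
        cases x x<k refl with parity x
        ... | i , inj₁ refl = _ , even-even→1 i (half-≤ (ℕ.≤-trans x<k (s≤s (s≤s (s≤s (ℕ.+-monoʳ-≤ j (ℕ.n≤1+n j))))))) ⟫ odd-odd→ 0 z≤n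
        ... | i , inj₂ refl = _ , even-odd→0 i (half-≤ (s≤s⁻¹ x<k)) ⟫ odd-even→port 0 z≤n
      leaves (odd s) = cases (toℕ s) (toℕ<n s) ([]-toℕ s)
        where
        cases : ∀ x → x < k → [ x ] ≡ s → Σ[ a ∈ Cell m ] odd s ⟶ embed a
        cases x x<k refl with x ℕ.≟ suc (suc (j + j))
        ... | yes refl = _ , odd-last→
        ... | no x≢ with parity x
        ...   | i , inj₁ refl = _ , odd-even→port i (half-≤ (ℕ.≤∧≢⇒< (s≤s⁻¹ x<k) x≢))
        ...   | i , inj₂ refl = _ , odd-odd→ i (half-≤ (ℕ.m<n⇒m<1+n (s≤s⁻¹ (ℕ.≤∧≢⇒< (s≤s⁻¹ x<k) x≢))))

  step-transitive : ∀ m (c d : Cell m) → c ⟶ d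
  step-transitive zero (base , s) (base , s′) = subst (λ z → (base , s) ⟶ (base , z)) (⊖-⊕ s s′)
    (subst (λ z → (base , s) ⟶ (base , s ⊕ z)) ([]-toℕ (s′ ⊖ s)) (reach (toℕ (s′ ⊖ s))))
    where
    double : ∀ i s → (base , s) ⟶ (base , s ⊕ [ i + i ])
    double zero    s = ⟶-refl (cong (base ,_) (sym (⊕-identityʳ s)))
    double (suc i) s = ⟶-step refl ⟫ subst (λ z → (base , (s ⊕ [ 1 ]) ⊕ [ 1 ]) ⟶ (base , z)) (begin
      ((s ⊕ [ 1 ]) ⊕ [ 1 ]) ⊕ [ i + i ]  ≡⟨ cong (_⊕ [ i + i ]) (trans (⊕-assoc s _ _) (cong (s ⊕_) ([]-⊕ 1 1))) ⟩
      (s ⊕ [ 2 ]) ⊕ [ i + i ]  ≡⟨ trans (⊕-assoc s _ _) (cong (s ⊕_) ([]-⊕ 2 (i + i))) ⟩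
      s ⊕ [ 2 + (i + i) ]  ≡⟨ cong (λ z → s ⊕ [ suc z ]) (sym (ℕ.+-suc i i)) ⟩
      s ⊕ [ suc i + suc i ]  ∎) (double i _)
      where open ≡-Reasoning
    -- k is odd, so every residue is even
    reach : ∀ x → (base , s) ⟶ (base , s ⊕ [ x ])
    reach x with parity x
    ... | i , inj₁ refl = double i s
    -- Twice i + (2 + j) is k + (2 i + 1), so the odd offset is also reached by an even number of
    -- applications of `next`.
    ... | i , inj₂ refl = subst (λ z → (base , s) ⟶ (base , s ⊕ z)) (trans (cong [_] (lemma i j)) ([v+] _)) (double (i + (2 + j)) s)
      where
      lemma : ∀ i j → i + (2 + j) + (i + (2 + j)) ≡ 3 + (j + j) + suc (i + i)
      lemma = solve-∀
  step-transitive (suc m) c d =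
    let open Gadget m; a , p = leaves c; b , q = reached d in p ⟫ embed-⟶ (step-transitive m a b) ⟫ q

-- Lines and prescribed cells of the array

rows : ∀ m → List (Row m)
rows zero    = base ∷ []
rows (suc m) = oddʳ ∷ evenʳ ∷ map old (rows m)

∈-rows : ∀ {m} (q : Row m) → q ∈ rows m
∈-rows base    = here refl
∈-rows (old q) = there (there (∈-map⁺ old (∈-rows q)))
∈-rows oddʳ    = here refl
∈-rows evenʳ   = there (here refl)

length-rows : ∀ m → length (rows m) ≡ rowCount m
length-rows zero    = refl
length-rows (suc m) = trans (cong (λ z → 2 + z) (trans (List.length-map old (rows m)) (length-rows m))) (ℕ.+-comm 2 _)

row-index : ∀ m → Row m ↔ Fin (rowCount m)
row-index zero = mk↔ₛ′ (λ _ → Fin.zero) (λ _ → base) (λ { Fin.zero → refl ; (Fin.suc ()) }) (λ { base → refl })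
row-index (suc m) = ↔-sym (+↔⊎ {rowCount m} {2}) ↔-∘ mk↔ₛ′ to from to-from from-to
  where
  module I = Inverse (row-index m)
  to : Row (suc m) → Fin (rowCount m) ⊎ Fin 2
  to (old q) = inj₁ (I.to q)
  to oddʳ    = inj₂ Fin.zero
  to evenʳ   = inj₂ (Fin.suc Fin.zero)
  from : Fin (rowCount m) ⊎ Fin 2 → Row (suc m)
  from (inj₁ i)                  = old (I.from i)
  from (inj₂ Fin.zero)           = oddʳ
  from (inj₂ (Fin.suc Fin.zero)) = evenʳ
  to-from : ∀ i → to (from i) ≡ i
  to-from (inj₁ i)                  = cong inj₁ (I.inverseˡ refl)
  to-from (inj₂ Fin.zero)           = refl
  to-from (inj₂ (Fin.suc Fin.zero)) = refl
  from-to : ∀ q → from (to q) ≡ q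
  from-to (old q) = cong old (I.inverseʳ refl)
  from-to oddʳ    = refl
  from-to evenʳ   = refl

module ArrayLines (j m : ℕ) where

  open Array j public
  open Cyclic k

  A : Set
  A = Cell (suc m)

  row col : A ↔ A
  row = rowPerm (suc m)
  col = colPerm (suc m)

  abstract
    cell-index : A ↔ Fin (rowCount (suc m) * k)
    cell-index = ↔-sym *↔× ↔-∘ mk↔ₛ′ (λ (q , s) → I.to q , s) (λ (i , s) → I.from i , s)
      (λ (i , s) → cong (_, s) (I.inverseˡ refl)) (λ (q , s) → cong (_, s) (I.inverseʳ refl))
      where
      module I = Inverse (row-index (suc m))

  line← line→ : Bool → A → A
  line→ true  = Inverse.to col
  line→ false = Inverse.to row
  line← true  = Inverse.from col
  line← false = Inverse.from row

  -- This lets `Row` index the lines of both directions: line `q` of direction `b` consists of the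
  -- cells `place b (q , s)`.
  place : Bool → A → A
  place true  = θ (suc m)
  place false = id

  place-involutive : ∀ b a → place b (place b a) ≡ a
  place-involutive true  a = θ-involutive (suc m) a
  place-involutive false a = refl

  iterate-next : ∀ (a : A) i → iterate next a i ≡ (proj₁ a , proj₂ a ⊕ [ i ])
  iterate-next (q , s) zero    = cong (q ,_) (sym (⊕-identityʳ s))
  iterate-next (q , s) (suc i) = trans (iterate-next (q , s ⊕ [ 1 ]) i)
    (cong (q ,_) (trans (⊕-assoc s [ 1 ] [ i ]) (cong (s ⊕_) ([]-⊕ 1 i))))

  iterate-line : ∀ b a i → iterate (line→ b) (place b a) i ≡ place b (iterate next a i)
  iterate-line true  a i = iterate-cong next (line→ true) (θ (suc m)) (λ c → cong (θ (suc m) ∘ next) (θ-involutive (suc m) c)) a i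
  iterate-line false a i = refl

  iterate-line′ : ∀ b a i → iterate (line→ b) a i ≡ place b (iterate next (place b a) i)
  iterate-line′ b a i = trans (cong (λ z → iterate (line→ b) z i) (sym (place-involutive b a))) (iterate-line b (place b a) i)

  line-period : ∀ b a → iterate (line→ b) a k ≡ a
  line-period b a = begin
    iterate (line→ b) a k  ≡⟨ iterate-line′ b a k ⟩
    place b (iterate next (place b a) k) ≡⟨ cong (place b) (iterate-next (place b a) k) ⟩
    place b (proj₁ (place b a) , proj₂ (place b a) ⊕ [ k ])
                                         ≡⟨ cong (λ z → place b (proj₁ (place b a) , z)) (trans (cong (proj₂ (place b a) ⊕_) [v]) (⊕-identityʳ (proj₂ (place b a)))) ⟩
    place b (place b a)  ≡⟨ place-involutive b a ⟩
    a  ∎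
    where open ≡-Reasoning

  line-period⁻¹ : ∀ b a i → iterate (line→ b) a i ≡ a → k ∣ i
  line-period⁻¹ b a i e = []≡0⇒∣ i (⊕-cancelˡ (proj₂ (place b a)) [ i ] [ 0 ] (trans (cong proj₂ back) (sym (⊕-identityʳ (proj₂ (place b a))))))
    where
    back : (proj₁ (place b a) , proj₂ (place b a) ⊕ [ i ]) ≡ place b a
    back = begin
      (proj₁ (place b a) , proj₂ (place b a) ⊕ [ i ])  ≡⟨ iterate-next (place b a) i ⟨
      iterate next (place b a) i  ≡⟨ place-involutive b _ ⟨
      place b (place b (iterate next (place b a) i))  ≡⟨ cong (place b) (iterate-line′ b a i) ⟨
      place b (iterate (line→ b) a i)  ≡⟨ cong (place b) e ⟩
      place b a  ∎
      where open ≡-Reasoning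

  on-line : ∀ b q s s′ → ∃[ i ] iterate (line→ b) (place b (q , s)) i ≡ place b (q , s′)
  on-line b q s s′ = toℕ (s′ ⊖ s) , trans (iterate-line b (q , s) (toℕ (s′ ⊖ s))) (cong (place b)
    (trans (iterate-next (q , s) (toℕ (s′ ⊖ s))) (cong (q ,_) (trans (cong (s ⊕_) ([]-toℕ (s′ ⊖ s))) (⊖-⊕ s s′)))))

  line→-line← : ∀ b a → line→ b (line← b a) ≡ a
  line→-line← true  a = Inverse.inverseˡ col refl
  line→-line← false a = Inverse.inverseˡ row refl

  line←-line→ : ∀ b a → line← b (line→ b a) ≡ a
  line←-line→ true  a = Inverse.inverseʳ col refl
  line←-line→ false a = Inverse.inverseʳ row refl

  line→≢ : ∀ b a → line→ b a ≢ a
  line→≢ b a e = ℕ.<⇒≱ (s≤s (s≤s z≤n)) (∣⇒≤ (line-period⁻¹ b a 1 e))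

  line←≢ : ∀ b a → line← b a ≢ a
  line←≢ b a e = line→≢ b a (trans (sym (cong (line→ b) e)) (line→-line← b a))

  line→≢line← : ∀ b a → line→ b a ≢ line← b a
  line→≢line← b a e = ℕ.<⇒≱ (s≤s (s≤s (s≤s z≤n))) (∣⇒≤ (line-period⁻¹ b a 2 (trans (cong (line→ b) e) (line→-line← b a))))

  step≢ : ∀ (a : A) → step a ≢ a
  step≢ a e with step-transitive (suc m) a (next a)
  ... | i , p = next≢ a (trans (sym p) (stays i))
    where
    stays : ∀ i → iterate step a i ≡ a
    stays zero    = refl
    stays (suc i) = trans (cong (λ z → iterate step z i) e) (stays i)

  -- Equality would make `col→ a` a fixed point of the composite, which is one long cycle. This is
  -- what allows the forward triangle at `a` to be broken at `col→ a` with the backward one left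
  -- intact.
  col→≢row← : ∀ a → line→ true a ≢ line← false a
  col→≢row← a e = step≢ (line→ true a) (cong (line→ true) (trans (cong (line→ false) e) (line→-line← false a)))

  transitive : ∀ a b → ∃[ i ] iterate (line→ true ∘ line→ false) a i ≡ b
  transitive a b = let i , p = step-transitive (suc m) a b in i , p

  -- `θ` exchanges `odd [ 0 ]` with `even [ 0 ]`, so the column neighbours of `a₀` lie in the even
  -- row and its row neighbours in the odd one. Hence all four are distinct even for k = 3.
  a₀ a₁ a₂ a₃ a₄ : A
  a₀ = odd [ 0 ]
  a₁ = even [ 1 ]
  a₂ = odd [ 1 ]
  a₃ = even last
  a₄ = odd last

  private
    1<k : 1 < k
    1<k = s≤s (s≤s z≤n)

    ℓ<k : suc (suc (j + j)) < k
    ℓ<k = ℕ.≤-refl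

    1≢0 : [ 1 ] ≢ [ 0 ]
    1≢0 = []≢ 1<k (s≤s z≤n) λ ()

    last≢0 : last ≢ [ 0 ]
    last≢0 = []≢ ℓ<k (s≤s z≤n) λ ()

    1≢last : [ 1 ] ≢ last
    1≢last = []≢ 1<k ℓ<k λ ()

    0-1 : [ 0 ] ⊕ neg [ 1 ] ≡ last
    0-1 = trans (cong (_⊕ neg [ 1 ]) (sym last⊕[1])) (⊕-⊕neg′ [ 1 ] last)

    1-1 : [ 1 ] ⊕ neg [ 1 ] ≡ [ 0 ]
    1-1 = neg-inverseʳ [ 1 ]

    0+1 : [ 0 ] ⊕ [ 1 ] ≡ [ 1 ]
    0+1 = ⊕-identityˡ [ 1 ]

  col→a₀ : line→ true a₀ ≡ a₁
  col→a₀ = trans (cong (θ (suc m) ∘ next) θ-odd-0) (trans (cong (λ z → θ (suc m) (even z)) 0+1) (θ-even 1≢0))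

  row→a₀ : line→ false a₀ ≡ a₂
  row→a₀ = cong (oddʳ ,_) 0+1

  col←a₀ : line← true a₀ ≡ a₃
  col←a₀ = trans (cong (θ (suc m) ∘ prev) θ-odd-0) (trans (cong (λ z → θ (suc m) (even z)) 0-1) (θ-even last≢0))

  row←a₀ : line← false a₀ ≡ a₄
  row←a₀ = cong (oddʳ ,_) 0-1

  forcedCells : List A
  forcedCells = a₀ ∷ a₁ ∷ a₂ ∷ a₃ ∷ a₄ ∷ []

  forcedCells-unique : Unique forcedCells
  forcedCells-unique =
      ((λ ()) ∷ (λ e → 1≢0 (sym (cong proj₂ e))) ∷ (λ ()) ∷ (λ e → last≢0 (sym (cong proj₂ e))) ∷ [])
    ∷ ((λ ()) ∷ (λ e → 1≢last (cong proj₂ e)) ∷ (λ ()) ∷ [])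
    ∷ ((λ ()) ∷ (λ e → 1≢last (cong proj₂ e)) ∷ [])
    ∷ ((λ ()) ∷ []) ∷ [] ∷ []

  even∉ : ∀ {s} → s ≢ [ 1 ] → s ≢ last → even s ∉ forcedCells
  even∉ s≢1 s≢l (there (here e))                 = s≢1 (cong proj₂ e)
  even∉ s≢1 s≢l (there (there (there (here e)))) = s≢l (cong proj₂ e)
  even∉ s≢1 s≢l (there (there (there (there (there ())))))

  odd∉ : ∀ {s} → s ≢ [ 0 ] → s ≢ [ 1 ] → s ≢ last → odd s ∉ forcedCells
  odd∉ s≢0 s≢1 s≢l (here e)                               = s≢0 (cong proj₂ e)
  odd∉ s≢0 s≢1 s≢l (there (there (here e)))               = s≢1 (cong proj₂ e)
  odd∉ s≢0 s≢1 s≢l (there (there (there (there (here e))))) = s≢l (cong proj₂ e)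

  embed∉ : ∀ c → embed c ∉ forcedCells
  embed∉ c (there (there (there (there (there ())))))

  even-0∉ : even [ 0 ] ∉ forcedCells
  even-0∉ = even∉ (1≢0 ∘ sym) (last≢0 ∘ sym)

  neighbours : A → List A
  neighbours a = a ∷ line→ true a ∷ line→ false a ∷ line← true a ∷ line← false a ∷ []

  -- A coincidence at `a` can only be broken at a cell whose entry is not prescribed. The prescribed
  -- cells around `a₀` have such a cell next to them: `even [ 0 ]` in three cases, and for `a₄` a
  -- cell of the older array, reached through the port.
  free-neighbour : ∀ a → a ≢ a₀ → Σ[ x ∈ A ] x ∈ neighbours a × x ∉ forcedCells
  free-neighbour a a≢a₀ with Any.any? (a ≟ᶜ_) forcedCells
  ... | no a∉ = a , here refl , a∉
  ... | yes (here refl) = contradiction refl a≢a₀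
  ... | yes (there (here refl)) = even [ 0 ] , there (there (there (there (here (cong (evenʳ ,_) (sym 1-1)))))) , even-0∉
  ... | yes (there (there (here refl))) = even [ 0 ] , there (there (there (here (sym (begin
      θ (suc m) (prev (θ (suc m) (odd [ 1 ])))  ≡⟨ cong (θ (suc m) ∘ prev) (θ-odd 1≢0 1≢last) ⟩
      θ (suc m) (odd ([ 1 ] ⊕ neg [ 1 ]))  ≡⟨ cong (λ z → θ (suc m) (odd z)) 1-1 ⟩
      θ (suc m) (odd [ 0 ])  ≡⟨ θ-odd-0 ⟩
      even [ 0 ]  ∎))))) , even-0∉
    where open ≡-Reasoning
  ... | yes (there (there (there (here refl)))) = even [ 0 ] , there (there (here (cong (evenʳ ,_) (sym last⊕[1])))) , even-0∉
  ... | yes (there (there (there (there (here refl))))) = embed (θ m (next (port m))) , there (here (sym (begin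
      θ (suc m) (next (θ (suc m) (odd last)))  ≡⟨ cong (θ (suc m) ∘ next) θ-odd-last ⟩
      θ (suc m) (embed (next (port m)))  ≡⟨ θ-embed (next≢ (port m)) ⟩
      embed (θ m (next (port m)))  ∎))) , embed∉ _
    where open ≡-Reasoning

  -- On arrays with three columns the row and the column of a₀ are entirely
  -- forced; every other line has a cell that is not.
  line-representative : ∀ b q → Σ[ s ∈ Fin k ]
    (place b (q , s) ∉ forcedCells ⊎ (j ≡ 0 × place b (q , s) ≡ a₀))
  line-representative false (old q) = [ 0 ] , inj₁ (embed∉ (q , [ 0 ]))
  line-representative false evenʳ   = [ 0 ] , inj₁ even-0∉
  line-representative true  (old q) = [ 0 ] , inj₁ (λ p → embed∉ (θ m (q , [ 0 ])) (subst (_∈ forcedCells) (θ-embed (not-port m q)) p))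
    where
    not-port : ∀ m (q : Row m) → (q , [ 0 ]) ≢ port m
    not-port zero    q e = 1≢0 (sym (cong proj₂ e))
    not-port (suc m) q e = 1≢0 (sym (cong proj₂ e))
  line-representative true  oddʳ    = [ 0 ] , inj₁ (λ p → even-0∉ (subst (_∈ forcedCells) θ-odd-0 p))
  line-representative false oddʳ with j ℕ.≟ 0
  ... | yes j≡0 = [ 0 ] , inj₂ (j≡0 , refl)
  ... | no j≢0 = [ 2 ] , inj₁ (odd∉ ([]≢ 2<k (s≤s z≤n) λ ()) ([]≢ 2<k 1<k λ ()) ([]≢ 2<k ℓ<k 2≢ℓ))
    where
    2<k : 2 < k
    2<k = s≤s (s≤s (s≤s z≤n))
    2≢ℓ : 2 ≢ suc (suc (j + j))
    2≢ℓ e = j≢0 (ℕ.m+n≡0⇒m≡0 j (sym (ℕ.suc-injective (ℕ.suc-injective e))))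
  line-representative true evenʳ with j ℕ.≟ 0
  ... | yes j≡0 = [ 0 ] , inj₂ (j≡0 , θ-even-0)
  ... | no j≢0 = [ 2 ] , inj₁ (λ p → even∉ ([]≢ 2<k 1<k λ ()) ([]≢ 2<k ℓ<k 2≢ℓ)
      (subst (_∈ forcedCells) (θ-even ([]≢ 2<k (s≤s z≤n) λ ())) p))
    where
    2<k : 2 < k
    2<k = s≤s (s≤s (s≤s z≤n))
    2≢ℓ : 2 ≢ suc (suc (j + j))
    2≢ℓ e = j≢0 (ℕ.m+n≡0⇒m≡0 j (sym (ℕ.suc-injective (ℕ.suc-injective e))))

  line→² : j ≡ 0 → ∀ b a → line→ b (line→ b a) ≡ line← b a
  line→² refl b a = trans (sym (line←-line→ b _)) (cong (line← b) (line-period b a))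

-- Placements as signed permutations

transpose-left : ∀ {n} (i j : Fin n) → PC.transpose i j i ≡ j
transpose-left i j rewrite Dec.dec-true (i Fin.≟ i) refl = refl

transpose-right : ∀ {n} (i j : Fin n) → PC.transpose i j j ≡ i
transpose-right i j with j Fin.≟ i
... | yes j≡i = j≡i
... | no _ rewrite Dec.dec-true (j Fin.≟ j) refl = refl

transpose-other : ∀ {n} {i j k : Fin n} → k ≢ i → k ≢ j → PC.transpose i j k ≡ k
transpose-other {i = i} {j} {k} k≢i k≢j
  rewrite Dec.dec-false (k Fin.≟ i) k≢i | Dec.dec-false (k Fin.≟ j) k≢j = refl

-- Bijective labellings of the cells by Fin N, with a sign for each label.
module Configurations {A : Set} (N : ℕ) (cell-index : A ↔ Fin N) where

  private
    to   = Inverse.to cell-index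
    from = Inverse.from cell-index
    from-to : ∀ a → from (to a) ≡ a
    from-to a = Inverse.inverseʳ cell-index refl
    to-from : ∀ i → to (from i) ≡ i
    to-from i = Inverse.inverseˡ cell-index refl

    to-injective : ∀ {a b} → to a ≡ to b → a ≡ b
    to-injective {a} {b} e = trans (sym (from-to a)) (trans (cong from e) (from-to b))

  _≟ᵃ_ : DecidableEquality A
  a ≟ᵃ b = map′ to-injective (cong to) (to a Fin.≟ to b)

  -- Signs belong to magnitudes rather than to cells, so that `swap` carries an entry along with its
  -- sign.
  Ω : Set
  Ω = Fin (2 ^ N) × Fin (N !)

  configurations : List Ω
  configurations = cartesianProduct (allFin (2 ^ N)) (allFin (N !))

  configurations-unique : Unique configurations
  configurations-unique = Unique.cartesianProduct⁺ (Unique.allFin⁺ _) (Unique.allFin⁺ _)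

  ∈-configurations : ∀ ω → ω ∈ configurations
  ∈-configurations (s , i) = ∈-cartesianProduct⁺ (∈-allFin s) (∈-allFin i)

  length-configurations : length configurations ≡ 2 ^ N * N !
  length-configurations = trans (length-cartesianProduct (allFin (2 ^ N)) (allFin (N !)))
    (cong₂ (λ x y → x * y) (List.length-tabulate {n = 2 ^ N} id) (List.length-tabulate {n = N !} id))

  cells : List A
  cells = map from (allFin N)

  ∈-cells : ∀ a → a ∈ cells
  ∈-cells a = subst (_∈ cells) (from-to a) (∈-map⁺ from (∈-allFin (to a)))

  cells-unique : Unique cells
  cells-unique = Unique.map⁺ (λ {i} {j} e → trans (sym (to-from i)) (trans (cong to e) (to-from j))) (Unique.allFin⁺ N)

  length-cells : length cells ≡ N
  length-cells = trans (List.length-map from (allFin N)) (List.length-tabulate id)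

  magnitude : Ω → A → Fin N
  magnitude (s , i) a = decode N i ⟨$⟩ʳ to a

  sign : Ω → Fin N → Bool
  sign (s , i) x = Inverse.to 2↔Bool (finToFun s x)

  location : Ω → Fin N → A
  location (s , i) x = from (decode N i ⟨$⟩ˡ x)

  signed : Ω → A → Fin N × Bool
  signed ω a = magnitude ω a , sign ω (magnitude ω a)

  magnitude-location : ∀ ω x → magnitude ω (location ω x) ≡ x
  magnitude-location (s , i) x = trans (cong (decode N i ⟨$⟩ʳ_) (to-from _)) (Perm.inverseʳ (decode N i))

  location-magnitude : ∀ ω a → location ω (magnitude ω a) ≡ a
  location-magnitude (s , i) a = trans (cong from (Perm.inverseˡ (decode N i))) (from-to a)

  magnitude-injective : ∀ ω {a b} → magnitude ω a ≡ magnitude ω b → a ≡ b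
  magnitude-injective ω {a} {b} e =
    trans (sym (location-magnitude ω a)) (trans (cong (location ω) e) (location-magnitude ω b))

  signed-ext : ∀ {ω ω′} → (∀ a → signed ω a ≡ signed ω′ a) → ω ≡ ω′
  signed-ext {s , i} {s′ , i′} e = cong₂ _,_ same-signs same-perm
    where
    same-perm : i ≡ i′
    same-perm = decode-injective N (λ x → subst (λ z → decode N i ⟨$⟩ʳ z ≡ decode N i′ ⟨$⟩ʳ z) (to-from x) (cong proj₁ (e (from x))))
    sign-at : ∀ x → sign (s , i) x ≡ sign (s′ , i′) x
    sign-at x = begin
      sign (s , i) x  ≡⟨ cong (sign (s , i)) (magnitude-location (s , i) x) ⟨
      sign (s , i) (magnitude (s , i) a)  ≡⟨ cong proj₂ (e a) ⟩
      sign (s′ , i′) (magnitude (s′ , i′) a)  ≡⟨ cong (sign (s′ , i′)) (cong proj₁ (e a)) ⟨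
      sign (s′ , i′) (magnitude (s , i) a)  ≡⟨ cong (sign (s′ , i′)) (magnitude-location (s , i) x) ⟩
      sign (s′ , i′) x  ∎
      where
      open ≡-Reasoning
      a = location (s , i) x
    bit-injective : ∀ {x y} → Inverse.to 2↔Bool x ≡ Inverse.to 2↔Bool y → x ≡ y
    bit-injective {x} {y} e = trans (sym (Inverse.inverseʳ 2↔Bool refl)) (trans (cong (Inverse.from 2↔Bool) e) (Inverse.inverseʳ 2↔Bool refl))
    same-signs : s ≡ s′
    same-signs = begin
      s  ≡⟨ funToFin-finToFin {N} {2} s ⟨
      funToFin {N} {2} (finToFun s)  ≡⟨ funToFin-cong N (λ x → bit-injective (sign-at x)) ⟩
      funToFin {N} {2} (finToFun s′)  ≡⟨ funToFin-finToFin {N} {2} s′ ⟩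
      s′  ∎
      where
      open ≡-Reasoning
      funToFin-cong : ∀ n {f g : Fin n → Fin 2} → (∀ x → f x ≡ g x) → funToFin f ≡ funToFin g
      funToFin-cong zero    e = refl
      funToFin-cong (suc n) e = cong₂ combine (e Fin.zero) (funToFin-cong n (λ x → e (Fin.suc x)))

  exchange : A → A → A → A
  exchange x y a = from (PC.transpose (to x) (to y) (to a))

  exchange-left : ∀ x y → exchange x y x ≡ y
  exchange-left x y = trans (cong from (transpose-left (to x) (to y))) (from-to y)

  exchange-right : ∀ x y → exchange x y y ≡ x
  exchange-right x y = trans (cong from (transpose-right (to x) (to y))) (from-to x)

  exchange-other : ∀ {x y a} → a ≢ x → a ≢ y → exchange x y a ≡ a
  exchange-other {a = a} a≢x a≢y =
    trans (cong from (transpose-other (λ e → a≢x (to-injective e)) (λ e → a≢y (to-injective e)))) (from-to a)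

  exchange-involutive : ∀ x y a → exchange x y (exchange x y a) ≡ a
  exchange-involutive x y a = cases (a ≟ᵃ x) (a ≟ᵃ y)
    where
    cases : Dec (a ≡ x) → Dec (a ≡ y) → exchange x y (exchange x y a) ≡ a
    cases (yes refl) _          = trans (cong (exchange x y) (exchange-left x y)) (exchange-right x y)
    cases (no _)     (yes refl) = trans (cong (exchange x y) (exchange-right x y)) (exchange-left x y)
    cases (no a≢x)   (no a≢y)   = trans (cong (exchange x y) (exchange-other a≢x a≢y)) (exchange-other a≢x a≢y)

  swap : A → A → Ω → Ω
  swap x y (s , i) = s , encode (Perm.transpose (to x) (to y) Perm.∘ₚ decode N i)

  magnitude-swap : ∀ x y ω a → magnitude (swap x y ω) a ≡ magnitude ω (exchange x y a)
  magnitude-swap x y (s , i) a = trans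
    (decode-encode (Perm.transpose (to x) (to y) Perm.∘ₚ decode N i) (to a))
    (cong (decode N i ⟨$⟩ʳ_) (sym (to-from (PC.transpose (to x) (to y) (to a)))))

  signed-swap : ∀ x y ω a → signed (swap x y ω) a ≡ signed ω (exchange x y a)
  signed-swap x y ω@(s , i) a = cong (λ z → z , sign ω z) (magnitude-swap x y ω a)

  swap-involutive : ∀ x y ω → swap x y (swap x y ω) ≡ ω
  swap-involutive x y ω = signed-ext λ a → trans (signed-swap x y (swap x y ω) a)
    (trans (signed-swap x y ω (exchange x y a)) (cong (signed ω) (exchange-involutive x y a)))

  toggle : Fin N → Fin N → Bool → Bool
  toggle x y b = if does (y Fin.≟ x) then not b else b

  flipSign : Fin N → Ω → Ω
  flipSign x (s , i) = funToFin (λ y → Inverse.from 2↔Bool (toggle x y (sign (s , i) y))) , i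

  sign-flipSign : ∀ x ω y → sign (flipSign x ω) y ≡ toggle x y (sign ω y)
  sign-flipSign x (s , i) y = trans (cong (Inverse.to 2↔Bool) (finToFun-funToFin _ y)) (Inverse.inverseˡ 2↔Bool refl)

  toggle-same : ∀ x b → toggle x x b ≡ not b
  toggle-same x b rewrite Dec.dec-true (x Fin.≟ x) refl = refl

  toggle-other : ∀ {x y} b → y ≢ x → toggle x y b ≡ b
  toggle-other {x} {y} b y≢x rewrite Dec.dec-false (y Fin.≟ x) y≢x = refl

  toggle-involutive : ∀ x y b → toggle x y (toggle x y b) ≡ b
  toggle-involutive x y b with does (y Fin.≟ x)
  ... | true  = Bool.not-involutive b
  ... | false = refl

  signed-flipSign : ∀ x ω a → signed (flipSign x ω) a ≡ (magnitude ω a , toggle x (magnitude ω a) (sign ω (magnitude ω a)))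
  signed-flipSign x ω a = cong (magnitude ω a ,_) (sign-flipSign x ω (magnitude ω a))

  flipSign-involutive : ∀ x ω → flipSign x (flipSign x ω) ≡ ω
  flipSign-involutive x ω = signed-ext λ a → trans (signed-flipSign x (flipSign x ω) a)
    (cong (magnitude ω a ,_) (trans (cong (toggle x (magnitude ω a)) (sign-flipSign x ω (magnitude ω a)))
      (toggle-involutive x (magnitude ω a) (sign ω (magnitude ω a)))))

-- The residues outside `J` and their pairing by negation

opposite-sum : ∀ {n} (i : Fin n) → suc (toℕ i) + toℕ (opposite i) ≡ n
opposite-sum {n} i = trans (cong (λ z → suc (toℕ i) + z) (opposite-prop i)) (ℕ.m+[n∸m]≡n (toℕ<n i))

opposite-unique : ∀ {n} (i j : Fin n) → suc (toℕ i) + toℕ j ≡ n → opposite i ≡ j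
opposite-unique i j e = toℕ-injective (ℕ.+-cancelˡ-≡ (suc (toℕ i)) (toℕ (opposite i)) (toℕ j) (trans (opposite-sum i) (sym e)))

-- The residues outside J are a w + r with 0 < r < w, where w = v / t = suc u.
-- Listing them in increasing order, negation reverses the list.
module NonMultiples (t u N : ℕ) .{{_ : NonZero t}} .{{_ : NonZero (t * suc u)}} (tu≡2N : t * u ≡ N + N) where

  v : ℕ
  v = t * suc u

  open Cyclic v

  v/t : v ÷ t ≡ suc u
  v/t = trans (cong (_÷ t) (ℕ.*-comm t (suc u))) (m*n/n≡m (suc u) t)

  J⇒∣ : ∀ {α} → J v t α → suc u ∣ toℕ α
  J⇒∣ {α} = subst (_∣ toℕ α) v/t

  ∣⇒J : ∀ {α} → suc u ∣ toℕ α → J v t α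
  ∣⇒J {α} = subst (_∣ toℕ α) (sym v/t)

  u+1≤v : suc u ≤ v
  u+1≤v = ℕ.m≤n*m (suc u) t

  small∉J : ∀ {m} → suc m ≤ u → ¬ J v t [ suc m ]
  small∉J {m} m<u p = ℕ.<⇒≱ (s≤s m<u) (∣⇒≤ (subst (suc u ∣_) (toℕ-[]-< (ℕ.<-≤-trans (s≤s m<u) u+1≤v)) (J⇒∣ {[ suc m ]} p)))

  private
    J-multiple : ∀ {α} x → toℕ α ≡ x → J v t α → suc u ∣ x
    J-multiple {α} x refl = J⇒∣ {α}

  neg∉J : ∀ {α} → ¬ J v t α → ¬ J v t (neg α)
  neg∉J {α} ¬Jα p = ¬Jα (∣⇒J {α} (∣m+n∣m⇒∣n (subst (suc u ∣_) sum≡v (n∣m*n t)) (∣n∣m%n⇒∣m (n∣m*n t) (J-multiple {neg α} _ (toℕ-[] (v ∸ toℕ α)) p))))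
    where
    sum≡v : v ≡ (v ∸ toℕ α) + toℕ α
    sum≡v = sym (ℕ.m∸n+n≡m (toℕ≤n α))

  point : Fin t → Fin u → Fin v
  point a r = combine a (Fin.suc r)

  toℕ-point : ∀ a r → toℕ (point a r) ≡ suc u * toℕ a + suc (toℕ r)
  toℕ-point a r = toℕ-combine a (Fin.suc r)

  point∉J : ∀ a r → ¬ J v t (point a r)
  point∉J a r p = ℕ.<⇒≱ (s≤s (toℕ<n r)) (∣⇒≤ (∣m+n∣m⇒∣n
    (J-multiple {point a r} _ (toℕ-point a r) p) (m∣m*n (toℕ a))))

  point-surjective : ∀ α → ¬ J v t α → Σ[ ar ∈ Fin t × Fin u ] uncurry point ar ≡ α
  point-surjective α ¬Jα = cases (remQuot {t} (suc u) α) (combine-remQuot {t} (suc u) α)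
    where
    cases : (qr : Fin t × Fin (suc u)) → uncurry combine qr ≡ α → Σ[ ar ∈ Fin t × Fin u ] uncurry point ar ≡ α
    cases (a , Fin.suc r) e = (a , r) , e
    cases (a , Fin.zero)  e = contradiction (∣⇒J {α} (divides (toℕ a) (begin
      toℕ α  ≡⟨ cong toℕ e ⟨
      toℕ (combine a (Fin.zero {u})) ≡⟨ toℕ-combine a (Fin.zero {u}) ⟩
      suc u * toℕ a + 0  ≡⟨ ℕ.+-identityʳ (suc u * toℕ a) ⟩
      suc u * toℕ a  ≡⟨ ℕ.*-comm (suc u) (toℕ a) ⟩
      toℕ a * suc u  ∎))) ¬Jα
      where open ≡-Reasoning

  private
    opposite-combine : ∀ (a : Fin t) (r : Fin u) → opposite (combine a r) ≡ combine (opposite a) (opposite r)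
    opposite-combine a r = opposite-unique (combine a r) (combine (opposite a) (opposite r)) (begin
      suc (toℕ (combine a r)) + toℕ (combine (opposite a) (opposite r))
        ≡⟨ cong₂ (λ x y → suc x + y) (toℕ-combine a r) (toℕ-combine (opposite a) (opposite r)) ⟩
      suc (u * toℕ a + toℕ r) + (u * toℕ (opposite a) + toℕ (opposite r))
        ≡⟨ regroup u (toℕ a) (toℕ r) (toℕ (opposite a)) (toℕ (opposite r)) ⟩
      u * (toℕ a + toℕ (opposite a)) + (suc (toℕ r) + toℕ (opposite r))
        ≡⟨ cong (λ z → u * (toℕ a + toℕ (opposite a)) + z) (opposite-sum r) ⟩
      u * (toℕ a + toℕ (opposite a)) + u
        ≡⟨ factor u (toℕ a + toℕ (opposite a)) ⟩
      suc (toℕ a + toℕ (opposite a)) * u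
        ≡⟨ cong (_* u) (opposite-sum a) ⟩
      t * u ∎)
      where
      open ≡-Reasoning
      regroup : ∀ u a r a′ r′ → suc (u * a + r) + (u * a′ + r′) ≡ u * (a + a′) + (suc r + r′)
      regroup = solve-∀
      factor : ∀ u x → u * x + u ≡ suc x * u
      factor = solve-∀

    -- Both digits are complemented: with w = u + 1, the numbers a w + (r + 1) and (t - 1 - a) w +
    -- (u - r) add up to t w = v.
    neg-point : ∀ a r → neg (point a r) ≡ point (opposite a) (opposite r)
    neg-point a r = sym (⊕≡0⇒≡neg (point a r) (point (opposite a) (opposite r)) (trans (cong [_] total) [v]))
      where
      open ≡-Reasoning
      regroup : ∀ w a r a′ r′ → w * a + suc r + (w * a′ + suc r′) ≡ w * (a + a′) + suc (suc r + r′)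
      regroup = solve-∀
      factor : ∀ w x → w * x + w ≡ suc x * w
      factor = solve-∀
      total : toℕ (point a r) + toℕ (point (opposite a) (opposite r)) ≡ v
      total = begin
        toℕ (point a r) + toℕ (point (opposite a) (opposite r))
          ≡⟨ cong₂ (λ x y → x + y) (toℕ-point a r) (toℕ-point (opposite a) (opposite r)) ⟩
        suc u * toℕ a + suc (toℕ r) + (suc u * toℕ (opposite a) + suc (toℕ (opposite r)))
          ≡⟨ regroup (suc u) (toℕ a) (toℕ r) (toℕ (opposite a)) (toℕ (opposite r)) ⟩
        suc u * (toℕ a + toℕ (opposite a)) + suc (suc (toℕ r) + toℕ (opposite r))
          ≡⟨ cong (λ z → suc u * (toℕ a + toℕ (opposite a)) + suc z) (opposite-sum r) ⟩
        suc u * (toℕ a + toℕ (opposite a)) + suc u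
          ≡⟨ factor (suc u) (toℕ a + toℕ (opposite a)) ⟩
        suc (toℕ a + toℕ (opposite a)) * suc u
          ≡⟨ cong (_* suc u) (opposite-sum a) ⟩
        t * suc u ∎

  element : Fin (N + N) → Fin v
  element i = uncurry point (remQuot {t} u (cast (sym tu≡2N) i))

  private
    element∉J : ∀ i → ¬ J v t (element i)
    element∉J i = point∉J (proj₁ (remQuot {t} u (cast (sym tu≡2N) i))) (proj₂ (remQuot {t} u (cast (sym tu≡2N) i)))

    element-injective : ∀ {i i′} → element i ≡ element i′ → i ≡ i′
    element-injective {i} {i′} e = toℕ-injective (begin
      toℕ i  ≡⟨ Fin.toℕ-cast (sym tu≡2N) i ⟨
      toℕ (cast (sym tu≡2N) i)  ≡⟨ cong toℕ same ⟩
      toℕ (cast (sym tu≡2N) i′)  ≡⟨ Fin.toℕ-cast (sym tu≡2N) i′ ⟩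
      toℕ i′  ∎)
      where
      open ≡-Reasoning
      point-injective : ∀ a r a′ r′ → point a r ≡ point a′ r′ → (a , r) ≡ (a′ , r′)
      point-injective a r a′ r′ e with refl , refl ← Fin.combine-injective a (Fin.suc r) a′ (Fin.suc r′) e = refl
      same : cast (sym tu≡2N) i ≡ cast (sym tu≡2N) i′
      same = trans (sym (combine-remQuot {t} u (cast (sym tu≡2N) i)))
        (trans (cong (uncurry combine) (point-injective _ _ _ _ e)) (combine-remQuot {t} u (cast (sym tu≡2N) i′)))

    element-surjective : ∀ α → ¬ J v t α → Σ[ i ∈ Fin (N + N) ] element i ≡ α
    element-surjective α ¬Jα with (a , r) , e ← point-surjective α ¬Jα =
      cast tu≡2N (combine a r) , trans (cong (uncurry point) (trans
        (cong (remQuot {t} u) (Fin.cast-involutive (sym tu≡2N) tu≡2N (combine a r))) (remQuot-combine a r))) e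

    opposite-cast : ∀ i → cast (sym tu≡2N) (opposite i) ≡ opposite (cast (sym tu≡2N) i)
    opposite-cast i = sym (opposite-unique (cast (sym tu≡2N) i) (cast (sym tu≡2N) (opposite i)) (trans
      (cong₂ (λ x y → suc x + y) (Fin.toℕ-cast (sym tu≡2N) i) (Fin.toℕ-cast (sym tu≡2N) (opposite i)))
      (trans (opposite-sum i) (sym tu≡2N))))

    neg-element : ∀ i → neg (element i) ≡ element (opposite i)
    neg-element i = from (remQuot {t} u (cast (sym tu≡2N) i)) (combine-remQuot {t} u (cast (sym tu≡2N) i))
      where
      from : ∀ ar → uncurry combine ar ≡ cast (sym tu≡2N) i → neg (uncurry point ar) ≡ element (opposite i)
      from (a , r) e = trans (neg-point a r) (cong (uncurry point) (sym (begin
        remQuot {t} u (cast (sym tu≡2N) (opposite i))  ≡⟨ cong (remQuot {t} u) (opposite-cast i) ⟩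
        remQuot {t} u (opposite (cast (sym tu≡2N) i))  ≡⟨ cong (remQuot {t} u ∘ opposite) e ⟨
        remQuot {t} u (opposite (combine a r))  ≡⟨ cong (remQuot {t} u) (opposite-combine a r) ⟩
        remQuot {t} u (combine (opposite a) (opposite r)) ≡⟨ remQuot-combine (opposite a) (opposite r) ⟩
        (opposite a , opposite r)  ∎)))
        where open ≡-Reasoning

    opposite-↑ˡ : ∀ (x : Fin N) → opposite (x Fin.↑ˡ N) ≡ N Fin.↑ʳ opposite x
    opposite-↑ˡ x = opposite-unique (x Fin.↑ˡ N) (N Fin.↑ʳ opposite x) (begin
      suc (toℕ (x Fin.↑ˡ N)) + toℕ (N Fin.↑ʳ opposite x)  ≡⟨ cong₂ (λ x y → suc x + y) (Fin.toℕ-↑ˡ x N) (Fin.toℕ-↑ʳ N (opposite x)) ⟩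
      suc (toℕ x) + (N + toℕ (opposite x))  ≡⟨ swap-middle (suc (toℕ x)) N (toℕ (opposite x)) ⟩
      N + (suc (toℕ x) + toℕ (opposite x))  ≡⟨ cong (λ z → N + z) (opposite-sum x) ⟩
      N + N  ∎)
      where
      open ≡-Reasoning
      swap-middle : ∀ a b c → a + (b + c) ≡ b + (a + c)
      swap-middle = solve-∀

  -- The lower half of the list represents each pair {α , -α}: the list has even length 2 N and
  -- negation reverses it, so no member is its own negative.
  value : Fin N → Bool → Fin v
  value x true  = element (x Fin.↑ˡ N)
  value x false = element (N Fin.↑ʳ opposite x)

  value-not : ∀ x b → value x (not b) ≡ neg (value x b)
  value-not x true  = sym (trans (neg-element (x Fin.↑ˡ N)) (cong element (opposite-↑ˡ x)))
  value-not x false = trans (sym (neg-involutive (value x true))) (cong neg (sym (value-not x true)))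

  value∉J : ∀ x b → ¬ J v t (value x b)
  value∉J x true  = element∉J (x Fin.↑ˡ N)
  value∉J x false = element∉J (N Fin.↑ʳ opposite x)

  private
    ↑ˡ≢↑ʳ : ∀ (x y : Fin N) → x Fin.↑ˡ N ≢ N Fin.↑ʳ y
    ↑ˡ≢↑ʳ x y e = case trans (sym (Fin.splitAt-↑ˡ N x N)) (trans (cong (splitAt N) e) (Fin.splitAt-↑ʳ N N y)) of λ ()

    opposite-injective : ∀ {x y : Fin N} → opposite x ≡ opposite y → x ≡ y
    opposite-injective {x} {y} e = trans (sym (Fin.opposite-involutive x)) (trans (cong opposite e) (Fin.opposite-involutive y))

  value-injective : ∀ {x b x′ b′} → value x b ≡ value x′ b′ → (x , b) ≡ (x′ , b′)
  value-injective {x} {true} {x′} {true} e = cong (_, true) (Fin.↑ˡ-injective N x x′ (element-injective e))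
  value-injective {x} {false} {x′} {false} e = cong (_, false)
    (opposite-injective (Fin.↑ʳ-injective N (opposite x) (opposite x′) (element-injective e)))
  value-injective {x} {true} {x′} {false} e = contradiction (element-injective e) (↑ˡ≢↑ʳ x (opposite x′))
  value-injective {x} {false} {x′} {true} e = contradiction (sym (element-injective e)) (↑ˡ≢↑ʳ x′ (opposite x))

  value-surjective : ∀ α → ¬ J v t α → Σ[ l ∈ Fin N × Bool ] value (proj₁ l) (proj₂ l) ≡ α
  value-surjective α ¬Jα = from (element-surjective α ¬Jα)
    where
    cases : ∀ i (s : Fin N ⊎ Fin N) → Fin.join N N s ≡ i → Σ[ l ∈ Fin N × Bool ] value (proj₁ l) (proj₂ l) ≡ element i
    cases i (inj₁ x) e = (x , true) , cong element e
    cases i (inj₂ y) e = (opposite y , false) , cong element (trans (cong (N Fin.↑ʳ_) (Fin.opposite-involutive y)) e)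
    from : Σ[ i ∈ Fin (N + N) ] element i ≡ α → Σ[ l ∈ Fin N × Bool ] value (proj₁ l) (proj₂ l) ≡ α
    from (i , e) = let l , p = cases i (splitAt N i) (Fin.join-splitAt N N i) in l , trans p e

-- Swapping and prescribing entries

module Family (j m t u : ℕ) .{{_ : NonZero t}} .{{_ : NonZero (t * suc u)}}
  (tu≡2N : t * u ≡ rowCount (suc m) * Array.k j + rowCount (suc m) * Array.k j) (9≤u : 9 ≤ u) (t∣v : t ∣ t * suc u)
  where

  open ArrayLines j m

  N : ℕ
  N = rowCount (suc m) * k

  open NonMultiples t u N tu≡2N
  open Cyclic v
  open Configurations N cell-index
  open Counting configurations configurations-unique ∈-configurations

  1∉J : ¬ J v t [ 1 ]
  1∉J = small∉J (ℕ.≤-trans (s≤s z≤n) 9≤u)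

  9<v : 9 < v
  9<v = ℕ.≤-trans (s≤s 9≤u) u+1≤v

  7<v : 7 < v
  7<v = ℕ.≤-trans (s≤s (s≤s (s≤s (s≤s (s≤s (s≤s (s≤s (s≤s z≤n)))))))) 9<v

  -- The product of two signs with `true` as +1. A second multiplication by the same sign undoes it,
  -- which gives surjectivity of the labelling.
  signedBy : Bool → Bool → Bool
  signedBy true  s = s
  signedBy false s = not s

  labelled : Ω → Labelling v t A
  labelled ω = record
    { val = val
    ; val-not = λ a b → trans (cong (value (magnitude ω a)) (signedBy-not b (sign ω (magnitude ω a)))) (value-not (magnitude ω a) (signedBy b (sign ω (magnitude ω a))))
    ; val-∉J = λ a b → value∉J (magnitude ω a) (signedBy b (sign ω (magnitude ω a)))
    ; val-injective = λ {a} {b} {a′} {b′} e → injective a b a′ b′ (value-injective {magnitude ω a} {signedBy b (sign ω (magnitude ω a))} {magnitude ω a′} {signedBy b′ (sign ω (magnitude ω a′))} e)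
    ; val-surjective = λ α ¬Jα → surjective α (value-surjective α ¬Jα) }
    where
    val : A → Bool → Fin v
    val a b = value (magnitude ω a) (signedBy b (sign ω (magnitude ω a)))
    signedBy-not : ∀ b s → signedBy (not b) s ≡ not (signedBy b s)
    signedBy-not true  s = refl
    signedBy-not false s = sym (Bool.not-involutive s)
    signedBy-injective : ∀ s {b b′} → signedBy b s ≡ signedBy b′ s → b ≡ b′
    signedBy-injective s     {true}  {true}  e = refl
    signedBy-injective s     {false} {false} e = refl
    signedBy-injective true  {true}  {false} ()
    signedBy-injective false {true}  {false} ()
    signedBy-injective true  {false} {true}  ()
    signedBy-injective false {false} {true}  ()
    signedBy-signedBy : ∀ b s → signedBy (signedBy b s) s ≡ b
    signedBy-signedBy true  true  = refl
    signedBy-signedBy true  false = refl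
    signedBy-signedBy false true  = refl
    signedBy-signedBy false false = refl
    injective : ∀ a b a′ b′ →
      (magnitude ω a , signedBy b (sign ω (magnitude ω a))) ≡ (magnitude ω a′ , signedBy b′ (sign ω (magnitude ω a′))) →
      (a , b) ≡ (a′ , b′)
    injective a b a′ b′ e = from (magnitude-injective ω {a} {a′} (cong proj₁ e)) (cong proj₂ e)
      where
      from : a ≡ a′ → signedBy b (sign ω (magnitude ω a)) ≡ signedBy b′ (sign ω (magnitude ω a′)) → (a , b) ≡ (a′ , b′)
      from refl e = cong (a ,_) (signedBy-injective (sign ω (magnitude ω a)) e)
    surjective : ∀ α → Σ[ l ∈ Fin N × Bool ] value (proj₁ l) (proj₂ l) ≡ α → Σ[ l ∈ A × Bool ] val (proj₁ l) (proj₂ l) ≡ α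
    surjective α ((x , b) , e) = (location ω x , signedBy b (sign ω x)) , (begin
      value (magnitude ω (location ω x)) (signedBy (signedBy b (sign ω x)) (sign ω (magnitude ω (location ω x))))
        ≡⟨ cong (λ y → value y (signedBy (signedBy b (sign ω x)) (sign ω y))) (magnitude-location ω x) ⟩
      value x (signedBy (signedBy b (sign ω x)) (sign ω x))
        ≡⟨ cong (value x) (signedBy-signedBy b (sign ω x)) ⟩
      value x b
        ≡⟨ e ⟩
      α ∎)
      where open ≡-Reasoning

  open Rigidity v t t∣v 7<v 1∉J row col transitive a₀ public

  -- This computes to `entry (labelled ω)`, so the conditions of `Rigidity` apply to it directly.
  val : Ω → A → Fin v
  val ω a = uncurry value (signed ω a)

  val-injective : ∀ ω {a b} → val ω a ≡ val ω b → a ≡ b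
  val-injective ω {a} {b} e = magnitude-injective ω {a} {b}
    (cong proj₁ (value-injective {magnitude ω a} {sign ω (magnitude ω a)} {magnitude ω b} {sign ω (magnitude ω b)} e))

  val-swap : ∀ x y ω a → val (swap x y ω) a ≡ val ω (exchange x y a)
  val-swap x y ω a = cong (uncurry value) (signed-swap x y ω a)

  val-ext : ∀ {ω ω′} → (∀ a → val ω a ≡ val ω′ a) → ω ≡ ω′
  val-ext {ω} {ω′} e = signed-ext {ω} {ω′} λ a →
    value-injective {magnitude ω a} {sign ω (magnitude ω a)} {magnitude ω′ a} {sign ω′ (magnitude ω′ a)} (e a)

  cellsOutside : List A → List A
  cellsOutside avoid = filter (λ y → ¬? (Any.any? (y ≟ᵃ_) avoid)) cells

  cellsOutside-unique : ∀ avoid → Unique (cellsOutside avoid)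
  cellsOutside-unique avoid = Unique.filter⁺ _ cells-unique

  ∉-cellsOutside : ∀ {avoid y} → y ∈ cellsOutside avoid → y ∉ avoid
  ∉-cellsOutside {avoid} p = proj₂ (∈-filter⁻ (λ y → ¬? (Any.any? (y ≟ᵃ_) avoid)) {xs = cells} p)

  length-cellsOutside : ∀ avoid → N ∸ length avoid ≤ length (cellsOutside avoid)
  length-cellsOutside avoid = ℕ.m≤n+o⇒m∸n≤o N (length avoid) (subst₂ _≤_ length-cells
    (trans (List.length-++ (cellsOutside avoid)) (ℕ.+-comm (length (cellsOutside avoid)) (length avoid)))
    (injection⇒length≤ cells-unique id cover (λ _ _ e → e)))
    where
    cover : ∀ {y} → y ∈ cells → y ∈ cellsOutside avoid ++ avoid
    cover {y} y∈ with Any.any? (y ≟ᵃ_) avoid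
    ... | yes y∈avoid = ∈-++⁺ʳ (cellsOutside avoid) y∈avoid
    ... | no  y∉avoid = ∈-++⁺ˡ (∈-filter⁺ (λ y → ¬? (Any.any? (y ≟ᵃ_) avoid)) y∈ y∉avoid)

  -- P and h fix the value at x once the values at the other cells of avoid are
  -- known, so ω and y can be recovered from swap x y ω and h ω.
  swap-bound : ∀ {P Q : Ω → Set} (P? : Decidable P) (Q? : Decidable Q) {D : Set} (zs : List D) (h : Ω → D) (x : A) (avoid : List A) →
    (∀ ω → h ω ∈ zs) → x ∈ avoid →
    (∀ ω y → y ∉ avoid → Q ω → Q (swap x y ω)) →
    (∀ ω ω′ → P ω → P ω′ → (∀ z → z ∈ avoid → z ≢ x → val ω z ≡ val ω′ z) → h ω ≡ h ω′ → val ω x ≡ val ω′ x) →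
    # (λ ω → P? ω ×-dec Q? ω) * (N ∸ length avoid) ≤ # Q? * length zs
  swap-bound {P} {Q} P? Q? zs h x avoid h∈ x∈avoid Q-swap determined = ℕ.≤-trans
    (ℕ.*-monoʳ-≤ (# (λ ω → P? ω ×-dec Q? ω)) (length-cellsOutside avoid))
    (#-injection (λ ω → P? ω ×-dec Q? ω) Q? (cellsOutside-unique avoid) zs (λ ω y → swap x y ω) (λ ω y → h ω)
      (λ ω y (_ , q) y∈ → Q-swap ω y (∉-cellsOutside y∈) q , h∈ ω)
      (λ ω y ω′ y′ (p , _) y∈ (p′ , _) y′∈ e eh → injective ω y ω′ y′ p (∉-cellsOutside y∈) p′ (∉-cellsOutside y′∈) e eh))
    where
    open ≡-Reasoning
    injective : ∀ ω y ω′ y′ → P ω → y ∉ avoid → P ω′ → y′ ∉ avoid → swap x y ω ≡ swap x y′ ω′ → h ω ≡ h ω′ → ω ≡ ω′ × y ≡ y′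
    injective ω y ω′ y′ p y∉ p′ y′∉ e eh = same-ω , same-y
      where
      ≢-outside : ∀ {z w} → z ∈ avoid → w ∉ avoid → z ≢ w
      ≢-outside z∈ w∉ refl = w∉ z∈
      agree : ∀ z → z ∈ avoid → z ≢ x → val ω z ≡ val ω′ z
      agree z z∈ z≢x = begin
        val ω z  ≡⟨ cong (val ω) (exchange-other z≢x (≢-outside z∈ y∉)) ⟨
        val ω (exchange x y z)  ≡⟨ val-swap x y ω z ⟨
        val (swap x y ω) z  ≡⟨ cong (λ ω → val ω z) e ⟩
        val (swap x y′ ω′) z  ≡⟨ val-swap x y′ ω′ z ⟩
        val ω′ (exchange x y′ z)  ≡⟨ cong (val ω′) (exchange-other z≢x (≢-outside z∈ y′∉)) ⟩
        val ω′ z  ∎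
      at : ∀ y ω → val (swap x y ω) y ≡ val ω x
      at y ω = trans (val-swap x y ω y) (cong (val ω) (exchange-right x y))
      -- After the swap, `y` holds the value that `x` had before. That value is already known to
      -- agree on both sides, and no two cells share a value.
      same-y : y ≡ y′
      same-y = val-injective (swap x y ω) (begin
        val (swap x y ω) y  ≡⟨ at y ω ⟩
        val ω x  ≡⟨ determined ω ω′ p p′ agree eh ⟩
        val ω′ x  ≡⟨ at y′ ω′ ⟨
        val (swap x y′ ω′) y′  ≡⟨ cong (λ ω → val ω y′) e ⟨
        val (swap x y ω) y′  ∎)
      same-ω : ω ≡ ω′
      same-ω = begin
        ω  ≡⟨ swap-involutive x y ω ⟨
        swap x y (swap x y ω)  ≡⟨ cong (swap x y) e ⟩
        swap x y (swap x y′ ω′)  ≡⟨ cong (λ z → swap x z (swap x y′ ω′)) same-y ⟩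
        swap x y′ (swap x y′ ω′)  ≡⟨ swap-involutive x y′ ω′ ⟩
        ω′  ∎

  Prescribed : List (A × Fin v) → Ω → Set
  Prescribed L ω = All (λ p → val ω (proj₁ p) ≡ proj₂ p) L

  prescribed? : ∀ L → Decidable (Prescribed L)
  prescribed? L ω = All.all? (λ p → val ω (proj₁ p) Fin.≟ proj₂ p) L

  prescribed-swap : ∀ {L} x y ω → x ∉ map proj₁ L → y ∉ map proj₁ L → Prescribed L ω → Prescribed L (swap x y ω)
  prescribed-swap x y ω x∉ y∉ [] = []
  prescribed-swap {(a , β) ∷ L} x y ω x∉ y∉ (e ∷ es) =
    trans (val-swap x y ω a) (trans (cong (val ω) (exchange-other (λ { refl → x∉ (here refl) }) (λ { refl → y∉ (here refl) }))) e)
    ∷ prescribed-swap x y ω (x∉ ∘ there) (y∉ ∘ there) es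

  -- Any placement is repaired by correcting the sign of the pair {β , -β} and swapping its cell
  -- with `a`. The flip bit and the former cell, 2 N possibilities, undo the repair. Earlier
  -- prescriptions survive because their values are not in that pair.
  prescribe-bound : ∀ L a β → a ∉ map proj₁ L → ¬ J v t β → All (λ p → proj₂ p ≢ β × proj₂ p ≢ neg β) L →
    # (prescribed? L) ≤ # (prescribed? ((a , β) ∷ L)) * (2 * N)
  prescribe-bound L a β a∉ ¬Jβ distinct = subst₂ _≤_ (ℕ.*-identityʳ _) (cong (λ z → # (prescribed? ((a , β) ∷ L)) * z)
      (trans (length-cartesianProduct (true ∷ false ∷ []) cells) (cong (2 *_) length-cells)))
    (#-injection (prescribed? L) (prescribed? ((a , β) ∷ L)) {ys = tt ∷ []} ([] ∷ [])
      (cartesianProduct (true ∷ false ∷ []) cells) (λ ω _ → fix ω) (λ ω _ → flipped ω , y ω)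
      (λ ω _ p _ → prescribed ω p , ∈-cartesianProduct⁺ (∈-bools (flipped ω)) (∈-cells (y ω)))
      (λ ω _ ω′ _ _ _ _ _ e eh → recover ω ω′ e (cong proj₁ eh) (cong proj₂ eh) , refl))
    where
    open ≡-Reasoning
    ∈-bools : ∀ b → b ∈ true ∷ false ∷ []
    ∈-bools true  = here refl
    ∈-bools false = there (here refl)
    target = value-surjective β ¬Jβ
    x = proj₁ (proj₁ target)
    b = proj₂ (proj₁ target)
    y : Ω → A
    y ω = location ω x
    flipped : Ω → Bool
    flipped ω = not (does (sign ω x Bool.≟ b))
    flipIf : Bool → Ω → Ω
    flipIf true  ω = flipSign x ω
    flipIf false ω = ω
    fix : Ω → Ω
    fix ω = swap a (y ω) (flipIf (flipped ω) ω)
    flipIf-involutive : ∀ c ω → flipIf c (flipIf c ω) ≡ ω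
    flipIf-involutive true  ω = flipSign-involutive x ω
    flipIf-involutive false ω = refl
    signed-y : ∀ ω → signed (flipIf (flipped ω) ω) (y ω) ≡ (x , b)
    signed-y ω = cases (sign ω x Bool.≟ b)
      where
      cases : (d : Dec (sign ω x ≡ b)) → signed (flipIf (not (does d)) ω) (y ω) ≡ (x , b)
      cases (yes e) = trans (cong (λ z → z , sign ω z) (magnitude-location ω x)) (cong (x ,_) e)
      cases (no ¬e) = begin
        signed (flipSign x ω) (y ω)  ≡⟨ signed-flipSign x ω (y ω) ⟩
        (magnitude ω (y ω) , toggle x (magnitude ω (y ω)) (sign ω (magnitude ω (y ω))))
                                                                           ≡⟨ cong (λ z → z , toggle x z (sign ω z)) (magnitude-location ω x) ⟩
        (x , toggle x x (sign ω x))  ≡⟨ cong (x ,_) (trans (toggle-same x (sign ω x)) (sym (Bool.¬-not (¬e ∘ sym)))) ⟩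
        (x , b)  ∎
    val-other : ∀ ω c a′ → magnitude ω a′ ≢ x → val (flipIf c ω) a′ ≡ val ω a′
    val-other ω true  a′ ≢x = cong (uncurry value) (trans (signed-flipSign x ω a′)
      (cong (magnitude ω a′ ,_) (toggle-other (sign ω (magnitude ω a′)) ≢x)))
    val-other ω false a′ ≢x = refl
    magnitude≢ : ∀ ω a′ γ → γ ≢ β → γ ≢ neg β → val ω a′ ≡ γ → magnitude ω a′ ≢ x
    magnitude≢ ω a′ γ γ≢β γ≢-β e ≡x = cases (sign ω (magnitude ω a′) Bool.≟ b)
      where
      cases : Dec (sign ω (magnitude ω a′) ≡ b) → ⊥
      cases (yes p) = γ≢β (trans (sym e) (trans (cong₂ value ≡x p) (proj₂ target)))
      cases (no ¬p) = γ≢-β (begin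
        γ  ≡⟨ e ⟨
        value (magnitude ω a′) (sign ω (magnitude ω a′)) ≡⟨ cong₂ value ≡x (Bool.¬-not ¬p) ⟩
        value x (not b)  ≡⟨ value-not x b ⟩
        neg (value x b)  ≡⟨ cong neg (proj₂ target) ⟩
        neg β  ∎)
    prescribed : ∀ ω → Prescribed L ω → Prescribed ((a , β) ∷ L) (fix ω)
    prescribed ω p = trans (val-swap a (y ω) (flipIf (flipped ω) ω) a) (trans
        (cong (val (flipIf (flipped ω) ω)) (exchange-left a (y ω)))
        (trans (cong (uncurry value) (signed-y ω)) (proj₂ target)))
      ∷ rest a∉ distinct p
      where
      rest : ∀ {L} → a ∉ map proj₁ L → All (λ p → proj₂ p ≢ β × proj₂ p ≢ neg β) L → Prescribed L ω → Prescribed L (fix ω)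
      rest a∉ [] [] = []
      rest {(a′ , γ) ∷ L} a∉ ((γ≢β , γ≢-β) ∷ ds) (e ∷ es) = (begin
          val (fix ω) a′  ≡⟨ val-swap a (y ω) (flipIf (flipped ω) ω) a′ ⟩
          val (flipIf (flipped ω) ω) (exchange a (y ω) a′)  ≡⟨ cong (val (flipIf (flipped ω) ω)) (exchange-other (λ { refl → a∉ (here refl) })
                                                                  (λ p → ≢x (trans (cong (magnitude ω) p) (magnitude-location ω x)))) ⟩
          val (flipIf (flipped ω) ω) a′  ≡⟨ val-other ω (flipped ω) a′ ≢x ⟩
          val ω a′  ≡⟨ e ⟩
          γ  ∎)
        ∷ rest (a∉ ∘ there) ds es
        where
        ≢x : magnitude ω a′ ≢ x
        ≢x = magnitude≢ ω a′ γ γ≢β γ≢-β e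
    recover : ∀ ω ω′ → fix ω ≡ fix ω′ → flipped ω ≡ flipped ω′ → y ω ≡ y ω′ → ω ≡ ω′
    recover ω ω′ e ec ey = begin
      ω  ≡⟨ undo ω ⟨
      flipIf (flipped ω) (swap a (y ω) (fix ω))  ≡⟨ cong₂ (λ c z → flipIf c (swap a z (fix ω))) ec ey ⟩
      flipIf (flipped ω′) (swap a (y ω′) (fix ω))  ≡⟨ cong (λ z → flipIf (flipped ω′) (swap a (y ω′) z)) e ⟩
      flipIf (flipped ω′) (swap a (y ω′) (fix ω′)) ≡⟨ undo ω′ ⟩
      ω′  ∎
      where
      undo : ∀ ω → flipIf (flipped ω) (swap a (y ω) (fix ω)) ≡ ω
      undo ω = trans (cong (flipIf (flipped ω)) (swap-involutive a (y ω) (flipIf (flipped ω) ω))) (flipIf-involutive (flipped ω) ω)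

-- The number of placements with the five prescribed entries

module Events (j m t u : ℕ) .{{_ : NonZero t}} .{{_ : NonZero (t * suc u)}}
  (tu≡2N : t * u ≡ rowCount (suc m) * Array.k j + rowCount (suc m) * Array.k j) (9≤u : 9 ≤ u) (t∣v : t ∣ t * suc u)
  where

  open ArrayLines j m
  open Family j m t u tu≡2N 9≤u t∣v public
  open NonMultiples t u N tu≡2N public using (v; small∉J; neg∉J)
  open Cyclic v
  open Configurations N cell-index public
  open Counting configurations configurations-unique ∈-configurations public

  prescription : List (A × Fin v)
  prescription = (a₀ , [ 1 ]) ∷ (a₁ , [ 2 ]) ∷ (a₂ , neg [ 3 ]) ∷ (a₃ , [ 4 ]) ∷ (a₄ , neg [ 5 ]) ∷ []

  Q : Ω → Set
  Q = Prescribed prescription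

  Q? : Decidable Q
  Q? = prescribed? prescription

  private
    ≤9⇒<v : ∀ {x} → x ≤ 9 → x < v
    ≤9⇒<v x≤9 = ℕ.≤-<-trans x≤9 9<v

    [c]≢ : ∀ {c d} → c ≤ 9 → d ≤ 9 → c ≢ d → [ c ] ≢ [ d ]
    [c]≢ {c} {d} c≤ d≤ c≢d e = c≢d ([]-injective {c} {d} (≤9⇒<v c≤) (≤9⇒<v d≤) e)

    -[c]≢ : ∀ {c d} → 0 < c + d → c + d ≤ 9 → neg [ c ] ≢ [ d ]
    -[c]≢ {c} {d} 0< ≤9 = neg-[]≢ {c} {d} 0< (≤9⇒<v ≤9)

    ≤9 : ∀ {x} {p : Dec.True (x ℕ.≤? 9)} → x ≤ 9
    ≤9 {p = p} = Dec.toWitness p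

    pos-pos : ∀ {c d} → c ≢ d → c ≤ 9 → d ≤ 9 → 0 < c + d → c + d ≤ 9 → [ d ] ≢ [ c ] × [ d ] ≢ neg [ c ]
    pos-pos {c} {d} c≢d c≤ d≤ 0< s≤ = [c]≢ {d} {c} d≤ c≤ (c≢d ∘ sym) , (λ e → -[c]≢ {c} {d} 0< s≤ (sym e))

    pos-neg : ∀ {c d} → c ≢ d → c ≤ 9 → d ≤ 9 → 0 < d + c → d + c ≤ 9 → neg [ d ] ≢ [ c ] × neg [ d ] ≢ neg [ c ]
    pos-neg {c} {d} c≢d c≤ d≤ 0< s≤ = -[c]≢ {d} {c} 0< s≤ , (λ e → [c]≢ {d} {c} d≤ c≤ (c≢d ∘ sym) (neg-injective {[ d ]} {[ c ]} e))

    neg-pos : ∀ {c d} → c ≢ d → c ≤ 9 → d ≤ 9 → 0 < c + d → c + d ≤ 9 → [ d ] ≢ neg [ c ] × [ d ] ≢ neg (neg [ c ])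
    neg-pos {c} {d} c≢d c≤ d≤ 0< s≤ = (λ e → -[c]≢ {c} {d} 0< s≤ (sym e))
      , (λ e → [c]≢ {d} {c} d≤ c≤ (c≢d ∘ sym) (trans e (neg-involutive [ c ])))

    neg-neg : ∀ {c d} → c ≢ d → c ≤ 9 → d ≤ 9 → 0 < d + c → d + c ≤ 9 → neg [ d ] ≢ neg [ c ] × neg [ d ] ≢ neg (neg [ c ])
    neg-neg {c} {d} c≢d c≤ d≤ 0< s≤ = (λ e → [c]≢ {d} {c} d≤ c≤ (c≢d ∘ sym) (neg-injective {[ d ]} {[ c ]} e))
      , (λ e → -[c]≢ {d} {c} 0< s≤ (trans e (neg-involutive [ c ])))

    small : ∀ {c} → suc c ≤ 9 → ¬ J v t [ suc c ]
    small c≤ = small∉J (ℕ.≤-trans c≤ 9≤u)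

  -- One factor 2 N for each of the five prescriptions. The values c, d among 1, ..., 5 are distinct
  -- up to sign because c + d stays below v; the largest such sum is 4 + 5, whence `9≤u`.
  configurations-bound : 2 ^ N * N ! ≤ # Q? * (2 * N) ^ 5
  configurations-bound = begin
    2 ^ N * N !  ≡⟨ length-configurations ⟨
    length configurations  ≤⟨ injection⇒length≤ configurations-unique id (λ {ω} p → ∈-filter⁺ (prescribed? []) p []) (λ _ _ e → e) ⟩
    # (prescribed? [])  ≤⟨ prescribe-bound [] a₄ (neg [ 5 ]) (λ ()) (neg∉J {[ 5 ]} (small {4} ≤9)) [] ⟩
    # (prescribed? L₁) * M  ≤⟨ ℕ.*-monoˡ-≤ M (prescribe-bound L₁ a₃ [ 4 ] a₃∉ (small {3} ≤9) (pos-neg {4} {5} (λ ()) ≤9 ≤9 (s≤s z≤n) ≤9 ∷ [])) ⟩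
    # (prescribed? L₂) * M * M  ≤⟨ ℕ.*-monoˡ-≤ M (ℕ.*-monoˡ-≤ M (prescribe-bound L₂ a₂ (neg [ 3 ]) a₂∉ (neg∉J {[ 3 ]} (small {2} ≤9))
                                                 (neg-pos {3} {4} (λ ()) ≤9 ≤9 (s≤s z≤n) ≤9 ∷ neg-neg {3} {5} (λ ()) ≤9 ≤9 (s≤s z≤n) ≤9 ∷ []))) ⟩
    # (prescribed? L₃) * M * M * M  ≤⟨ ℕ.*-monoˡ-≤ M (ℕ.*-monoˡ-≤ M (ℕ.*-monoˡ-≤ M (prescribe-bound L₃ a₁ [ 2 ] a₁∉ (small {1} ≤9)
                                                 (pos-neg {2} {3} (λ ()) ≤9 ≤9 (s≤s z≤n) ≤9 ∷ pos-pos {2} {4} (λ ()) ≤9 ≤9 (s≤s z≤n) ≤9 ∷ pos-neg {2} {5} (λ ()) ≤9 ≤9 (s≤s z≤n) ≤9 ∷ [])))) ⟩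
    # (prescribed? L₄) * M * M * M * M  ≤⟨ ℕ.*-monoˡ-≤ M (ℕ.*-monoˡ-≤ M (ℕ.*-monoˡ-≤ M (ℕ.*-monoˡ-≤ M (prescribe-bound L₄ a₀ [ 1 ] a₀∉ (small {0} ≤9)
                                                 (pos-pos {1} {2} (λ ()) ≤9 ≤9 (s≤s z≤n) ≤9 ∷ pos-neg {1} {3} (λ ()) ≤9 ≤9 (s≤s z≤n) ≤9 ∷ pos-pos {1} {4} (λ ()) ≤9 ≤9 (s≤s z≤n) ≤9 ∷ pos-neg {1} {5} (λ ()) ≤9 ≤9 (s≤s z≤n) ≤9 ∷ []))))) ⟩
    # Q? * M * M * M * M * M  ≡⟨ power (# Q?) M ⟩
    # Q? * M ^ 5  ∎
    where
    open ℕ.≤-Reasoning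
    M = 2 * N
    L₁ L₂ L₃ L₄ : List (A × Fin v)
    L₁ = (a₄ , neg [ 5 ]) ∷ []
    L₂ = (a₃ , [ 4 ]) ∷ L₁
    L₃ = (a₂ , neg [ 3 ]) ∷ L₂
    L₄ = (a₁ , [ 2 ]) ∷ L₃
    a₀∉ : a₀ ∉ map proj₁ L₄
    a₁∉ : a₁ ∉ map proj₁ L₃
    a₂∉ : a₂ ∉ map proj₁ L₂
    a₃∉ : a₃ ∉ map proj₁ L₁
    a₀∉ with p ∷ _ ← forcedCells-unique = All.All¬⇒¬Any p
    a₁∉ with _ ∷ p ∷ _ ← forcedCells-unique = All.All¬⇒¬Any p
    a₂∉ with _ ∷ _ ∷ p ∷ _ ← forcedCells-unique = All.All¬⇒¬Any p
    a₃∉ with _ ∷ _ ∷ _ ∷ p ∷ _ ← forcedCells-unique = All.All¬⇒¬Any p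
    power : ∀ q M → q * M * M * M * M * M ≡ q * (M * (M * (M * (M * (M * 1)))))
    power = solve-∀

-- Rarity of zero lines and of further coincidences

module Bounds (j m t u : ℕ) .{{_ : NonZero t}} .{{_ : NonZero (t * suc u)}}
  (tu≡2N : t * u ≡ rowCount (suc m) * Array.k j + rowCount (suc m) * Array.k j) (9≤u : 9 ≤ u) (t∣v : t ∣ t * suc u)
  where

  open ArrayLines j m
  open Events j m t u tu≡2N 9≤u t∣v public
  open Cyclic v

  Q-swap : ∀ x y ω → x ∉ forcedCells → y ∉ forcedCells → Q ω → Q (swap x y ω)
  Q-swap x y ω x∉ y∉ = prescribed-swap {prescription} x y ω x∉ y∉

  lineSum : (A → Fin v) → Bool → A → ℕ → Fin v
  lineSum f b a zero    = [ 0 ]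
  lineSum f b a (suc i) = f a ⊕ lineSum f b (line→ b a) i

  lineSum-cong : ∀ {f g : A → Fin v} b a n → (∀ i → i < n → f (iterate (line→ b) a i) ≡ g (iterate (line→ b) a i)) →
    lineSum f b a n ≡ lineSum g b a n
  lineSum-cong b a zero    e = refl
  lineSum-cong b a (suc n) e = cong₂ _⊕_ (e 0 (s≤s z≤n)) (lineSum-cong b (line→ b a) n (λ i i<n → e (suc i) (s≤s i<n)))

  lineSum-last : ∀ f b a n → lineSum f b a (suc n) ≡ lineSum f b a n ⊕ f (iterate (line→ b) a n)
  lineSum-last f b a zero    = ⊕-comm (f a) [ 0 ]
  lineSum-last f b a (suc n) = trans (cong (f a ⊕_) (lineSum-last f b (line→ b a) n))
    (sym (⊕-assoc (f a) (lineSum f b (line→ b a) n) (f (iterate (line→ b) (line→ b a) n))))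

  lineSum-shift : ∀ f b a → lineSum f b (line→ b a) k ≡ lineSum f b a k
  lineSum-shift f b a = ⊕-cancelˡ (f a) (lineSum f b (line→ b a) k) (lineSum f b a k) (begin
    lineSum f b a (suc k)  ≡⟨ lineSum-last f b a k ⟩
    lineSum f b a k ⊕ f (iterate (line→ b) a k)  ≡⟨ cong (λ z → lineSum f b a k ⊕ f z) (line-period b a) ⟩
    lineSum f b a k ⊕ f a  ≡⟨ ⊕-comm (lineSum f b a k) (f a) ⟩
    f a ⊕ lineSum f b a k  ∎)
    where open ≡-Reasoning

  lineSum-iterate : ∀ f b a i → lineSum f b (iterate (line→ b) a i) k ≡ lineSum f b a k
  lineSum-iterate f b a zero    = refl
  lineSum-iterate f b a (suc i) = trans (lineSum-iterate f b (line→ b a) i) (lineSum-shift f b a)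

  -- A line sum is the same from every starting cell, so each line is entered at a cell that may be
  -- swapped, whenever it has one.
  representative : Bool → Row (suc m) → A
  representative b q = place b (q , proj₁ (line-representative b q))

  ZeroLine : Bool → Row (suc m) → Ω → Set
  ZeroLine b q ω = lineSum (val ω) b (representative b q) k ≡ [ 0 ]

  zeroLine? : ∀ b q → Decidable (ZeroLine b q)
  zeroLine? b q ω = lineSum (val ω) b (representative b q) k Fin.≟ [ 0 ]

  #-empty : ∀ {P : Ω → Set} (P? : Decidable P) → (∀ ω → ¬ P ω) → ∀ x y → # P? * x ≤ y
  #-empty P? ¬P x y = subst (λ n → n * x ≤ y) (sym (ℕ.n≤0⇒n≡0 (injection⇒length≤ {ys = []} (Unique.filter⁺ P? configurations-unique) id
    (λ p → contradiction (proj₂ (∈-filter⁻ P? {xs = configurations} p)) (¬P _)) (λ _ _ e → e)))) z≤n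

  private
    val-a₀ : ∀ {ω} → Q ω → val ω a₀ ≡ [ 1 ]
    val-a₀ (e ∷ _) = e

    val-a₁ : ∀ {ω} → Q ω → val ω a₁ ≡ [ 2 ]
    val-a₁ (_ ∷ e ∷ _) = e

    val-a₂ : ∀ {ω} → Q ω → val ω a₂ ≡ neg [ 3 ]
    val-a₂ (_ ∷ _ ∷ e ∷ _) = e

    val-a₃ : ∀ {ω} → Q ω → val ω a₃ ≡ [ 4 ]
    val-a₃ (_ ∷ _ ∷ _ ∷ e ∷ _) = e

    val-a₄ : ∀ {ω} → Q ω → val ω a₄ ≡ neg [ 5 ]
    val-a₄ (_ ∷ _ ∷ _ ∷ _ ∷ e ∷ []) = e

  Q⇒Forced : ∀ {ω} → Q ω → Forced (val ω)
  Q⇒Forced {ω} q = forced (val-a₀ q)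
    (trans (cong (val ω) col→a₀) (val-a₁ q)) (trans (cong (val ω) row→a₀) (val-a₂ q))
    (trans (cong (val ω) col←a₀) (val-a₃ q)) (trans (cong (val ω) row←a₀) (val-a₄ q))

  -- The two forced lines of length 3 have sums 1 + 2 + 4 and 1 - 3 - 5.
  forced-line : j ≡ 0 → ∀ b ω → Q ω → lineSum (val ω) b a₀ k ≢ [ 0 ]
  forced-line j≡0 b ω q e = cases b (trans (sym (sum₃ b)) e)
    where
    open ≡-Reasoning
    open Forced (Q⇒Forced q)
    sum₃ : ∀ b → lineSum (val ω) b a₀ k ≡ val ω a₀ ⊕ (val ω (line→ b a₀) ⊕ val ω (line← b a₀))
    sum₃ b = begin
      lineSum (val ω) b a₀ (3 + (j + j))  ≡⟨ cong (λ j → lineSum (val ω) b a₀ (3 + (j + j))) j≡0 ⟩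
      lineSum (val ω) b a₀ 3  ≡⟨ cong (λ z → val ω a₀ ⊕ (val ω (line→ b a₀) ⊕ z)) (⊕-identityʳ (val ω (line→ b (line→ b a₀)))) ⟩
      val ω a₀ ⊕ (val ω (line→ b a₀) ⊕ val ω (line→ b (line→ b a₀))) ≡⟨ cong (λ z → val ω a₀ ⊕ (val ω (line→ b a₀) ⊕ val ω z)) (line→² j≡0 b a₀) ⟩
      val ω a₀ ⊕ (val ω (line→ b a₀) ⊕ val ω (line← b a₀))  ∎
    cases : ∀ b → val ω a₀ ⊕ (val ω (line→ b a₀) ⊕ val ω (line← b a₀)) ≢ [ 0 ]
    cases true e = contradiction ([]-injective {7} {0} 7<v (ℕ.<-trans (s≤s z≤n) 7<v) (begin
      [ 7 ]  ≡⟨ []-⊕ 1 6 ⟨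
      [ 1 ] ⊕ [ 6 ]  ≡⟨ cong ([ 1 ] ⊕_) ([]-⊕ 2 4) ⟨
      [ 1 ] ⊕ ([ 2 ] ⊕ [ 4 ])  ≡⟨ cong₂ _⊕_ at-a₀ (cong₂ _⊕_ at-col→ at-col←) ⟨
      val ω a₀ ⊕ (val ω (line→ true a₀) ⊕ val ω (line← true a₀)) ≡⟨ e ⟩
      [ 0 ]  ∎)) λ ()
    cases false e = contradiction ([]-injective {1} {8} (ℕ.<-trans (s≤s (s≤s z≤n)) 7<v) (ℕ.<-trans ℕ.≤-refl 9<v) (begin
      [ 1 ]  ≡⟨ ⊕-⊕neg′ [ 8 ] [ 1 ] ⟨
      ([ 1 ] ⊕ [ 8 ]) ⊕ neg [ 8 ]  ≡⟨ ⊕-assoc [ 1 ] [ 8 ] (neg [ 8 ]) ⟩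
      [ 1 ] ⊕ ([ 8 ] ⊕ neg [ 8 ])  ≡⟨ cong ([ 1 ] ⊕_) (⊕-comm [ 8 ] (neg [ 8 ])) ⟩
      [ 1 ] ⊕ (neg [ 8 ] ⊕ [ 8 ])  ≡⟨ ⊕-assoc [ 1 ] (neg [ 8 ]) [ 8 ] ⟨
      ([ 1 ] ⊕ neg [ 8 ]) ⊕ [ 8 ]  ≡⟨ cong (_⊕ [ 8 ]) 1-8 ⟩
      [ 0 ] ⊕ [ 8 ]  ≡⟨ ⊕-identityˡ [ 8 ] ⟩
      [ 8 ]  ∎)) λ ()
      where
      1-8 : [ 1 ] ⊕ neg [ 8 ] ≡ [ 0 ]
      1-8 = begin
        [ 1 ] ⊕ neg [ 8 ]  ≡⟨ cong (λ z → [ 1 ] ⊕ neg z) ([]-⊕ 3 5) ⟨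
        [ 1 ] ⊕ neg ([ 3 ] ⊕ [ 5 ])  ≡⟨ cong ([ 1 ] ⊕_) (neg-⊕ [ 3 ] [ 5 ]) ⟨
        [ 1 ] ⊕ (neg [ 3 ] ⊕ neg [ 5 ])  ≡⟨ cong₂ _⊕_ at-a₀ (cong₂ _⊕_ at-row→ at-row←) ⟨
        val ω a₀ ⊕ (val ω (line→ false a₀) ⊕ val ω (line← false a₀)) ≡⟨ e ⟩
        [ 0 ]  ∎

  -- A zero sum determines the entry at `x` from the others on its line, so a swap of `x` with a
  -- cell outside can be undone. The k + 5 excluded cells are the k on the line and the five
  -- prescribed ones. On a fully prescribed line the event is void.
  zeroLine-bound : ∀ b q → # (λ ω → zeroLine? b q ω ×-dec Q? ω) * (N ∸ (k + 5)) ≤ # Q?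
  zeroLine-bound b q = cases (proj₂ (line-representative b q))
    where
    x = representative b q
    cases : x ∉ forcedCells ⊎ (j ≡ 0 × x ≡ a₀) → # (λ ω → zeroLine? b q ω ×-dec Q? ω) * (N ∸ (k + 5)) ≤ # Q?
    cases (inj₂ (j≡0 , x≡a₀)) = #-empty (λ ω → zeroLine? b q ω ×-dec Q? ω)
      (λ ω (z , p) → forced-line j≡0 b ω p (subst (λ x → lineSum (val ω) b x k ≡ [ 0 ]) x≡a₀ z)) (N ∸ (k + 5)) (# Q?)
    cases (inj₁ x∉) = subst₂ _≤_ (cong (λ z → # (λ ω → zeroLine? b q ω ×-dec Q? ω) * (N ∸ z)) length-avoid) (ℕ.*-identityʳ (# Q?))
      (swap-bound (zeroLine? b q) Q? (tt ∷ []) (λ _ → tt) x avoid (λ _ → here refl)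
        (∈-++⁺ˡ (∈-onLine 0 (s≤s z≤n)))
        (λ ω y y∉ → Q-swap x y ω x∉ (λ p → y∉ (∈-++⁺ʳ onLine p)))
        (λ ω ω′ p p′ agree _ → determined ω ω′ p p′ agree))
      where
      onLine avoid : List A
      onLine = applyUpTo (iterate (line→ b) x) k
      avoid = onLine ++ forcedCells
      ∈-onLine : ∀ i → i < k → iterate (line→ b) x i ∈ onLine
      ∈-onLine i i<k = ∈-applyUpTo⁺ (iterate (line→ b) x) {i} {k} i<k
      length-avoid : length avoid ≡ k + 5
      length-avoid = trans (List.length-++ onLine) (cong (_+ 5) (List.length-applyUpTo (iterate (line→ b) x) k))
      determined : ∀ ω ω′ → ZeroLine b q ω → ZeroLine b q ω′ → (∀ z → z ∈ avoid → z ≢ x → val ω z ≡ val ω′ z) → val ω x ≡ val ω′ x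
      determined ω ω′ p p′ agree = ⊕-cancelʳ (rest ω′) (val ω x) (val ω′ x)
        (trans (cong (val ω x ⊕_) (sym same-rest)) (trans p (sym p′)))
        where
        rest : Ω → Fin v
        rest ω = lineSum (val ω) b (line→ b x) (suc (suc (j + j)))
        same-rest : rest ω ≡ rest ω′
        same-rest = lineSum-cong b (line→ b x) (suc (suc (j + j))) λ i i< →
          agree (iterate (line→ b) x (suc i)) (∈-++⁺ˡ (∈-onLine (suc i) (s≤s i<)))
            (λ e → ℕ.<⇒≱ (s≤s i<) (∣⇒≤ (line-period⁻¹ b x (suc i) e)))

  Triangle : A → A → A → (A → Fin v) → Set
  Triangle c p q f = (f c ⊕ f p) ⊕ f q ≡ [ 0 ]

  triangle? : ∀ c p q ω → Dec (Triangle c p q (val ω))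
  triangle? c p q ω = ((val ω c ⊕ val ω p) ⊕ val ω q) Fin.≟ [ 0 ]

  half : Fin v → Bool
  half α = does (toℕ α + toℕ α ℕ.<? v)

  -- p and q may coincide, hence the bit half.
  triangle-determines : ∀ (f g : A → Fin v) c p q x → c ≢ p → c ≢ q → x ∈ c ∷ p ∷ q ∷ [] →
    Triangle c p q f → Triangle c p q g → (∀ z → z ∈ c ∷ p ∷ q ∷ [] → z ≢ x → f z ≡ g z) → half (f x) ≡ half (g x) → f x ≡ g x
  triangle-determines f g c p q x c≢p c≢q (here refl) Tf Tg agree h =
    ⊕-cancelʳ (g p) (f c) (g c) (⊕-cancelʳ (g q) (f c ⊕ g p) (g c ⊕ g p) (begin
      (f c ⊕ g p) ⊕ g q  ≡⟨ cong₂ (λ α β → (f c ⊕ α) ⊕ β) (agree p (there (here refl)) (c≢p ∘ sym)) (agree q (there (there (here refl))) (c≢q ∘ sym)) ⟨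
      (f c ⊕ f p) ⊕ f q  ≡⟨ Tf ⟩
      [ 0 ]  ≡⟨ Tg ⟨
      (g c ⊕ g p) ⊕ g q  ∎))
    where open ≡-Reasoning
  triangle-determines f g c p q x c≢p c≢q (there (here refl)) Tf Tg agree h = cases (q ≟ᵃ p)
    where
    open ≡-Reasoning
    fc≡gc : f c ≡ g c
    fc≡gc = agree c (here refl) c≢p
    cases : Dec (q ≡ p) → f p ≡ g p
    cases (yes refl) = double-injective (f p) (g p) (⊕-cancelˡ (g c) (f p ⊕ f p) (g p ⊕ g p) (begin
      g c ⊕ (f p ⊕ f p)  ≡⟨ cong (_⊕ (f p ⊕ f p)) fc≡gc ⟨
      f c ⊕ (f p ⊕ f p)  ≡⟨ ⊕-assoc (f c) (f p) (f p) ⟨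
      (f c ⊕ f p) ⊕ f p  ≡⟨ trans Tf (sym Tg) ⟩
      (g c ⊕ g p) ⊕ g p  ≡⟨ ⊕-assoc (g c) (g p) (g p) ⟩
      g c ⊕ (g p ⊕ g p)  ∎)) h
    cases (no q≢p) = ⊕-cancelˡ (g c) (f p) (g p) (⊕-cancelʳ (g q) (g c ⊕ f p) (g c ⊕ g p) (begin
      (g c ⊕ f p) ⊕ g q  ≡⟨ cong₂ (λ α β → (α ⊕ f p) ⊕ β) fc≡gc (agree q (there (there (here refl))) q≢p) ⟨
      (f c ⊕ f p) ⊕ f q  ≡⟨ trans Tf (sym Tg) ⟩
      (g c ⊕ g p) ⊕ g q  ∎))
  triangle-determines f g c p q x c≢p c≢q (there (there (here refl))) Tf Tg agree h = cases (p ≟ᵃ q)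
    where
    open ≡-Reasoning
    fc≡gc : f c ≡ g c
    fc≡gc = agree c (here refl) c≢q
    cases : Dec (p ≡ q) → f q ≡ g q
    cases (yes refl) = double-injective (f q) (g q) (⊕-cancelˡ (g c) (f q ⊕ f q) (g q ⊕ g q) (begin
      g c ⊕ (f q ⊕ f q)  ≡⟨ cong (_⊕ (f q ⊕ f q)) fc≡gc ⟨
      f c ⊕ (f q ⊕ f q)  ≡⟨ ⊕-assoc (f c) (f q) (f q) ⟨
      (f c ⊕ f q) ⊕ f q  ≡⟨ trans Tf (sym Tg) ⟩
      (g c ⊕ g q) ⊕ g q  ≡⟨ ⊕-assoc (g c) (g q) (g q) ⟩
      g c ⊕ (g q ⊕ g q)  ∎)) h
    cases (no p≢q) = ⊕-cancelˡ (g c ⊕ g p) (f q) (g q) (begin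
      (g c ⊕ g p) ⊕ f q  ≡⟨ cong₂ (λ α β → (α ⊕ β) ⊕ f q) fc≡gc (agree p (there (here refl)) p≢q) ⟨
      (f c ⊕ f p) ⊕ f q  ≡⟨ trans Tf (sym Tg) ⟩
      (g c ⊕ g p) ⊕ g q  ∎)

  triangle-bound : ∀ {R : Ω → Set} (R? : Decidable R) c p q x avoid → c ≢ p → c ≢ q → x ∈ c ∷ p ∷ q ∷ [] →
    (∀ {z} → z ∈ c ∷ p ∷ q ∷ [] → z ∈ avoid) → (∀ ω y → y ∉ avoid → R ω → R (swap x y ω)) →
    # (λ ω → triangle? c p q ω ×-dec R? ω) * (N ∸ length avoid) ≤ # R? * 2
  triangle-bound R? c p q x avoid c≢p c≢q x∈ ⊆avoid R-swap = swap-bound (triangle? c p q) R? (true ∷ false ∷ [])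
    (λ ω → half (val ω x)) x avoid (λ ω → ∈-bools (half (val ω x))) (⊆avoid x∈) R-swap
    (λ ω ω′ T T′ agree h → triangle-determines (val ω) (val ω′) c p q x c≢p c≢q x∈ T T′ (λ z z∈ → agree z (⊆avoid z∈)) h)
    where
    ∈-bools : ∀ b → b ∈ true ∷ false ∷ []
    ∈-bools true  = here refl
    ∈-bools false = there (here refl)

  T→ T← : A → Ω → Set
  T→ a ω = TriangleAt (val ω) a
  T← a ω = TriangleAt⁻¹ (val ω) a

  T→? : ∀ a → Decidable (T→ a)
  T→? a = triangle? a (line→ true a) (line→ false a)

  T←? : ∀ a → Decidable (T← a)
  T←? a = triangle? a (line← true a) (line← false a)

  Spurious : A → Ω → Set
  Spurious a ω = a ≢ a₀ × T→ a ω × T← a ω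

  spurious? : ∀ a → Decidable (Spurious a)
  spurious? a ω = ¬? (a ≟ᵃ a₀) ×-dec (T→? a ω ×-dec T←? a ω)

  private
    avoided : A → List A
    avoided a = neighbours a ++ forcedCells

    →⊆ : ∀ {a z} → z ∈ a ∷ line→ true a ∷ line→ false a ∷ [] → z ∈ neighbours a
    →⊆ (here e)                 = here e
    →⊆ (there (here e))         = there (here e)
    →⊆ (there (there (here e))) = there (there (here e))

    ←⊆ : ∀ {a z} → z ∈ a ∷ line← true a ∷ line← false a ∷ [] → z ∈ neighbours a
    ←⊆ (here e)                 = here e
    ←⊆ (there (here e))         = there (there (there (here e)))
    ←⊆ (there (there (here e))) = there (there (there (there (here e))))

    T→-bound : ∀ {R : Ω → Set} (R? : Decidable R) a x → x ∈ a ∷ line→ true a ∷ line→ false a ∷ [] →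
      (∀ ω y → y ∉ avoided a → R ω → R (swap x y ω)) → # (λ ω → T→? a ω ×-dec R? ω) * (N ∸ 10) ≤ # R? * 2
    T→-bound R? a x x∈ = triangle-bound R? a (line→ true a) (line→ false a) x (avoided a)
      (line→≢ true a ∘ sym) (line→≢ false a ∘ sym) x∈ (λ p → ∈-++⁺ˡ (→⊆ p))

    T←-bound : ∀ {R : Ω → Set} (R? : Decidable R) a x → x ∈ a ∷ line← true a ∷ line← false a ∷ [] →
      (∀ ω y → y ∉ avoided a → R ω → R (swap x y ω)) → # (λ ω → T←? a ω ×-dec R? ω) * (N ∸ 10) ≤ # R? * 2
    T←-bound R? a x x∈ = triangle-bound R? a (line← true a) (line← false a) x (avoided a)
      (line←≢ true a ∘ sym) (line←≢ false a ∘ sym) x∈ (λ p → ∈-++⁺ˡ (←⊆ p))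

    Q-swap-avoided : ∀ a x → x ∉ forcedCells → ∀ ω y → y ∉ avoided a → Q ω → Q (swap x y ω)
    Q-swap-avoided a x x∉ ω y y∉ = Q-swap x y ω x∉ (λ p → y∉ (∈-++⁺ʳ (neighbours a) p))

  -- The free neighbour lies in one of the two triangles, and that one is broken. The factor 2 pays
  -- for the bit `half`; the 10 excluded cells are the five of `neighbours a` and the five
  -- prescribed ones.
  spurious-bound : ∀ a → # (λ ω → spurious? a ω ×-dec Q? ω) * (N ∸ 10) ≤ # Q? * 2
  spurious-bound a = cases (a ≟ᵃ a₀)
    where
    S? = λ ω → spurious? a ω ×-dec Q? ω
    via→ : ∀ x → x ∉ forcedCells → x ∈ a ∷ line→ true a ∷ line→ false a ∷ [] → # S? * (N ∸ 10) ≤ # Q? * 2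
    via→ x x∉ x∈ = ℕ.≤-trans (ℕ.*-monoˡ-≤ (N ∸ 10) (#-mono S? (λ ω → T→? a ω ×-dec Q? ω) (λ { ((_ , p , _) , q) → p , q })))
      (T→-bound Q? a x x∈ (Q-swap-avoided a x x∉))
    via← : ∀ x → x ∉ forcedCells → x ∈ a ∷ line← true a ∷ line← false a ∷ [] → # S? * (N ∸ 10) ≤ # Q? * 2
    via← x x∉ x∈ = ℕ.≤-trans (ℕ.*-monoˡ-≤ (N ∸ 10) (#-mono S? (λ ω → T←? a ω ×-dec Q? ω) (λ { ((_ , _ , p) , q) → p , q })))
      (T←-bound Q? a x x∈ (Q-swap-avoided a x x∉))
    split : Σ[ x ∈ A ] x ∈ neighbours a × x ∉ forcedCells → # S? * (N ∸ 10) ≤ # Q? * 2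
    split (x , here e , x∉)                                 = via→ x x∉ (here e)
    split (x , there (here e) , x∉)                         = via→ x x∉ (there (here e))
    split (x , there (there (here e)) , x∉)                 = via→ x x∉ (there (there (here e)))
    split (x , there (there (there (here e))) , x∉)         = via← x x∉ (there (here e))
    split (x , there (there (there (there (here e)))) , x∉) = via← x x∉ (there (there (here e)))
    cases : Dec (a ≡ a₀) → # S? * (N ∸ 10) ≤ # Q? * 2
    cases (yes a≡a₀) = #-empty S? (λ { ω ((a≢a₀ , _) , _) → a≢a₀ a≡a₀ }) (N ∸ 10) (# Q? * 2)
    cases (no a≢a₀)  = split (free-neighbour a a≢a₀)

  neighbours-symmetric : ∀ {a z} → z ∈ neighbours a → a ∈ neighbours z
  neighbours-symmetric (here refl)                                 = here refl
  neighbours-symmetric {a} (there (here refl))                         = there (there (there (here (sym (line←-line→ true a)))))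
  neighbours-symmetric {a} (there (there (here refl)))                 = there (there (there (there (here (sym (line←-line→ false a))))))
  neighbours-symmetric {a} (there (there (there (here refl))))         = there (here (sym (line→-line← true a)))
  neighbours-symmetric {a} (there (there (there (there (here refl))))) = there (there (here (sym (line→-line← false a))))

  -- Next to the prescribed cells only one of the two triangles is sure to have a free cell, and
  -- `spurious-bound` has to do. It costs about 2 / N per cell: little for the 25 entries of
  -- `nearCells`, but about 2 in total over all N cells, so the others need a quadratic bound.
  nearCells farCells : List A
  nearCells = concatMap neighbours forcedCells
  farCells = filter (λ a → ¬? (Any.any? (a ≟ᵃ_) nearCells)) cells

  far⇒free : ∀ {a z} → a ∉ nearCells → z ∈ neighbours a → z ∉ forcedCells
  far⇒free a∉ z∈ z∈forced = a∉ (∈-concatMap⁺ neighbours (Any.map (λ { refl → neighbours-symmetric z∈ }) z∈forced))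

  -- Away from the forced cells the two triangles at a can be broken
  -- independently, at col→ a and at a.
  spurious-bound² : ∀ a → a ∉ nearCells → # (λ ω → spurious? a ω ×-dec Q? ω) * (N ∸ 10) * (N ∸ 10) ≤ # Q? * 2 * 2
  spurious-bound² a a∉ = begin
    # (λ ω → spurious? a ω ×-dec Q? ω) * E * E  ≤⟨ ℕ.*-monoˡ-≤ E (ℕ.*-monoˡ-≤ E (#-mono (λ ω → spurious? a ω ×-dec Q? ω) (λ ω → T→? a ω ×-dec R? ω)
                                                     (λ { ((_ , p , p′) , q) → p , p′ , q }))) ⟩
    # (λ ω → T→? a ω ×-dec R? ω) * E * E  ≤⟨ ℕ.*-monoˡ-≤ E (T→-bound R? a x (there (here refl)) R-swap) ⟩
    # R? * 2 * E  ≡⟨ shuffle (# R?) E ⟩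
    # R? * E * 2  ≤⟨ ℕ.*-monoˡ-≤ 2 (T←-bound Q? a a (here refl) (Q-swap-avoided a a (far⇒free a∉ (here refl)))) ⟩
    # Q? * 2 * 2  ∎
    where
    open ℕ.≤-Reasoning
    shuffle : ∀ r e → r * 2 * e ≡ r * e * 2
    shuffle = solve-∀
    E = N ∸ 10
    x = line→ true a
    R : Ω → Set
    R ω = T← a ω × Q ω
    R? : Decidable R
    R? ω = T←? a ω ×-dec Q? ω
    fixed : ∀ ω y z → z ≢ x → z ≢ y → val (swap x y ω) z ≡ val ω z
    fixed ω y z z≢x z≢y = trans (val-swap x y ω z) (cong (val ω) (exchange-other z≢x z≢y))
    ≢y : ∀ {y z} → y ∉ avoided a → z ∈ neighbours a → z ≢ y
    ≢y y∉ z∈ refl = y∉ (∈-++⁺ˡ z∈)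
    R-swap : ∀ ω y → y ∉ avoided a → R ω → R (swap x y ω)
    R-swap ω y y∉ (p , q) = trans (cong₂ _⊕_ (cong₂ _⊕_
        (fixed ω y a (line→≢ true a ∘ sym) (≢y y∉ (here refl)))
        (fixed ω y (line← true a) (line→≢line← true a ∘ sym) (≢y y∉ (there (there (there (here refl)))))))
        (fixed ω y (line← false a) (col→≢row← a ∘ sym) (≢y y∉ (there (there (there (there (here refl)))))))) p
      , Q-swap-avoided a x (far⇒free a∉ (there (here refl))) ω y y∉ q

-- Numerical estimates

^-distribʳ-* : ∀ o m n → (m * n) ^ o ≡ m ^ o * n ^ o
^-distribʳ-* zero    m n = refl
^-distribʳ-* (suc o) m n = trans (cong (λ z → m * n * z) (^-distribʳ-* o m n)) (interchange m n (m ^ o) (n ^ o))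
  where
  interchange : ∀ a b c d → a * b * (c * d) ≡ a * c * (b * d)
  interchange = solve-∀

private
  -- (65/64)⁵ < 2.
  suc^5≤2*^5 : ∀ n → 64 ≤ n → suc n ^ 5 ≤ 2 * n ^ 5
  suc^5≤2*^5 n 64≤n = scale (64 ^ 5) (65 ^ 5) (suc n ^ 5) (n ^ 5)
    (subst₂ _≤_ (^-distribʳ-* 5 64 (suc n)) (^-distribʳ-* 5 65 n) (ℕ.^-monoˡ-≤ 5 64[n+1]≤65n))
    (ℕ.≤ᵇ⇒≤ (65 ^ 5) (64 ^ 5 * 2) tt)
    where
    64[n+1]≤65n : 64 * suc n ≤ 65 * n
    64[n+1]≤65n = subst (_≤ 65 * n) (sym (ℕ.*-suc 64 n)) (ℕ.+-monoˡ-≤ (64 * n) 64≤n)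
    scale : ∀ a b x y .{{_ : NonZero a}} → a * x ≤ b * y → b ≤ a * 2 → x ≤ 2 * y
    scale a b x y ax≤by b≤2a = ℕ.*-cancelˡ-≤ a (ℕ.≤-trans ax≤by
      (subst (b * y ≤_) (ℕ.*-assoc a 2 y) (ℕ.*-monoˡ-≤ y b≤2a)))

-- The price of the five prescriptions is (2 n)^5, that of the discarded placements 8, and the
-- choice of signs pays for both. At n = 64 the claim is 2^38 ≤ 2^64, and from there each step at
-- most doubles the left side.
8*[2n]^5≤2^n : ∀ n → 64 ≤ n → 8 * (2 * n) ^ 5 ≤ 2 ^ n
8*[2n]^5≤2^n n 64≤n = subst (λ n → 8 * (2 * n) ^ 5 ≤ 2 ^ n) (ℕ.m∸n+n≡m 64≤n) (from (n ∸ 64))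
  where
  from : ∀ d → 8 * (2 * (d + 64)) ^ 5 ≤ 2 ^ (d + 64)
  from zero    = ℕ.≤ᵇ⇒≤ (8 * (2 * 64) ^ 5) (2 ^ 64) tt
  from (suc d) = begin
    8 * (2 * suc x) ^ 5  ≡⟨ cong (8 *_) (^-distribʳ-* 5 2 (suc x)) ⟩
    8 * (2 ^ 5 * suc x ^ 5)  ≤⟨ ℕ.*-monoʳ-≤ 8 (ℕ.*-monoʳ-≤ (2 ^ 5) (suc^5≤2*^5 x (ℕ.m≤n+m 64 d))) ⟩
    8 * (2 ^ 5 * (2 * x ^ 5))  ≡⟨ shuffle 8 (2 ^ 5) (x ^ 5) ⟩
    2 * (8 * (2 ^ 5 * x ^ 5))  ≡⟨ cong (λ z → 2 * (8 * z)) (^-distribʳ-* 5 2 x) ⟨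
    2 * (8 * (2 * x) ^ 5)  ≤⟨ ℕ.*-monoʳ-≤ 2 (from d) ⟩
    2 * 2 ^ x  ∎
    where
    open ℕ.≤-Reasoning
    x = d + 64
    shuffle : ∀ a b y → a * (b * (2 * y)) ≡ 2 * (a * (b * y))
    shuffle = solve-∀

private
  -- Lines cost at most 3/4 of q, near and far cells 1/16 each.
  remaining≥⅛ : ∀ q g L M F n N D E → q ≤ g + (L + (M + F)) → 0 < n → 8 * n ≤ 3 * D → 800 ≤ E → N ≤ 2 * E →
    L * D ≤ 2 * n * q → M * E ≤ 25 * (q * 2) → F * (E * E) ≤ N * (q * 2 * 2) → q ≤ 8 * g
  remaining≥⅛ q g L M F n N D E q≤ 0<n 8n≤3D 800≤E N≤2E LD≤ ME≤ FE²≤ = ℕ.*-cancelˡ-≤ 2 (ℕ.+-cancelʳ-≤ (14 * q) (2 * q) (2 * (8 * g)) (begin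
    2 * q + 14 * q  ≡⟨ e₁ q ⟩
    16 * q  ≤⟨ ℕ.*-monoʳ-≤ 16 q≤ ⟩
    16 * (g + (L + (M + F)))  ≡⟨ e₂ g L M F ⟩
    2 * (8 * g) + (2 * (8 * L) + (16 * M + 16 * F))  ≤⟨ ℕ.+-monoʳ-≤ (2 * (8 * g)) (ℕ.+-mono-≤ (ℕ.*-monoʳ-≤ 2 8L≤6q) (ℕ.+-mono-≤ 16M≤q 16F≤q)) ⟩
    2 * (8 * g) + (2 * (6 * q) + (q + q))  ≡⟨ e₃ g q ⟩
    2 * (8 * g) + 14 * q  ∎))
    where
    open ℕ.≤-Reasoning
    e₁ : ∀ q → 2 * q + 14 * q ≡ 16 * q
    e₁ = solve-∀
    e₂ : ∀ g L M F → 16 * (g + (L + (M + F))) ≡ 2 * (8 * g) + (2 * (8 * L) + (16 * M + 16 * F))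
    e₂ = solve-∀
    e₃ : ∀ g q → 2 * (8 * g) + (2 * (6 * q) + (q + q)) ≡ 2 * (8 * g) + 14 * q
    e₃ = solve-∀
    8L≤6q : 8 * L ≤ 6 * q
    8L≤6q = ℕ.*-cancelˡ-≤ n {{>-nonZero 0<n}} (begin
      n * (8 * L)  ≡⟨ f₁ n L ⟩
      L * (8 * n)  ≤⟨ ℕ.*-monoʳ-≤ L 8n≤3D ⟩
      L * (3 * D)  ≡⟨ f₂ L D ⟩
      3 * (L * D)  ≤⟨ ℕ.*-monoʳ-≤ 3 LD≤ ⟩
      3 * (2 * n * q)  ≡⟨ f₃ n q ⟩
      n * (6 * q)  ∎)
      where
      f₁ : ∀ n L → n * (8 * L) ≡ L * (8 * n)
      f₁ = solve-∀
      f₂ : ∀ L D → L * (3 * D) ≡ 3 * (L * D)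
      f₂ = solve-∀
      f₃ : ∀ n q → 3 * (2 * n * q) ≡ n * (6 * q)
      f₃ = solve-∀
    16M≤q : 16 * M ≤ q
    16M≤q = ℕ.*-cancelˡ-≤ 50 (begin
      50 * (16 * M)  ≡⟨ ℕ.*-assoc 50 16 M ⟨
      800 * M  ≡⟨ ℕ.*-comm 800 M ⟩
      M * 800  ≤⟨ ℕ.*-monoʳ-≤ M 800≤E ⟩
      M * E  ≤⟨ ME≤ ⟩
      25 * (q * 2)  ≡⟨ cong (25 *_) (ℕ.*-comm q 2) ⟩
      25 * (2 * q)  ≡⟨ ℕ.*-assoc 25 2 q ⟨
      50 * q  ∎)
    FE≤8q : F * E ≤ 8 * q
    FE≤8q = ℕ.*-cancelʳ-≤ (F * E) (8 * q) E {{>-nonZero (ℕ.<-≤-trans (s≤s z≤n) 800≤E)}} (begin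
      F * E * E  ≡⟨ ℕ.*-assoc F E E ⟩
      F * (E * E)  ≤⟨ FE²≤ ⟩
      N * (q * 2 * 2)  ≤⟨ ℕ.*-monoˡ-≤ (q * 2 * 2) N≤2E ⟩
      2 * E * (q * 2 * 2)  ≡⟨ f E q ⟩
      8 * q * E  ∎)
      where
      f : ∀ E q → 2 * E * (q * 2 * 2) ≡ 8 * q * E
      f = solve-∀
    16F≤q : 16 * F ≤ q
    16F≤q = ℕ.*-cancelˡ-≤ 8 (begin
      8 * (16 * F)  ≡⟨ ℕ.*-assoc 8 16 F ⟨
      128 * F  ≡⟨ ℕ.*-comm 128 F ⟩
      F * 128  ≤⟨ ℕ.*-monoʳ-≤ F (ℕ.≤-trans (ℕ.≤ᵇ⇒≤ 128 800 tt) 800≤E) ⟩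
      F * E  ≤⟨ FE≤8q ⟩
      8 * q  ∎)

-- Placements that avoid every bad event

sum-map-++ : ∀ {I : Set} (g : I → ℕ) xs ys → sum (map g (xs ++ ys)) ≡ sum (map g xs) + sum (map g ys)
sum-map-++ g xs ys = trans (cong sum (List.map-++ g xs ys)) (sum-++ (map g xs) (map g ys))

sum-map-map : ∀ {I K : Set} (g : K → ℕ) (f : I → K) xs → sum (map g (map f xs)) ≡ sum (map (λ x → g (f x)) xs)
sum-map-map g f xs = cong sum (sym (List.map-∘ xs))

module Good (j m t u : ℕ) .{{_ : NonZero t}} .{{_ : NonZero (t * suc u)}}
  (tu≡2N : t * u ≡ rowCount (suc m) * Array.k j + rowCount (suc m) * Array.k j) (9≤u : 9 ≤ u) (t∣v : t ∣ t * suc u)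
  where

  open ArrayLines j m
  open Bounds j m t u tu≡2N 9≤u t∣v
  open Cyclic v

  Event : Set
  Event = (Bool × Row (suc m)) ⊎ A

  Bad : Event → Ω → Set
  Bad (inj₁ (b , q)) = ZeroLine b q
  Bad (inj₂ a)       = Spurious a

  bad? : ∀ e → Decidable (Bad e)
  bad? (inj₁ (b , q)) = zeroLine? b q
  bad? (inj₂ a)       = spurious? a

  lines : List (Bool × Row (suc m))
  lines = cartesianProduct (true ∷ false ∷ []) (rows (suc m))

  events : List Event
  events = map inj₁ lines ++ (map inj₂ nearCells ++ map inj₂ farCells)

  ∈-line-events : ∀ b q → inj₁ (b , q) ∈ events
  ∈-line-events b q = ∈-++⁺ˡ (∈-map⁺ inj₁ (∈-cartesianProduct⁺ (∈-bools b) (∈-rows q)))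
    where
    ∈-bools : ∀ b → b ∈ true ∷ false ∷ []
    ∈-bools true  = here refl
    ∈-bools false = there (here refl)

  ∈-cell-events : ∀ a → inj₂ a ∈ events
  ∈-cell-events a = ∈-++⁺ʳ (map inj₁ lines) (cases (Any.any? (a ≟ᵃ_) nearCells))
    where
    cases : Dec (a ∈ nearCells) → inj₂ a ∈ map inj₂ nearCells ++ map inj₂ farCells
    cases (yes a∈) = ∈-++⁺ˡ (∈-map⁺ inj₂ a∈)
    cases (no a∉)  = ∈-++⁺ʳ (map inj₂ nearCells) (∈-map⁺ inj₂ (∈-filter⁺ (λ a → ¬? (Any.any? (a ≟ᵃ_) nearCells)) (∈-cells a) a∉))

  IsGood : Ω → Set
  IsGood ω = Q ω × All (λ e → ¬ Bad e ω) events

  good? : Decidable IsGood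
  good? ω = Q? ω ×-dec All.all? (λ e → ¬? (bad? e ω)) events

  bad∧Q? : ∀ e → Decidable (λ ω → Bad e ω × Q ω)
  bad∧Q? e ω = bad? e ω ×-dec Q? ω

  private
    count : Event → ℕ
    count e = # (bad∧Q? e)

    ΣL ΣM ΣF : ℕ
    ΣL = sum (map (λ l → count (inj₁ l)) lines)
    ΣM = sum (map (λ a → count (inj₂ a)) nearCells)
    ΣF = sum (map (λ a → count (inj₂ a)) farCells)

    Σ-events : sum (map count events) ≡ ΣL + (ΣM + ΣF)
    Σ-events = begin
      sum (map count events)  ≡⟨ sum-map-++ count (map inj₁ lines) (map inj₂ nearCells ++ map inj₂ farCells) ⟩
      sum (map count (map inj₁ lines)) + sum (map count (map inj₂ nearCells ++ map inj₂ farCells))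
        ≡⟨ cong (λ z → sum (map count (map inj₁ lines)) + z) (sum-map-++ count (map inj₂ nearCells) (map inj₂ farCells)) ⟩
      sum (map count (map inj₁ lines)) + (sum (map count (map inj₂ nearCells)) + sum (map count (map inj₂ farCells)))
        ≡⟨ cong₂ (λ x y → x + y) (sum-map-map count inj₁ lines)
             (cong₂ (λ x y → x + y) (sum-map-map count inj₂ nearCells) (sum-map-map count inj₂ farCells)) ⟩
      ΣL + (ΣM + ΣF) ∎
      where open ≡-Reasoning

    Q≤ : # Q? ≤ # good? + (ΣL + (ΣM + ΣF))
    Q≤ = subst (λ z → # Q? ≤ # good? + z) Σ-events (#-union bad∧Q? Q? good? events cover)
      where
      cover : ∀ {ω} → Q ω → IsGood ω ⊎ Any (λ e → Bad e ω × Q ω) events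
      cover {ω} q = cases (Any.any? (λ e → bad? e ω) events)
        where
        cases : Dec (Any (λ e → Bad e ω) events) → IsGood ω ⊎ Any (λ e → Bad e ω × Q ω) events
        cases (yes bad) = inj₂ (Any.map (_, q) bad)
        cases (no good) = inj₁ (q , All.¬Any⇒All¬ events good)

    n = rowCount (suc m)

    length-lines : length lines ≡ 2 * n
    length-lines = trans (length-cartesianProduct (true ∷ false ∷ []) (rows (suc m))) (cong (2 *_) (length-rows (suc m)))

    length-farCells : length farCells ≤ N
    length-farCells = subst (length farCells ≤_) length-cells (List.length-filter (λ a → ¬? (Any.any? (a ≟ᵃ_) nearCells)) cells)

    ΣL≤ : ΣL * (N ∸ (k + 5)) ≤ 2 * n * # Q?
    ΣL≤ = subst (λ z → ΣL * (N ∸ (k + 5)) ≤ z * # Q?) length-lines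
      (sum-map-≤ lines (λ l → count (inj₁ l)) (λ {(b , q)} _ → zeroLine-bound b q))

    ΣM≤ : ΣM * (N ∸ 10) ≤ 25 * (# Q? * 2)
    ΣM≤ = sum-map-≤ nearCells (λ a → count (inj₂ a)) (λ {a} _ → spurious-bound a)

    ΣF≤ : ΣF * ((N ∸ 10) * (N ∸ 10)) ≤ N * (# Q? * 2 * 2)
    ΣF≤ = ℕ.≤-trans (sum-map-≤ farCells (λ a → count (inj₂ a)) (λ {a} a∈ → subst (_≤ # Q? * 2 * 2) (ℕ.*-assoc (count (inj₂ a)) (N ∸ 10) (N ∸ 10))
        (spurious-bound² a (proj₂ (∈-filter⁻ (λ a → ¬? (Any.any? (a ≟ᵃ_) nearCells)) {xs = cells} a∈)))))
      (ℕ.*-monoˡ-≤ (# Q? * 2 * 2) length-farCells)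

  goodList : List Ω
  goodList = filter good? configurations

  goodList-large : 24 ≤ rowCount (suc m) → 1000 ≤ N → N ! ≤ length goodList
  goodList-large 24≤n 1000≤N = ℕ.*-cancelˡ-≤ (2 ^ N) {{ℕ.m^n≢0 2 N}} (begin
    2 ^ N * N !  ≤⟨ configurations-bound ⟩
    # Q? * (2 * N) ^ 5  ≤⟨ ℕ.*-monoˡ-≤ ((2 * N) ^ 5) q≤8g ⟩
    8 * # good? * (2 * N) ^ 5  ≡⟨ shuffle (# good?) ((2 * N) ^ 5) ⟩
    8 * (2 * N) ^ 5 * # good?  ≤⟨ ℕ.*-monoˡ-≤ (# good?) (8*[2n]^5≤2^n N (ℕ.≤-trans (ℕ.≤ᵇ⇒≤ 64 1000 tt) 1000≤N)) ⟩
    2 ^ N * # good?  ∎)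
    where
    open ℕ.≤-Reasoning
    shuffle : ∀ g x → 8 * g * x ≡ 8 * x * g
    shuffle = solve-∀
    -- For k = 3 this reads 8 n + 24 ≤ 9 n, which is where 24 ≤ n comes from. It keeps the total
    -- cost 2 n / (N - (k + 5)) of the zero lines below or equal to 3/4.
    8n≤3D : 8 * n ≤ 3 * (N ∸ (k + 5))
    8n≤3D = subst (8 * n ≤_) (sym (ℕ.*-distribˡ-∸ 3 N (k + 5))) (ℕ.m+n≤o⇒m≤o∸n (8 * n) (begin
      8 * n + 3 * (k + 5)  ≡⟨ e₁ n j ⟩
      8 * n + 24 + (j + j) * 3  ≤⟨ ℕ.+-mono-≤ (ℕ.+-monoʳ-≤ (8 * n) 24≤n) (ℕ.*-monoʳ-≤ (j + j) (ℕ.≤-trans (ℕ.≤ᵇ⇒≤ 3 24 tt) (ℕ.≤-trans 24≤n (ℕ.m≤n*m n 3)))) ⟩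
      8 * n + n + (j + j) * (3 * n)  ≡⟨ e₂ n j ⟩
      3 * N  ∎))
      where
      e₁ : ∀ n j → 8 * n + 3 * (3 + (j + j) + 5) ≡ 8 * n + 24 + (j + j) * 3
      e₁ = solve-∀
      e₂ : ∀ n j → 8 * n + n + (j + j) * (3 * n) ≡ 3 * (n * (3 + (j + j)))
      e₂ = solve-∀
    N≤2E : N ≤ 2 * (N ∸ 10)
    N≤2E = subst (N ≤_) (sym (ℕ.*-distribˡ-∸ 2 N 10)) (ℕ.m+n≤o⇒m≤o∸n N (begin
      N + 20  ≤⟨ ℕ.+-monoʳ-≤ N (ℕ.≤-trans (ℕ.≤ᵇ⇒≤ 20 1000 tt) 1000≤N) ⟩
      N + N  ≡⟨ cong (λ z → N + z) (ℕ.+-identityʳ N) ⟨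
      2 * N  ∎))
    q≤8g : # Q? ≤ 8 * # good?
    q≤8g = remaining≥⅛ (# Q?) (# good?) ΣL ΣM ΣF n N (N ∸ (k + 5)) (N ∸ 10) Q≤
      (ℕ.<-≤-trans (s≤s z≤n) 24≤n) 8n≤3D
      -- 800 is 16 times 50: the 25 near cells cost 2 / (N - 10) each and may use up 1/16.
      (ℕ.m+n≤o⇒m≤o∸n 800 (ℕ.≤-trans (ℕ.≤ᵇ⇒≤ 810 1000 tt) 1000≤N)) N≤2E ΣL≤ ΣM≤ ΣF≤

  module Arch = Archdeacon v t t∣v 1∉J row col transitive
  open Arch

  embed-config : Ω → Embedding Γ
  embed-config ω = Labelled.embedding (labelled ω)

  marked : ∀ {ω} → IsGood ω → Marked (labelled ω)
  marked {ω} (q , good) = record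
    { values = Q⇒Forced q
    ; unique = λ a T→a T←a → cases a T→a T←a (a ≟ᵃ a₀) }
    where
    cases : ∀ a → T→ a ω → T← a ω → Dec (a ≡ a₀) → a ≡ a₀
    cases a T→a T←a (yes e)   = e
    cases a T→a T←a (no a≢a₀) = contradiction (a≢a₀ , T→a , T←a) (All.lookup good (∈-cell-events a))

  lineSum≢0 : ∀ {ω} → IsGood ω → ∀ b a → lineSum (val ω) b a k ≢ [ 0 ]
  lineSum≢0 {ω} (q , good) b a e = All.lookup good (∈-line-events b (proj₁ (place b a))) (trans (sym (begin
    lineSum (val ω) b a k  ≡⟨ cong (λ z → lineSum (val ω) b z k) reached ⟨
    lineSum (val ω) b (iterate (line→ b) rep (proj₁ path)) k  ≡⟨ lineSum-iterate (val ω) b rep (proj₁ path) ⟩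
    lineSum (val ω) b rep k  ∎)) e)
    where
    open ≡-Reasoning
    rep = representative b (proj₁ (place b a))
    path = on-line b (proj₁ (place b a)) (proj₁ (line-representative b (proj₁ (place b a)))) (proj₂ (place b a))
    reached : iterate (line→ b) rep (proj₁ path) ≡ a
    reached = trans (proj₂ path) (place-involutive b a)

  partialSum≢0 : ∀ {ω} → IsGood ω → ∀ b a → Labelled.partialSum (labelled ω) b a k ≢ [ 0 ]
  partialSum≢0 {ω} g true  a e = lineSum≢0 g true a (trans (sym (same a k)) e)
    where
    same : ∀ a n → Labelled.partialSum (labelled ω) true a n ≡ lineSum (val ω) true a n
    same a zero    = refl
    same a (suc n) = cong (val ω a ⊕_) (same (line→ true a) n)
  partialSum≢0 {ω} g false a e = lineSum≢0 g false a (neg-injective {lineSum (val ω) false a k} {[ 0 ]} (trans (sym (negated a k)) (trans e (sym neg-0))))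
    where
    negated : ∀ a n → Labelled.partialSum (labelled ω) false a n ≡ neg (lineSum (val ω) false a n)
    negated a zero    = sym neg-0
    negated a (suc n) = trans (cong₂ _⊕_ (Labelling.val-not (labelled ω) a true) (negated (line→ false a) n))
      (neg-⊕ (val ω a) (lineSum (val ω) false (line→ false a) n))

  private
    line-period′ : ∀ b a → iterate (Arch.line b) a k ≡ a
    line-period′ true  = line-period true
    line-period′ false = line-period false

    line-period⁻¹′ : ∀ b a i → iterate (Arch.line b) a i ≡ a → k ∣ i
    line-period⁻¹′ true  = line-period⁻¹ true
    line-period⁻¹′ false = line-period⁻¹ false

  module GoodFaces {ω} (g : IsGood ω) = Labelled.Faces (labelled ω) k
    line-period′ line-period⁻¹′
    (partialSum≢0 g)

  autIsTranslations : ∀ {ω} → IsGood ω → AutIsTranslations (embed-config ω)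
  autIsTranslations {ω} g = (λ x → Arch.translation x , Labelled.translation-automorphism (labelled ω) x , (λ _ → refl))
    , (λ σ iso → proj₁ (iso-translation (labelled ω) (labelled ω) (marked g) (marked g) σ iso))

  non-isomorphic : ∀ {ω ω′} → IsGood ω → IsGood ω′ → Isomorphic (embed-config ω) (embed-config ω′) → ω ≡ ω′
  non-isomorphic {ω} {ω′} g g′ (σ , iso) = val-ext {ω} {ω′}
    (proj₂ (iso-translation (labelled ω) (labelled ω′) (marked g) (marked g′) σ iso))

-- The family of biembeddings

lookup-injective : ∀ {X : Set} {xs : List X} → Unique xs → ∀ i i′ → lookup xs i ≡ lookup xs i′ → i ≡ i′
lookup-injective (x∉ ∷ xs!) Fin.zero    Fin.zero     e = refl
lookup-injective (x∉ ∷ xs!) Fin.zero    (Fin.suc i′) e = contradiction e (All.lookup x∉ (∈-lookup i′))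
lookup-injective (x∉ ∷ xs!) (Fin.suc i) Fin.zero     e = contradiction (sym e) (All.lookup x∉ (∈-lookup i))
lookup-injective (x∉ ∷ xs!) (Fin.suc i) (Fin.suc i′) e = cong Fin.suc (lookup-injective xs! i i′ e)

BiembeddingFamily : (v t k M : ℕ) .{{_ : NonZero v}} .{{_ : NonZero t}} → t ∣ v → Set
BiembeddingFamily v t k M t∣v = Σ[ Π ∈ (Fin M → Embedding (K v t t∣v)) ]
    (∀ i → IsBiembedding (Π i))
  × (∀ i i′ → i ≢ i′ → ¬ Isomorphic (Π i) (Π i′))
  × (∀ i → AutIsTranslations (Π i))
  × (∀ i d → ∃[ ℓ ] HasFaceLength (Π i) d ℓ × k ∣ ℓ × k < ℓ)
  × (Prime v → ∀ i → Gonal (Π i) (k * v))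

large-family : ∀ j m t u .{{_ : NonZero t}} .{{_ : NonZero (t * suc u)}} (let k = 3 + (j + j); N = rowCount (suc m) * k) →
  t * u ≡ N + N → 9 ≤ u → (t∣v : t ∣ t * suc u) → 24 ≤ rowCount (suc m) → 1000 ≤ N →
  ∃[ M ] N ! ≤ M × BiembeddingFamily (t * suc u) t k M t∣v
large-family j m t u tu≡2N 9≤u t∣v 24≤n 1000≤N = length goodList , goodList-large 24≤n 1000≤N , (λ i → embed-config (lookup goodList i))
  , (λ i → Arch.Labelled.isBiembedding (labelled (lookup goodList i)))
  , (λ i i′ i≢i′ iso → i≢i′ (lookup-injective (Unique.filter⁺ good? configurations-unique) i i′ (non-isomorphic (good i) (good i′) iso)))
  , (λ i → autIsTranslations (good i))
  , (λ i → GoodFaces.faceLengths (good i))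
  , (λ v-prime i → GoodFaces.gonal (good i) v-prime)
  where
  open Good j m t u tu≡2N 9≤u t∣v
  open Bounds j m t u tu≡2N 9≤u t∣v using (configurations; configurations-unique; labelled)
  good : ∀ i → IsGood (lookup goodList i)
  good i = proj₂ (∈-filter⁻ good? {xs = configurations} (∈-lookup i))

rowCount-odd : ∀ m → rowCount m ≡ suc (m + m)
rowCount-odd zero    = refl
rowCount-odd (suc m) = trans (cong (_+ 2) (rowCount-odd m)) (lemma m)
  where
  lemma : ∀ m → suc (m + m) + 2 ≡ suc (suc m + suc m)
  lemma = solve-∀

odd-factors : ∀ n k → ¬ (2 ∣ n * k) → 3 ≤ k → 3 ≤ n →
  ∃[ m ] ∃[ j ] n ≡ rowCount (suc m) × k ≡ 3 + (j + j)
odd-factors n k odd 3≤k 3≤n with parity n | parity k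
... | i , inj₁ refl | _ = contradiction (divides (i * k) (lemma i k)) odd
  where
  lemma : ∀ i k → (i + i) * k ≡ i * k * 2
  lemma = solve-∀
... | _ | i , inj₁ refl = contradiction (divides (n * i) (lemma n i)) odd
  where
  lemma : ∀ n i → n * (i + i) ≡ n * i * 2
  lemma = solve-∀
... | zero , inj₂ refl | _ = contradiction 3≤n λ { (s≤s ()) }
... | _ | zero , inj₂ refl = contradiction 3≤k λ { (s≤s ()) }
... | suc m , inj₂ refl | suc j , inj₂ refl = m , j , sym (rowCount-odd (suc m)) , cong (λ z → suc (suc z)) (ℕ.+-suc j j)

regime-odd : ∀ {n k} → Regime n k → ¬ (2 ∣ n * k) × 3 ≤ k
regime-odd (coprime odd _ 3≤k _) = odd , 3≤k
regime-odd (small-k odd _ 3<k _) = odd , ℕ.<⇒≤ 3<k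
regime-odd (large-n odd _ 3≤k _) = odd , 3≤k

-- The threshold serves two ends. As t u = 2 n k, the part 9 t gives 9 ≤ u; and n k ≥ 1000 with k <
-- n forces 24 ≤ n, since n ≤ 23 would leave n k at most 23 times 22.
admissible-family : ∀ t n k v .{{_ : NonZero t}} .{{_ : NonZero v}} → v ≡ 2 * n * k + t → Admissible t n k →
  1000 + 9 * t ≤ n * k → (t∣v : t ∣ v) → ∃[ M ] (n * k) ! ≤ M × BiembeddingFamily v t k M t∣v
admissible-family t n k v v≡ adm large t∣v = from (Admissible.t∣2nk adm) (odd-factors n k odd 3≤k (ℕ.≤-trans 3≤k (ℕ.<⇒≤ k<n)))
  where
  open Admissible adm using (k<n)
  odd = proj₁ (regime-odd (Admissible.regime adm))
  3≤k = proj₂ (regime-odd (Admissible.regime adm))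
  1000≤nk : 1000 ≤ n * k
  1000≤nk = ℕ.m+n≤o⇒m≤o 1000 large
  24≤n : 24 ≤ n
  24≤n = ℕ.≮⇒≥ λ n<24 → ℕ.<⇒≱ (ℕ.<-≤-trans (ℕ.≤ᵇ⇒≤ 530 1000 tt) 1000≤nk)
    (ℕ.≤-trans (ℕ.*-mono-≤ (s≤s⁻¹ n<24) (s≤s⁻¹ (ℕ.<-≤-trans k<n (s≤s⁻¹ n<24)))) (ℕ.≤ᵇ⇒≤ (23 * 22) 529 tt))
  from : t ∣ 2 * n * k → ∃[ m ] ∃[ j ] n ≡ rowCount (suc m) × k ≡ 3 + (j + j) → ∃[ M ] (n * k) ! ≤ M × BiembeddingFamily v t k M t∣v
  from (divides u 2nk≡ut) (m , j , n≡ , k≡) = build v≡t*[1+u] n≡ k≡ t∣v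
    where
    open ≡-Reasoning
    tu≡2N : t * u ≡ n * k + n * k
    tu≡2N = begin
      t * u  ≡⟨ ℕ.*-comm t u ⟩
      u * t  ≡⟨ 2nk≡ut ⟨
      2 * n * k  ≡⟨ lemma n k ⟩
      n * k + n * k  ∎
      where
      lemma : ∀ n k → 2 * n * k ≡ n * k + n * k
      lemma = solve-∀
    v≡t*[1+u] : v ≡ t * suc u
    v≡t*[1+u] = begin
      v  ≡⟨ v≡ ⟩
      2 * n * k + t  ≡⟨ cong (_+ t) 2nk≡ut ⟩
      u * t + t  ≡⟨ lemma u t ⟩
      t * suc u  ∎
      where
      lemma : ∀ u t → u * t + t ≡ t * suc u
      lemma = solve-∀
    9≤u : 9 ≤ u
    9≤u = ℕ.*-cancelˡ-≤ t (ℕ.≤-trans (ℕ.≤-reflexive (ℕ.*-comm t 9)) (ℕ.≤-trans (ℕ.m+n≤o⇒n≤o 1000 large)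
      (ℕ.≤-trans (ℕ.m≤m+n (n * k) (n * k)) (ℕ.≤-reflexive (sym tu≡2N)))))
    build : ∀ {v} .{{_ : NonZero v}} → v ≡ t * suc u → n ≡ rowCount (suc m) → k ≡ 3 + (j + j) → (t∣v : t ∣ v) →
      ∃[ M ] (n * k) ! ≤ M × BiembeddingFamily v t k M t∣v
    build refl refl refl t∣v = large-family j m t u tu≡2N 9≤u t∣v 24≤n 1000≤nk

-- Rational bounds and the error term

private
  toℚᵘ-/ : ∀ a b .{{_ : NonZero b}} → ℚ.toℚᵘ (+ a / b) ℚᵘ.≃ (+ a ℚᵘ./ b)
  toℚᵘ-/ a (suc b) = ℚ.toℚᵘ-fromℚᵘ (ℚᵘ.mkℚᵘ (+ a) b)

/-≤-/ : ∀ a b c d .{{_ : NonZero b}} .{{_ : NonZero d}} → a * d ≤ c * b → + a / b ≤ℚ + c / d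
/-≤-/ a b@(suc _) c d@(suc _) h = ℚ.toℚᵘ-cancel-≤ (ℚᵘ.≤-respʳ-≃ (ℚᵘ.≃-sym (toℚᵘ-/ c d)) (ℚᵘ.≤-respˡ-≃ (ℚᵘ.≃-sym (toℚᵘ-/ a b))
  (ℚᵘ.*≤* (subst₂ ℤ._≤_ (ℤ.pos-* a d) (ℤ.pos-* c b) (ℤ.+≤+ h)))))

/-<-/ : ∀ a b c d .{{_ : NonZero b}} .{{_ : NonZero d}} → a * d < c * b → + a / b <ℚ + c / d
/-<-/ a b@(suc _) c d@(suc _) h = ℚ.toℚᵘ-cancel-< (ℚᵘ.<-respʳ-≃ (ℚᵘ.≃-sym (toℚᵘ-/ c d)) (ℚᵘ.<-respˡ-≃ (ℚᵘ.≃-sym (toℚᵘ-/ a b))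
  (ℚᵘ.*<* (subst₂ ℤ._<_ (ℤ.pos-* a d) (ℤ.pos-* c b) (ℤ.+<+ h)))))

/-*-/ : ∀ a c d .{{_ : NonZero d}} → (+ a / 1) · (+ c / d) ≡ + (a * c) / d
/-*-/ a c d@(suc d-1) = ℚ.toℚᵘ-injective (begin
  ℚ.toℚᵘ ((+ a / 1) · (+ c / d))  ≈⟨ ℚ.toℚᵘ-homo-* (+ a / 1) (+ c / d) ⟩
  ℚ.toℚᵘ (+ a / 1) ℚᵘ.* ℚ.toℚᵘ (+ c / d)  ≈⟨ ℚᵘ.*-cong (toℚᵘ-/ a 1) (toℚᵘ-/ c d) ⟩
  (+ a ℚᵘ./ 1) ℚᵘ.* (+ c ℚᵘ./ d)  ≈⟨ ℚᵘ.*≡* (cong₂ ℤ._*_ (sym (ℤ.pos-* a c)) (cong (+_ ∘ suc) (sym (ℕ.+-identityʳ d-1)))) ⟩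
  + (a * c) ℚᵘ./ d  ≈⟨ toℚᵘ-/ (a * c) d ⟨
  ℚ.toℚᵘ (+ (a * c) / d)  ∎)
  where open ℚᵘ.≃-Reasoning

0≤/ : ∀ a b .{{_ : NonZero b}} → 0ℚ ≤ℚ + a / b
0≤/ a b = /-≤-/ 0 1 a b z≤n

∣/∣ : ∀ a b .{{_ : NonZero b}} → ℚ.∣ + a / b ∣ ≡ + a / b
∣/∣ a b = ℚ.0≤p⇒∣p∣≡p (0≤/ a b)

private
  -- Division takes its nonzeroness proof irrelevantly, so this one is interchangeable with the one
  -- inside `δ`.
  denominator : ∀ n k .{{_ : NonZero n}} .{{_ : NonZero k}} → NonZero (n * k ∸ (k ∸ 1))
  denominator n k@(suc _) = >-nonZero (ℕ.m<n⇒0<n∸m (ℕ.m≤n*m k n))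

δ<1 : ∀ n k .{{_ : NonZero n}} .{{_ : NonZero k}} → k < n → 3 ≤ k → δ n k <ℚ 1ℚ
δ<1 n k@(suc k-1) k<n 3≤k = /-<-/ (2 * n) (n * k ∸ k-1) 1 1 {{denominator n k}} (begin-strict
  2 * n * 1  ≡⟨ ℕ.*-identityʳ (2 * n) ⟩
  2 * n  <⟨ ℕ.m+n≤o⇒m≤o∸n (suc (2 * n)) (begin-strict
      2 * n + k-1  <⟨ ℕ.+-monoʳ-< (2 * n) (ℕ.<-trans ℕ.≤-refl k<n) ⟩
      2 * n + n  ≡⟨ triple n ⟩
      n * 3  ≤⟨ ℕ.*-monoʳ-≤ n 3≤k ⟩
      n * k  ∎) ⟩
  n * k ∸ k-1  ≡⟨ ℕ.*-identityˡ (n * k ∸ k-1) ⟨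
  1 * (n * k ∸ k-1)  ∎)
  where
  open ℕ.≤-Reasoning
  triple : ∀ n → 2 * n + n ≡ n * 3
  triple = solve-∀

0<1-δ : ∀ n k .{{_ : NonZero n}} .{{_ : NonZero k}} → k < n → 3 ≤ k → 0ℚ <ℚ 1ℚ - δ n k
0<1-δ n k k<n 3≤k = subst (_<ℚ 1ℚ - δ n k) (ℚ.+-inverseʳ (δ n k)) (ℚ.+-monoˡ-< (ℚ.- δ n k) (δ<1 n k k<n 3≤k))

-- As n ≥ 2, the denominator nk - (k - 1) is at least nk / 2, which gives the constant 4.
δ≤4/k : IsBigO (λ n k → k < n × 3 ≤ k) δ 1/k
δ≤4/k = + 4 / 1 , bound
  where
  bound : ∀ n k .{{_ : NonZero n}} .{{_ : NonZero k}} → k < n × 3 ≤ k → ℚ.∣ δ n k ∣ ≤ℚ (+ 4 / 1) · ℚ.∣ 1/k n k ∣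
  bound n k@(suc k-1) (k<n , 3≤k) = subst₂ _≤ℚ_ (sym (∣/∣ (2 * n) (n * k ∸ k-1) {{denominator n k}}))
    (sym (trans (cong ((+ 4 / 1) ·_) (∣/∣ 1 k)) (/-*-/ 4 1 k)))
    (/-≤-/ (2 * n) (n * k ∸ k-1) 4 k {{denominator n k}} (subst (2 * n * k ≤_) (sym (ℕ.*-distribˡ-∸ 4 (n * k) k-1))
      (ℕ.m+n≤o⇒m≤o∸n (2 * n * k) (begin
        2 * n * k + 4 * k-1  ≤⟨ ℕ.+-monoʳ-≤ (2 * n * k) (ℕ.*-mono-≤ {4} {2 * n} 4≤2n (ℕ.n≤1+n k-1)) ⟩
        2 * n * k + 2 * n * k  ≡⟨ lemma n k ⟩
        4 * (n * k)  ∎))))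
    where
    open ℕ.≤-Reasoning
    lemma : ∀ n k → 2 * n * k + 2 * n * k ≡ 4 * (n * k)
    lemma = solve-∀
    4≤2n : 4 ≤ 2 * n
    4≤2n = ℕ.*-monoʳ-≤ 2 (ℕ.≤-trans (ℕ.≤ᵇ⇒≤ 2 3 tt) (ℕ.≤-trans 3≤k (ℕ.<⇒≤ k<n)))

-- As the error only has to be O(1/nk), the bound may be made void below a
-- threshold.
errorBelow : ℕ → Fun₂
errorBelow M n k = if does (n * k ℕ.<? M) then 1ℚ else 0ℚ

private
  errorBelow-cases : ∀ M n k .{{_ : NonZero n}} .{{_ : NonZero k}} → (P : ℚ → Set) →
    (n * k < M → P 1ℚ) → (M ≤ n * k → P 0ℚ) → P (errorBelow M n k)
  errorBelow-cases M n k P below above = cases (n * k ℕ.<? M)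
    where
    cases : (d : Dec (n * k < M)) → P (if does d then 1ℚ else 0ℚ)
    cases (yes p) = below p
    cases (no ¬p) = above (ℕ.≮⇒≥ ¬p)

errorBelow-BigO : ∀ M D → IsBigO D (errorBelow M) 1/nk
errorBelow-BigO M D = + M / 1 , λ n k _ → errorBelow-cases M n k (λ e → ℚ.∣ e ∣ ≤ℚ (+ M / 1) · ℚ.∣ 1/nk n k ∣)
  (λ nk<M → subst (1ℚ ≤ℚ_) (sym (product n k)) (/-≤-/ 1 1 (M * 1) (n * k) {{_}} {{ℕ.m*n≢0 n k}} (begin
    1 * (n * k)  ≡⟨ ℕ.*-identityˡ (n * k) ⟩
    n * k  ≤⟨ ℕ.<⇒≤ nk<M ⟩
    M  ≡⟨ trans (ℕ.*-identityʳ (M * 1)) (ℕ.*-identityʳ M) ⟨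
    M * 1 * 1  ∎)))
  (λ _ → subst (0ℚ ≤ℚ_) (sym (product n k)) (0≤/ (M * 1) (n * k) {{ℕ.m*n≢0 n k}}))
  where
  open ℕ.≤-Reasoning
  product : ∀ n k .{{_ : NonZero n}} .{{_ : NonZero k}} → (+ M / 1) · ℚ.∣ 1/nk n k ∣ ≡ ℚ._/_ (+ (M * 1)) (n * k) {{ℕ.m*n≢0 n k}}
  product n k = trans (cong ((+ M / 1) ·_) (∣/∣ 1 (n * k) {{ℕ.m*n≢0 n k}})) (/-*-/ M 1 (n * k) {{ℕ.m*n≢0 n k}})

errorBelow-LittleO1 : ∀ M D → IsLittleO1 D (errorBelow M)
errorBelow-LittleO1 M D η 0<η = M , λ n k _ M≤nk → errorBelow-cases M n k (λ e → ℚ.∣ e ∣ <ℚ η)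
  (λ nk<M → contradiction nk<M (ℕ.≤⇒≯ M≤nk)) (λ _ → 0<η)

prime-modulus : ∀ {t n k v} .{{_ : NonZero n}} .{{_ : NonZero k}} → v ≡ 2 * n * k + t → t ∣ v → Prime v → t ≡ 1
prime-modulus {t} {n} {k} v≡ t∣v v-prime with prime⇒irreducible v-prime t∣v
... | inj₁ t≡1 = t≡1
... | inj₂ t≡v = contradiction (ℕ.+-cancelʳ-≡ t (2 * n * k) 0 (trans (sym v≡) (sym t≡v)))
  (λ e → ℕ.<-irrefl (sym e) (>-nonZero⁻¹ (2 * n * k) {{ℕ.m*n≢0 (2 * n) k {{ℕ.m*n≢0 2 n}}}}))

-- Applied with x = (nk)!. Since the family already has x members, the factor 1 - p and the divisor
-- 2 φ(v) are simply given away.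
size-bound : ∀ p x v N .{{_ : NonZero v}} → 0ℚ <ℚ 1ℚ - p → 0ℚ ≤ℚ p → x ≤ N →
  (1ℚ - p) · (1ℚ - 0ℚ) · (x /2φ v) ≤ℚ + N / 1
size-bound p x v N 0<1-p 0≤p x≤N = begin
  (1ℚ - p) · (1ℚ - 0ℚ) · (x /2φ v)  ≡⟨ cong (_· (x /2φ v)) (ℚ.*-identityʳ (1ℚ - p)) ⟩
  (1ℚ - p) · (x /2φ v)  ≤⟨ ℚ.*-monoʳ-≤-nonNeg (x /2φ v) {{ℚ.nonNegative (0≤/ x (2 * φ v) {{2φ≢0}})}} 1-p≤1 ⟩
  1ℚ · (x /2φ v)  ≡⟨ ℚ.*-identityˡ (x /2φ v) ⟩
  x /2φ v  ≤⟨ /-≤-/ x (2 * φ v) N 1 {{2φ≢0}} (ℕ.*-mono-≤ x≤N (>-nonZero⁻¹ (2 * φ v) {{2φ≢0}})) ⟩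
  + N / 1  ∎
  where
  open ℚ.≤-Reasoning
  2φ≢0 : NonZero (2 * φ v)
  2φ≢0 = ℕ.m*n≢0 2 (φ v) {{_}} {{φ-nonZero v}}
  1-p≤1 : 1ℚ - p ≤ℚ 1ℚ
  1-p≤1 = subst (1ℚ - p ≤ℚ_) (ℚ.+-identityʳ 1ℚ) (ℚ.+-monoʳ-≤ 1ℚ (ℚ.neg-antimono-≤ 0≤p))

half-[v-t] : ∀ {t n k v} → v ≡ 2 * n * k + t → n * k ≡ (v ∸ t) ÷ 2
half-[v-t] {t} {n} {k} refl = sym (trans (cong (_÷ 2) (trans (ℕ.m+n∸n≡m (2 * n * k) t) (lemma n k))) (m*n/n≡m (n * k) 2))
  where
  lemma : ∀ n k → 2 * n * k ≡ n * k * 2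
  lemma = solve-∀

theorem5p8 : ∀ (t : ℕ) .{{_ : NonZero t}} → t % 4 ≢ 0 →
    Σ[ ε ∈ Fun₂ ]
    IsBigO (Admissible t) ε 1/nk
    × IsLittleO1 (Admissible t) ε
    × IsBigO (λ n k → k < n × 3 ≤ k) δ 1/k
    × (∀ n k .{{_ : NonZero n}} .{{_ : NonZero k}} → k < n → 3 ≤ k → 0ℚ <ℚ 1ℚ - δ n k)
    × (∀ n k v .{{_ : NonZero n}} .{{_ : NonZero k}} .{{_ : NonZero v}} →
    (v≡ : v ≡ 2 * n * k + t) (adm : Admissible t n k) →
    Σ[ N ∈ ℕ ] Σ[ Π ∈ (Fin N → Embedding (K v t (subst (t ∣_) (sym v≡) (t∣2nk+t adm)))) ]
    (∀ i → IsBiembedding (Π i))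
    × (∀ i j → i ≢ j → ¬ Isomorphic (Π i) (Π j))
    × (∀ i → AutIsTranslations (Π i))
    × (∀ i d → ∃[ ℓ ] HasFaceLength (Π i) d ℓ × k ∣ ℓ × k < ℓ)
    × (1ℚ - δ n k) · (1ℚ - ε n k) · ((n * k) ! /2φ v) ≤ℚ + N / 1
    × (1ℚ - δ n k) · (1ℚ - ε n k) · ((n * k) ! /2φ v)
    ≡ (1ℚ - δ n k) · (1ℚ - ε n k) · (((v ∸ t) ÷ 2) ! /2φ v)
    × (Prime v → t ≡ 1 × (∀ i → Gonal (Π i) (k * v))))
theorem5p8 t _ = errorBelow M , errorBelow-BigO M (Admissible t) , errorBelow-LittleO1 M (Admissible t) , δ≤4/k , 0<1-δ , families
  where
  -- Depends on t alone, as the constant implied in O(1 / nk) must.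
  M = 1000 + 9 * t
  families : ∀ n k v .{{_ : NonZero n}} .{{_ : NonZero k}} .{{_ : NonZero v}} →
    (v≡ : v ≡ 2 * n * k + t) (adm : Admissible t n k) →
    Σ[ N ∈ ℕ ] Σ[ Π ∈ (Fin N → Embedding (K v t (subst (t ∣_) (sym v≡) (t∣2nk+t adm)))) ]
    (∀ i → IsBiembedding (Π i))
    × (∀ i j → i ≢ j → ¬ Isomorphic (Π i) (Π j))
    × (∀ i → AutIsTranslations (Π i))
    × (∀ i d → ∃[ ℓ ] HasFaceLength (Π i) d ℓ × k ∣ ℓ × k < ℓ)
    × (1ℚ - δ n k) · (1ℚ - errorBelow M n k) · ((n * k) ! /2φ v) ≤ℚ + N / 1
    × (1ℚ - δ n k) · (1ℚ - errorBelow M n k) · ((n * k) ! /2φ v)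
    ≡ (1ℚ - δ n k) · (1ℚ - errorBelow M n k) · (((v ∸ t) ÷ 2) ! /2φ v)
    × (Prime v → t ≡ 1 × (∀ i → Gonal (Π i) (k * v)))
  families n k v v≡ adm = assemble (errorBelow-cases M n k Family-at small (large ∘ (λ M≤nk → admissible-family t n k v v≡ adm M≤nk t∣v)))
    where
    t∣v : t ∣ v
    t∣v = subst (t ∣_) (sym v≡) (t∣2nk+t adm)
    3≤k : 3 ≤ k
    3≤k = proj₂ (regime-odd (Admissible.regime adm))
    Family-at : ℚ → Set
    Family-at e = ∃[ N ] BiembeddingFamily v t k N t∣v × (1ℚ - δ n k) · (1ℚ - e) · ((n * k) ! /2φ v) ≤ℚ + N / 1
    -- With ε = 1 the required size is 0, which the empty family meets.
    small : n * k < M → Family-at 1ℚ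
    small _ = 0 , ((λ ()) , (λ ()) , (λ ()) , (λ ()) , (λ ()) , (λ _ ()))
      , ℚ.≤-reflexive (trans (cong (_· ((n * k) ! /2φ v)) (ℚ.*-zeroʳ (1ℚ - δ n k))) (ℚ.*-zeroˡ ((n * k) ! /2φ v)))
    large : ∃[ N ] (n * k) ! ≤ N × BiembeddingFamily v t k N t∣v → Family-at 0ℚ
    large (N , size , family) = N , family , size-bound (δ n k) ((n * k) !) v N
      (0<1-δ n k (Admissible.k<n adm) 3≤k) (0≤/ (2 * n) (n * k ∸ (k ∸ 1)) {{denominator n k}}) size
    assemble : Family-at (errorBelow M n k) → _
    assemble (N , (Π , bi , non-iso , aut , faces , gon) , bound) = N , Π , bi , non-iso , aut , faces , bound
      , cong (λ x → (1ℚ - δ n k) · (1ℚ - errorBelow M n k) · (x ! /2φ v)) (half-[v-t] {t} {n} {k} v≡)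
      , (λ v-prime → prime-modulus {t} {n} {k} v≡ t∣v v-prime , gon v-prime)
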